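{- $\widetilde{{\rm CLU\#P}}_{\rm circular}={\rm CLU\#P}$, where $\widetilde{{\rm CLU\#P}}_{\rm circular}$ is the class of all functions $f$ for which there exist $p$, $M$, $\prec$ witnessing $f\in{\rm CLU\#P_{circular}}$ such that $\{x: f(x)=2^{p(|x|)}\}\in{\rm P}$.
   Context: Alphabet $\Sigma=\{0,1\}$; NPTM = nondeterministic polynomial-time Turing machine. For a polynomial $p$, an NPTM $M$ is $p$-balanced if on every input $x$ its computation paths correspond exactly to the guess strings in $\{0,1\}^{p(|x|)}$; paths are identified with guess strings. $\mathrm{acc}_M(x)$ is the set of accepting paths, $\#\mathrm{acc}_M(x)$ its size. ${\rm FP}_{\rm t}$: total polynomial-time computable functions. For same-length strings, $a\prec_{\rm lex}b$ means $b$ is the immediate lexicographic successor of $a$; $\le_{\rm lex}$ is lexicographic order. ${\rm CLU\#P}$: total $f:\Sigma^*\to\mathbb{N}$ such that there exist a polynomial $p$, a $p$-balanced NPTM $M$, $b,t\in{\rm FP}_{\rm t}$ and a polynomial-time 3-argument predicate $\prec$ such that for every $x$ there is a bijection $h_x$ of $\Sigma^{p(|x|)}$ with: $|b(x)|=|t(x)|=p(|x|)$; $h_x(b(x))=0^{p(|x|)}$, $h_x(t(x))=1^{p(|x|)}$; for $y,z\in\{0,1\}^{p(|x|)}$, $\prec(x,y,z)$ iff $h_x(y)\prec_{\rm lex}h_x(z)$; if $f(x)\neq0$ there exist $\ell,u$ with $\mathrm{acc}_M(x)=\{w\in\{0,1\}^{p(|x|)}: h_x(\ell)\le_{\rm lex}h_x(w)\le_{\rm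 lex}h_x(u)\}$; $f(x)=\#\mathrm{acc}_M(x)$. $p,M,\prec$ witness $f\in{\rm CLU\#P_{circular}}$ if $p$ is a polynomial, $M$ a $p$-balanced NPTM, $\prec$ a polynomial-time 3-argument predicate, and for every $x$ there is a bijection $h_x$ of $\Sigma^{p(|x|)}$ with: for $y,z\in\{0,1\}^{p(|x|)}$, $\prec(x,y,z)$ iff $h_x(y)\prec_{\rm lex}h_x(z)$ or ($h_x(y)=1^{p(|x|)}$ and $h_x(z)=0^{p(|x|)}$); if $f(x)\neq0$ there exist $\ell,u$ with $\mathrm{acc}_M(x)=\{w: h_x(\ell)\le_{\rm lex}h_x(w)\le_{\rm lex}h_x(u)\}$; and $f(x)=\#\mathrm{acc}_M(x)$. -}

module Defs where

open import Data.Nat using (ℕ; zero; suc; _+_; _*_; _^_; _≤_)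
open import Data.Bool using (Bool; true; false; if_then_else_)
open import Data.Fin using (Fin; zero; suc)
open import Data.List using (List; []; _∷_; length; map; _++_)
open import Data.Vec using (Vec; []; _∷_; toList; replicate)
open import Data.Maybe using (Maybe; just; nothing)
open import Data.Product using (Σ; _×_; _,_)
open import Data.Empty using (⊥)
open import Relation.Binary.PropositionalEquality using (_≡_; _≢_)
open import Function.Bundles using (_⤖_; Bijection)

Poly : Set
Poly = List ℕ

eval : Poly → ℕ → ℕ
eval [] n = 0
eval (c ∷ cs) n = c + n * eval cs n

-- Deterministic single-tape Turing machines over {0,1}
-- Tape symbols: Fin (3 + k); zero = blank, 1 = bit 0, 2 = bit 1, rest = work symbols.
-- States: Fin (suc q); start state is zero.  δ = nothing means "halt".
-- The tape is two-way infinite.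

data Move : Set where
  L R S : Move

record TM : Set where
  field
    nStates : ℕ
    nExtra  : ℕ
    δ : Fin (suc nStates) → Fin (3 + nExtra) →
        Maybe (Fin (suc nStates) × Fin (3 + nExtra) × Move)

record Config (M : TM) : Set where
  constructor cfg
  field
    state : Fin (suc (TM.nStates M))
    left  : List (Fin (3 + TM.nExtra M))   -- cells left of head, nearest first
    cur   : Fin (3 + TM.nExtra M)
    right : List (Fin (3 + TM.nExtra M))

module _ {M : TM} where
  open TM M

  Sym : Set
  Sym = Fin (3 + nExtra)

  blank : Sym
  blank = zero

  bitSym : Bool → Sym
  bitSym false = suc zero
  bitSym true  = suc (suc zero)

  symBit : Sym → Maybe Bool
  symBit (suc zero) = just false
  symBit (suc (suc zero)) = just true
  symBit _ = nothing

  readBits : List Sym → List Bool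
  readBits [] = []
  readBits (s ∷ ss) with symBit s
  ... | just b  = b ∷ readBits ss
  ... | nothing = []

  moveHead : Fin (suc nStates) → Move → List Sym → Sym → List Sym → Config M
  moveHead q L []       c r = cfg q [] blank (c ∷ r)
  moveHead q L (x ∷ l)  c r = cfg q l x (c ∷ r)
  moveHead q R l c []       = cfg q (c ∷ l) blank []
  moveHead q R l c (x ∷ r)  = cfg q (c ∷ l) x r
  moveHead q S l c r        = cfg q l c r

  step : Config M → Maybe (Config M)
  step (cfg q l c r) with δ q c
  ... | nothing = nothing
  ... | just (q' , s , m) = just (moveHead q' m l s r)

  run : ℕ → Config M → Maybe (Config M)
  run n c with step c
  run n       c | nothing = just c
  run zero    c | just _  = nothing
  run (suc n) c | just c' = run n c'

  initial : List Bool → Config M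
  initial x with map bitSym x
  ... | []     = cfg zero [] blank []
  ... | s ∷ ss = cfg zero [] s ss

  output : Config M → List Bool
  output (cfg _ _ c r) = readBits (c ∷ r)

runTM : (M : TM) → ℕ → List Bool → Maybe (List Bool)
runTM M n x with run {M} n (initial {M} x)
... | nothing = nothing
... | just c  = just (output {M} c)

pair : List Bool → List Bool → List Bool
pair [] w = false ∷ true ∷ w
pair (b ∷ x) w = b ∷ b ∷ pair x w

triple : List Bool → List Bool → List Bool → List Bool
triple x y z = pair x (pair y z)

ComputesIn : TM → Poly → (List Bool → List Bool) → Set
ComputesIn M q g = ∀ x → runTM M (eval q (length x)) x ≡ just (g x)

FP : (List Bool → List Bool) → Set
FP g = Σ TM λ M → Σ Poly λ q → ComputesIn M q g

PolyPred : (List Bool → Bool) → Set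
PolyPred P = Σ TM λ M → Σ Poly λ q →
  ∀ x → runTM M (eval q (length x)) x ≡ just (P x ∷ [])

PolyPred₂ : (List Bool → List Bool → Bool) → Set
PolyPred₂ P = Σ TM λ M → Σ Poly λ q →
  ∀ x y → runTM M (eval q (length (pair x y))) (pair x y) ≡ just (P x y ∷ [])

PolyPred₃ : (List Bool → List Bool → List Bool → Bool) → Set
PolyPred₃ P = Σ TM λ M → Σ Poly λ q →
  ∀ x y z → runTM M (eval q (length (triple x y z))) (triple x y z) ≡ just (P x y z ∷ [])

-- p-balanced NPTMs: computation paths are exactly the guess strings
-- w ∈ {0,1}^{p(|x|)}; path w on input x accepts iff V x w = true,
-- where V is decided in (deterministic) polynomial time.

record BalancedNPTM (p : Poly) : Set where
  field
    V      : List Bool → List Bool → Bool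
    V-poly : PolyPred₂ V

allVecs : ∀ n → List (Vec Bool n)
allVecs zero = [] ∷ []
allVecs (suc n) = map (false ∷_) (allVecs n) ++ map (true ∷_) (allVecs n)

countTrue : ∀ {n} → (Vec Bool n → Bool) → List (Vec Bool n) → ℕ
countTrue P [] = 0
countTrue P (w ∷ ws) = if P w then suc (countTrue P ws) else countTrue P ws

Path : Poly → List Bool → Set
Path p x = Vec Bool (eval p (length x))

Accepts : ∀ {p} → BalancedNPTM p → (x : List Bool) → Path p x → Set
Accepts M x w = BalancedNPTM.V M x (toList w) ≡ true

#acc : ∀ {p} → BalancedNPTM p → List Bool → ℕ
#acc {p} M x = countTrue (λ w → BalancedNPTM.V M x (toList w)) (allVecs (eval p (length x)))

data _≤lex_ : ∀ {n} → Vec Bool n → Vec Bool n → Set where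
  []≤   : [] ≤lex []
  0<1   : ∀ {n} {a b : Vec Bool n} → (false ∷ a) ≤lex (true ∷ b)
  same  : ∀ {n} (c : Bool) {a b : Vec Bool n} → a ≤lex b → (c ∷ a) ≤lex (c ∷ b)

_<lex_ : ∀ {n} → Vec Bool n → Vec Bool n → Set
a <lex b = a ≤lex b × a ≢ b

_≺lex_ : ∀ {n} → Vec Bool n → Vec Bool n → Set
a ≺lex b = a <lex b × (∀ c → a <lex c → c <lex b → ⊥)

Perm : ℕ → Set
Perm n = Vec Bool n ⤖ Vec Bool n

app : ∀ {n} → Perm n → Vec Bool n → Vec Bool n
app h = Bijection.to h

_⇔'_ : Set → Set → Set
A ⇔' B = (A → B) × (B → A)

IntervalCond : ∀ {p} → BalancedNPTM p → (List Bool → ℕ) → (x : List Bool) →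
               Perm (eval p (length x)) → Set
IntervalCond {p} M f x h =
  f x ≢ 0 → Σ (Path p x) λ ℓ → Σ (Path p x) λ u →
    ∀ w → Accepts M x w ⇔' (app h ℓ ≤lex app h w × app h w ≤lex app h u)

record CLU#P-witness (f : List Bool → ℕ) : Set where
  field
    p     : Poly
    M     : BalancedNPTM p
    b t   : List Bool → List Bool
    b-FP  : FP b
    t-FP  : FP t
    prec  : List Bool → List Bool → List Bool → Bool
    prec-poly : PolyPred₃ prec
    cond  : ∀ x → Σ (Perm (eval p (length x))) λ h →
      (Σ (Path p x) λ bv → toList bv ≡ b x × app h bv ≡ replicate _ false) ×
      (Σ (Path p x) λ tv → toList tv ≡ t x × app h tv ≡ replicate _ true) ×
      (∀ (y z : Path p x) → (prec x (toList y) (toList z) ≡ true) ⇔' (app h y ≺lex app h z)) ×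
      IntervalCond M f x h
    count : ∀ x → f x ≡ #acc M x

CLU#P : (List Bool → ℕ) → Set
CLU#P f = CLU#P-witness f

WitnessCircular : (f : List Bool → ℕ) (p : Poly) (M : BalancedNPTM p)
                  (prec : List Bool → List Bool → List Bool → Bool) → Set
WitnessCircular f p M prec =
  PolyPred₃ prec ×
  (∀ x → Σ (Perm (eval p (length x))) λ h →
      (∀ (y z : Path p x) → (prec x (toList y) (toList z) ≡ true) ⇔'
          (app h y ≺lex app h z ⊎'
           (app h y ≡ replicate _ true × app h z ≡ replicate _ false))) ×
      IntervalCond M f x h) ×
  (∀ x → f x ≡ #acc M x)
  where
  open import Data.Sum using () renaming (_⊎_ to _⊎'_)

CLU#P~circular : (List Bool → ℕ) → Set
CLU#P~circular f =
  Σ Poly λ p → Σ (BalancedNPTM p) λ M →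
  Σ (List Bool → List Bool → List Bool → Bool) λ prec →
    WitnessCircular f p M prec ×
    (Σ (List Bool → Bool) λ D → PolyPred D ×
       (∀ x → (D x ≡ true) ⇔' (f x ≡ 2 ^ eval p (length x))))

{-# OPTIONS --safe #-}
-- To make the order of a CLU#P function circular, join t(x) to b(x); all paths accept iff b(x) and
-- t(x) do, because the accepting paths form an interval.
--
-- Conversely a circular order has no computable end points.  Let c₀, …, c_{N-1} be the ring of guess
-- strings, read from c₀ = e = 0…0.  Exactly one edge c_k → c_{k+1} of the ring is the cut: the edge from
-- an accepting to a rejecting string if e accepts and f(x) ≠ 2^p (which is decidable by assumption),
-- and the edge into e otherwise.  Both are recognised from their end points, and cutting there leaves the
-- accepting strings contiguous.  With two more bits there are four copies (layers) of the ring, and the path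
--   1c₀ 2c₀ … 1c_k 2c_k   0c_{k+1} … 0c_{N-1} 0c₀ … 0c_k   1c_{k+1} 2c_{k+1} … 2c_{N-1}   3c_{N-1} … 3c₀
-- visits every vertex, starts at 1e, ends at 3e, and accepts exactly on an interval of layer 0.
--
-- Polynomial time on Turing machines is handled through a structured language over five stacks: its
-- programs compile to single-tape machines with one track per stack, and it can simulate any machine.
module Submission where

open import Defs
open import Data.Bool using (Bool; true; false; if_then_else_; _∧_; _∨_; not)
import Data.Bool.Properties as Bool
open import Data.Empty using (⊥; ⊥-elim)
open import Data.Fin using (Fin; zero; suc)
import Data.Fin.Properties as Fin
open import Data.List using (List; []; _∷_; length; map; _++_; _∷ʳ_; head; drop;
  reverse; _ʳ++_; applyUpTo; cartesianProductWith)
import Data.List as List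
import Data.List.Properties as List
open import Data.List.Properties using (++-assoc; ++-identityʳ; length-++; length-applyUpTo; length-map; length-reverse; map-++;
  reverse-injective; reverse-involutive; reverse-map; unfold-reverse)
open import Data.List.Membership.Propositional using (_∈_)
open import Data.List.Membership.Propositional.Properties using (∈-++⁺ˡ; ∈-++⁺ʳ; ∈-++⁻;
  ∈-applyUpTo⁺; ∈-cartesianProductWith⁺; ∈-map⁺)
open import Data.List.Relation.Unary.All using (All; []; _∷_)
import Data.List.Relation.Unary.All as All
import Data.List.Relation.Unary.All.Properties as All
open import Data.List.Relation.Unary.Any using (here; there; index)
open import Data.List.Relation.Unary.Any.Properties using (lookup-index; reverse⁺)
open import Data.List.Relation.Unary.Linked using (Linked; []; [-]; _∷_)
open import Data.Maybe using (Maybe; just; nothing; maybe′)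
import Data.Maybe.Properties as Maybe
open import Data.Nat
open import Data.Nat.Properties
open import Data.Nat.Tactic.RingSolver using (solve-∀)
open import Data.Product using (Σ; ∃; ∃₂; _×_; _,_; proj₁; proj₂)
open import Data.Sum using (_⊎_; inj₁; inj₂; map₁)
open import Data.Unit using (⊤; tt)
open import Data.Vec using (Vec; []; _∷_; lookup; updateAt; replicate; toList; _[_]≔_)
import Data.Vec.Properties as Vec
open import Data.Vec.Properties using (length-toList; lookup-replicate; lookup∘update; lookup∘update′;
  lookup∘updateAt; lookup∘updateAt′; toList-replicate)
open import Function using (_∘_)
open import Function.Bundles using (Bijection; mk⤖)
open import Relation.Binary.Definitions using (DecidableEquality)
open import Relation.Binary.PropositionalEquality
open import Relation.Nullary using (Dec; yes; no; ¬_; contradiction)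

-- Polynomials and polynomial bounds

-- The cut edge is easy to recognise but, as a string, may be hard to compute, and so may be the
-- neighbours of `e` on the ring; only strings built on `e` can serve as `b` and `t`. This dictates
-- the shape of the path. It goes from `1e` to the cut without touching layer 0, makes one full
-- round of layer 0 starting just behind the cut, resumes the interrupted round there, and arrives
-- at the predecessor of `e`, which is again not computable. Layer 3 is there to walk back from it
-- to `3e`. Three copies of the ring would do for this, but the number of strings must be a power of
-- two; the fourth copy is used up by visiting each vertex of the interrupted round twice in a row,
-- as `1c` and `2c`. Every step, forward or backward, needs at most one query of `prec` besides
-- tests for the cut and for equality of strings. Deciding f(x) = 2^p is needed because, when `e`
-- accepts, an edge from accepting to rejecting exists exactly if some string rejects, and the local
-- rule must know whether it exists.

eval-mono : ∀ p {m n} → m ≤ n → eval p m ≤ eval p n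
eval-mono []      m≤n = z≤n
eval-mono (c ∷ p) m≤n = +-monoʳ-≤ c (*-mono-≤ m≤n (eval-mono p m≤n))

_⊕_ : Poly → Poly → Poly
[]      ⊕ q       = q
(a ∷ p) ⊕ []      = a ∷ p
(a ∷ p) ⊕ (b ∷ q) = (a + b) ∷ (p ⊕ q)

eval-⊕ : ∀ p q n → eval (p ⊕ q) n ≡ eval p n + eval q n
eval-⊕ []      q       n = refl
eval-⊕ (a ∷ p) []      n = sym (+-identityʳ _)
eval-⊕ (a ∷ p) (b ∷ q) n rewrite eval-⊕ p q n = lemma a b n (eval p n) (eval q n)
  where
  lemma : ∀ a b n x y → a + b + n * (x + y) ≡ a + n * x + (b + n * y)
  lemma = solve-∀

scale : ℕ → Poly → Poly
scale c = map (c *_)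

eval-scale : ∀ c p n → eval (scale c p) n ≡ c * eval p n
eval-scale c []      n = sym (*-zeroʳ c)
eval-scale c (a ∷ p) n rewrite eval-scale c p n = lemma c a n (eval p n)
  where
  lemma : ∀ c a n x → c * a + n * (c * x) ≡ c * (a + n * x)
  lemma = solve-∀

_⊗_ : Poly → Poly → Poly
[]      ⊗ q = []
(a ∷ p) ⊗ q = scale a q ⊕ (0 ∷ (p ⊗ q))

eval-⊗ : ∀ p q n → eval (p ⊗ q) n ≡ eval p n * eval q n
eval-⊗ []      q n = refl
eval-⊗ (a ∷ p) q n
  rewrite eval-⊕ (scale a q) (0 ∷ (p ⊗ q)) n | eval-scale a q n | eval-⊗ p q n
  = lemma a n (eval p n) (eval q n)
  where
  lemma : ∀ a n x y → a * y + n * (x * y) ≡ (a + n * x) * y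
  lemma = solve-∀

_⊚_ : Poly → Poly → Poly
[]      ⊚ q = []
(a ∷ p) ⊚ q = (a ∷ []) ⊕ (q ⊗ (p ⊚ q))

eval-⊚ : ∀ p q n → eval (p ⊚ q) n ≡ eval p (eval q n)
eval-⊚ []      q n = refl
eval-⊚ (a ∷ p) q n
  rewrite eval-⊕ (a ∷ []) (q ⊗ (p ⊚ q)) n | eval-⊗ q (p ⊚ q) n | eval-⊚ p q n
        | *-zeroʳ n | +-identityʳ a = refl

-- Costs live on an arbitrary index type `X` with a size, so that one calculus of bounds serves
-- words, pairs and triples of words.
PolyBounded : {X : Set} → (X → ℕ) → (X → ℕ) → Set
PolyBounded s t = Σ Poly λ q → ∀ v → t v ≤ eval q (s v)

module _ {X : Set} {s : X → ℕ} where

  bound-const : ∀ c → PolyBounded s (λ _ → c)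
  bound-const c = c ∷ [] , λ v → m≤m+n c _

  bound-≤ : ∀ {t u} → (∀ v → t v ≤ u v) → PolyBounded s u → PolyBounded s t
  bound-≤ t≤u (q , b) = q , λ v → ≤-trans (t≤u v) (b v)

  bound-self : PolyBounded s s
  bound-self = 0 ∷ 1 ∷ [] , λ v → ≤-reflexive (lemma (s v))
    where
    lemma : ∀ n → n ≡ 0 + n * (1 + n * 0)
    lemma = solve-∀

  bound-+ : ∀ {t u} → PolyBounded s t → PolyBounded s u → PolyBounded s (λ v → t v + u v)
  bound-+ (p , a) (q , b) = p ⊕ q , λ v →
    ≤-trans (+-mono-≤ (a v) (b v)) (≤-reflexive (sym (eval-⊕ p q (s v))))

  bound-* : ∀ {t u} → PolyBounded s t → PolyBounded s u → PolyBounded s (λ v → t v * u v)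
  bound-* (p , a) (q , b) = p ⊗ q , λ v →
    ≤-trans (*-mono-≤ (a v) (b v)) (≤-reflexive (sym (eval-⊗ p q (s v))))

  -- Bounds compose because the outer polynomial is monotone, its coefficients being natural
  -- numbers.
  bound-trans : ∀ {t u} → PolyBounded s t → PolyBounded t u → PolyBounded s u
  bound-trans (p , a) (q , b) = q ⊚ p , λ v →
    ≤-trans (b v) (≤-trans (eval-mono q (a v)) (≤-reflexive (sym (eval-⊚ q p (s v)))))

-- A language over five stacks

Tok : Set
Tok = Maybe Bool

pattern bit b = just b
pattern #     = nothing

Stack : Set
Stack = List Tok

Reg : Set
Reg = Fin 5

-- The simulation of a Turing machine settles the roles of the five stacks: A carries the argument
-- and the result, B and C the two half-tapes, D the control state, E the output while it is read
-- off.
Store : Set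
Store = Vec Stack 5

pattern rA = zero
pattern rB = suc zero
pattern rC = suc (suc zero)
pattern rD = suc (suc (suc zero))
pattern rE = suc (suc (suc (suc zero)))

infixr 5 _⨾_

-- A loop pops its register; a bit is handed to the body, and a # or an empty stack ends the loop.
data Cmd : Set where
  skip : Cmd
  push : Reg → Tok → Cmd
  _⨾_  : Cmd → Cmd → Cmd
  pop  : Reg → (Maybe Tok → Cmd) → Cmd
  loop : Reg → (Bool → Cmd) → Cmd

bitOf : Maybe Tok → Maybe Bool
bitOf (just t) = t
bitOf nothing  = nothing

top : Store → Reg → Maybe Tok
top σ r = head (lookup σ r)

popped : Store → Reg → Store
popped σ r = updateAt σ r (drop 1)

-- `relax` turns the number into an upper bound of the cost, so that branches of different length
-- can be given a common figure.
data Exec : Cmd → Store → ℕ → Store → Set where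
  skipE : ∀ {σ} → Exec skip σ 1 σ
  pushE : ∀ {σ r t} → Exec (push r t) σ 1 (updateAt σ r (t ∷_))
  seqE  : ∀ {c d σ τ ρ m n} → Exec c σ m τ → Exec d τ n ρ → Exec (c ⨾ d) σ (m + n) ρ
  popE  : ∀ {r k σ τ n} → Exec (k (top σ r)) (popped σ r) n τ → Exec (pop r k) σ (suc n) τ
  exitE : ∀ {r k σ} → bitOf (top σ r) ≡ nothing → Exec (loop r k) σ 1 (popped σ r)
  iterE : ∀ {r k σ τ ρ b m n} → bitOf (top σ r) ≡ just b →
          Exec (k b) (popped σ r) m τ → Exec (loop r k) τ n ρ →
          Exec (loop r k) σ (suc (m + n)) ρ
  relax : ∀ {c σ τ m n} → m ≤ n → Exec c σ m τ → Exec c σ n τ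

total : ∀ {k} → Vec Stack k → ℕ
total []      = 0
total (s ∷ σ) = length s + total σ

length≤total : ∀ {k} (σ : Vec Stack k) r → length (lookup σ r) ≤ total σ
length≤total (s ∷ σ) zero    = m≤m+n _ _
length≤total (s ∷ σ) (suc r) = ≤-trans (length≤total σ r) (m≤n+m _ _)

total-push : ∀ {k} (σ : Vec Stack k) r t → total (updateAt σ r (t ∷_)) ≡ suc (total σ)
total-push (s ∷ σ) zero    t = refl
total-push (s ∷ σ) (suc r) t = trans (cong (length s +_) (total-push σ r t)) (+-suc _ _)

total-pop : ∀ {k} (σ : Vec Stack k) r → total (updateAt σ r (drop 1)) ≤ total σ
total-pop ([]      ∷ σ) zero    = ≤-refl
total-pop ((t ∷ s) ∷ σ) zero    = n≤1+n _
total-pop (s       ∷ σ) (suc r) = +-monoʳ-≤ (length s) (total-pop σ r)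

-- Only `push` lengthens a stack, and it costs a unit. This inequality bounds both how far the head
-- of a compiled machine has to travel and how long a computed word can be.
total-exec : ∀ {c σ n τ} → Exec c σ n τ → total τ ≤ n + total σ
total-exec skipE = n≤1+n _
total-exec (pushE {σ} {r} {t}) = ≤-reflexive (total-push σ r t)
total-exec (seqE {σ = σ} {m = m} {n} p q) = ≤-trans (total-exec q)
  (≤-trans (+-monoʳ-≤ n (total-exec p))
    (≤-reflexive (trans (sym (+-assoc n m _)) (cong (_+ total σ) (+-comm n m)))))
total-exec (popE {r} {σ = σ} {n = n} p) =
  ≤-trans (total-exec p) (m≤n⇒m≤1+n (+-monoʳ-≤ n (total-pop σ r)))
total-exec (exitE {r} {σ = σ} _) = m≤n⇒m≤1+n (total-pop σ r)
total-exec (iterE {r} {σ = σ} {m = m} {n} _ p q) = m≤n⇒m≤1+n (≤-trans (total-exec q)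
  (≤-trans (+-monoʳ-≤ n (≤-trans (total-exec p) (+-monoʳ-≤ m (total-pop σ r))))
    (≤-reflexive (trans (sym (+-assoc n m _)) (cong (_+ total σ) (+-comm n m))))))
total-exec (relax {σ = σ} m≤n p) = ≤-trans (total-exec p) (+-monoˡ-≤ (total σ) m≤n)

-- Turing machines over finite types

Finite : Set → Set
Finite X = Σ (List X) λ xs → ∀ x → x ∈ xs

-- Arbitrary finite types of states and symbols spare the compiler all arithmetic with indices.
-- Distinctness is demanded only of the blank and the two bits, whose codes in a `TM` are fixed.
record Machine : Set₁ where
  field
    Q Γ     : Set
    finQ    : Finite Q
    finΓ    : Finite Γ
    _≟Γ_    : DecidableEquality Γ
    start   : Q
    □       : Γ
    ⟨_⟩     : Bool → Γ
    □≢bit   : ∀ b → ⟨ b ⟩ ≢ □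
    0≢1     : ⟨ true ⟩ ≢ ⟨ false ⟩
    trans-δ : Q → Γ → Maybe (Q × Γ × Move)

module Realise (N : Machine) where
  open Machine N

  record Conf : Set where
    constructor conf
    field
      state : Q
      left  : List Γ
      cur   : Γ
      right : List Γ

  at : Q → List Γ → List Γ → Conf
  at q l []      = conf q l □ []
  at q l (c ∷ r) = conf q l c r

  backTo : Q → List Γ → List Γ → Conf
  backTo q []      cs = conf q [] □ cs
  backTo q (x ∷ l) cs = conf q l x cs

  shift : Q → Move → List Γ → Γ → List Γ → Conf
  shift q L l c r = backTo q l (c ∷ r)
  shift q R l c r = at q (c ∷ l) r
  shift q S l c r = conf q l c r

  data Reach : ℕ → Conf → Conf → Set where
    stop : ∀ {C} → Reach 0 C C
    next : ∀ {n q l c r q′ c′ m C} → trans-δ q c ≡ just (q′ , c′ , m) →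
           Reach n (shift q′ m l c′ r) C → Reach (suc n) (conf q l c r) C

  _⊙_ : ∀ {m n C D E} → Reach m C D → Reach n D E → Reach (m + n) C E
  stop     ⊙ q = q
  next e p ⊙ q = next e (p ⊙ q)

  reach-≡ : ∀ {m n C D} → m ≡ n → Reach m C D → Reach n C D
  reach-≡ refl p = p

  qs : List Q
  qs = start ∷ proj₁ finQ

  -- The first three places are the codes that a `TM` prescribes for the blank and the bits. These
  -- symbols recur later in the list, and `encΓ` has to choose the early occurrence.
  γs : List Γ
  γs = □ ∷ ⟨ false ⟩ ∷ ⟨ true ⟩ ∷ proj₁ finΓ

  decQ : Fin (length qs) → Q
  decQ = List.lookup qs

  encQ : Q → Fin (length qs)
  encQ q = suc (index (proj₂ finQ q))

  decQ-encQ : ∀ q → decQ (encQ q) ≡ q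
  decQ-encQ q = sym (lookup-index (proj₂ finQ q))

  decΓ : Fin (length γs) → Γ
  decΓ = List.lookup γs

  encΓ : Γ → Fin (length γs)
  encΓ x with x ≟Γ □ | x ≟Γ ⟨ false ⟩ | x ≟Γ ⟨ true ⟩
  ... | yes _ | _     | _     = zero
  ... | no _  | yes _ | _     = suc zero
  ... | no _  | no _  | yes _ = suc (suc zero)
  ... | no _  | no _  | no _  = suc (suc (suc (index (proj₂ finΓ x))))

  decΓ-encΓ : ∀ x → decΓ (encΓ x) ≡ x
  decΓ-encΓ x with x ≟Γ □ | x ≟Γ ⟨ false ⟩ | x ≟Γ ⟨ true ⟩
  ... | yes e | _     | _     = sym e
  ... | no _  | yes e | _     = sym e
  ... | no _  | no _  | yes e = sym e
  ... | no _  | no _  | no _  = sym (lookup-index (proj₂ finΓ x))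

  encΓ-□ : encΓ □ ≡ zero
  encΓ-□ with □ ≟Γ □ | □ ≟Γ ⟨ false ⟩ | □ ≟Γ ⟨ true ⟩
  ... | yes _ | _ | _ = refl
  ... | no ne | _ | _ = contradiction refl ne

  realise : TM
  realise .TM.nStates = length (proj₁ finQ)
  realise .TM.nExtra  = length (proj₁ finΓ)
  realise .TM.δ i a with trans-δ (decQ i) (decΓ a)
  ... | nothing           = nothing
  ... | just (q , c , m) = just (encQ q , encΓ c , m)

  encΓ-bit : ∀ b → encΓ ⟨ b ⟩ ≡ bitSym {M = realise} b
  encΓ-bit false with ⟨ false ⟩ ≟Γ □ | ⟨ false ⟩ ≟Γ ⟨ false ⟩ | ⟨ false ⟩ ≟Γ ⟨ true ⟩
  ... | yes e | _     | _ = contradiction e (□≢bit false)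
  ... | no _  | yes _ | _ = refl
  ... | no _  | no ne | _ = contradiction refl ne
  encΓ-bit true with ⟨ true ⟩ ≟Γ □ | ⟨ true ⟩ ≟Γ ⟨ false ⟩ | ⟨ true ⟩ ≟Γ ⟨ true ⟩
  ... | yes e | _     | _     = contradiction e (□≢bit true)
  ... | no _  | yes e | _     = contradiction e 0≢1
  ... | no _  | no _  | yes _ = refl
  ... | no _  | no _  | no ne = contradiction refl ne

  -- States are compared by decoding, because `start` has two codes, zero and `encQ start`, and the
  -- machine may be in either. Symbols are compared by encoding, because reading the output inspects
  -- exact codes.
  data _∼_ : Config realise → Conf → Set where
    code : ∀ {i q l s c r} → decQ i ≡ q → s ≡ encΓ c →
           cfg i (map encΓ l) s (map encΓ r) ∼ conf q l c r

  shift-∼ : ∀ {i q} m l c r → decQ i ≡ q →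
            moveHead {M = realise} i m (map encΓ l) (encΓ c) (map encΓ r) ∼ shift q m l c r
  shift-∼ L []      c r       e = code e (sym encΓ-□)
  shift-∼ L (x ∷ l) c r       e = code e refl
  shift-∼ R l       c []      e = code e (sym encΓ-□)
  shift-∼ R l       c (x ∷ r) e = code e refl
  shift-∼ S l       c r       e = code e refl

  step-∼ : ∀ {C q l c r q′ c′ m} → C ∼ conf q l c r → trans-δ q c ≡ just (q′ , c′ , m) →
           ∃ λ C′ → step {M = realise} C ≡ just C′ × C′ ∼ shift q′ m l c′ r
  step-∼ {q = q} {l} {c} {r} {q′} {c′} {m} (code refl refl) e rewrite decΓ-encΓ c | e =
    _ , refl , shift-∼ m l c′ r (decQ-encQ q′)

  halt-∼ : ∀ {C q l c r} → C ∼ conf q l c r → trans-δ q c ≡ nothing →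
           step {M = realise} C ≡ nothing
  halt-∼ {c = c} (code refl refl) e rewrite decΓ-encΓ c | e = refl

  run-halt : ∀ n {C} → step {M = realise} C ≡ nothing → run {M = realise} n C ≡ just C
  run-halt n {C} e with step {M = realise} C
  run-halt zero    e  | nothing = refl
  run-halt (suc n) e  | nothing = refl
  run-halt n       () | just _

  run-step : ∀ n {C C′} → step {M = realise} C ≡ just C′ →
             run {M = realise} (suc n) C ≡ run {M = realise} n C′
  run-step n {C} e with step {M = realise} C
  run-step n refl | just _ = refl

  run-∼ : ∀ {k n q l c r A C} → Reach k A (conf q l c r) → k ≤ n → trans-δ q c ≡ nothing → C ∼ A →
          ∃ λ C′ → run {M = realise} n C ≡ just C′ × C′ ∼ conf q l c r
  run-∼ {n = n} stop _ h C∼ = _ , run-halt n (halt-∼ C∼ h) , C∼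
  run-∼ (next e p) (s≤s k≤n) h C∼ with step-∼ C∼ e
  ... | C₁ , e₁ , C₁∼ with run-∼ p k≤n h C₁∼
  ... | C₂ , e₂ , C₂∼ = C₂ , trans (run-step _ e₁) e₂ , C₂∼

  map-bits : ∀ x → map (bitSym {M = realise}) x ≡ map encΓ (map ⟨_⟩ x)
  map-bits []      = refl
  map-bits (b ∷ x) = cong₂ _∷_ (sym (encΓ-bit b)) (map-bits x)

  initial-∼ : ∀ x → initial {M = realise} x ∼ at start [] (map ⟨_⟩ x)
  initial-∼ []      = code refl (sym encΓ-□)
  initial-∼ (b ∷ x) rewrite map-bits x | sym (encΓ-bit b) = code refl refl

  readBits-bits : ∀ y n → readBits {M = realise} (map encΓ (map ⟨_⟩ y List.++ List.replicate n □)) ≡ y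
  readBits-bits []      zero    = refl
  readBits-bits []      (suc n) rewrite encΓ-□ = refl
  readBits-bits (false ∷ y) n rewrite encΓ-bit false = cong (false ∷_) (readBits-bits y n)
  readBits-bits (true  ∷ y) n rewrite encΓ-bit true  = cong (true ∷_) (readBits-bits y n)

  output-at : ∀ {q l} y n {C} → C ∼ at q l (map ⟨_⟩ y List.++ List.replicate n □) →
              output {M = realise} C ≡ y
  output-at []      zero    (code _ refl) = readBits-bits [] 1
  output-at []      (suc n) (code _ refl) = readBits-bits [] (suc n)
  output-at (b ∷ y) n       (code _ refl) = readBits-bits (b ∷ y) n

  -- The trailing blanks are cells that were visited and are empty at the end; they remain in the
  -- list that models the tape.
  runTM-realise : ∀ {k n q l} x y m → trans-δ q (Conf.cur (at q l (map ⟨_⟩ y List.++ List.replicate m □))) ≡ nothing →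
    Reach k (at start [] (map ⟨_⟩ x)) (at q l (map ⟨_⟩ y List.++ List.replicate m □)) → k ≤ n →
    runTM realise n x ≡ just y
  runTM-realise {n = n} {q} {l} x y m h p k≤n with map ⟨_⟩ y List.++ List.replicate m □ in eq
  ... | [] with run-∼ p k≤n h (initial-∼ x)
  ...   | C , e , C∼ rewrite e = cong just (output-at {q} {l} y m (subst (λ z → C ∼ at q l z) (sym eq) C∼))
  runTM-realise {n = n} {q} {l} x y m h p k≤n | c ∷ r with run-∼ p k≤n h (initial-∼ x)
  ...   | C , e , C∼ rewrite e = cong just (output-at {q} {l} y m (subst (λ z → C ∼ at q l z) (sym eq) C∼))

-- Compilation of stack programs

finite-⊤ : Finite ⊤
finite-⊤ = tt ∷ [] , λ _ → here refl

finite-Bool : Finite Bool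
finite-Bool = false ∷ true ∷ [] , λ { false → here refl ; true → there (here refl) }

finite-Maybe : ∀ {X} → Finite X → Finite (Maybe X)
finite-Maybe (xs , ∈xs) = nothing ∷ map just xs , λ where
  nothing  → here refl
  (just x) → there (∈-map⁺ just (∈xs x))

finite-⊎ : ∀ {X Y} → Finite X → Finite Y → Finite (X ⊎ Y)
finite-⊎ (xs , ∈xs) (ys , ∈ys) = map inj₁ xs List.++ map inj₂ ys , λ where
  (inj₁ x) → ∈-++⁺ˡ (∈-map⁺ inj₁ (∈xs x))
  (inj₂ y) → ∈-++⁺ʳ (map inj₁ xs) (∈-map⁺ inj₂ (∈ys y))

finite-Σ : ∀ {X} {Y : X → Set} → Finite X → (∀ x → Finite (Y x)) → Finite (Σ X Y)
finite-Σ {X} {Y} (xs , ∈xs) fin = go xs , λ (x , y) → ∈go (∈xs x) y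
  where
  go : List X → List (Σ X Y)
  go []       = []
  go (x ∷ xs) = map (x ,_) (proj₁ (fin x)) List.++ go xs
  ∈go : ∀ {x xs} → x ∈ xs → ∀ y → (x , y) ∈ go xs
  ∈go {x} (here refl) y = ∈-++⁺ˡ (∈-map⁺ (x ,_) (proj₂ (fin x) y))
  ∈go {xs = x′ ∷ _} (there p) y = ∈-++⁺ʳ (map (x′ ,_) (proj₁ (fin x′))) (∈go p y)

finite-Vec : ∀ {X} → Finite X → ∀ n → Finite (Vec X n)
finite-Vec fin zero = [] ∷ [] , λ { [] → here refl }
finite-Vec fin (suc n) =
  cartesianProductWith _∷_ (proj₁ fin) (proj₁ (finite-Vec fin n)) ,
  λ { (x ∷ v) → ∈-cartesianProductWith⁺ _∷_ (proj₂ fin x) (proj₂ (finite-Vec fin n) v) }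

data Instr (X : Set) : Set where
  halt : Instr X
  goto : X → Instr X
  push : Reg → Tok → X → Instr X
  pop  : Reg → (Maybe Tok → X) → Instr X

Label : Cmd → Set
Label skip       = ⊤
Label (push r t) = ⊤
Label (c ⨾ d)    = Label c ⊎ Label d
Label (pop r k)  = ⊤ ⊎ Σ (Maybe Tok) λ o → Label (k o)
Label (loop r k) = ⊤ ⊎ Σ Bool λ b → Label (k b)

finite-Label : ∀ c → Finite (Label c)
finite-Label skip       = finite-⊤
finite-Label (push r t) = finite-⊤
finite-Label (c ⨾ d)    = finite-⊎ (finite-Label c) (finite-Label d)
finite-Label (pop r k)  =
  finite-⊎ finite-⊤ (finite-Σ (finite-Maybe (finite-Maybe finite-Bool)) λ o → finite-Label (k o))
finite-Label (loop r k) = finite-⊎ finite-⊤ (finite-Σ finite-Bool λ b → finite-Label (k b))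

entry : ∀ c → Label c
entry skip       = tt
entry (push r t) = tt
entry (c ⨾ d)    = inj₁ (entry c)
entry (pop r k)  = inj₁ tt
entry (loop r k) = inj₁ tt

module _ {X : Set} where

  -- `ι` embeds the program points of a part into those of the whole program, and `x` is the point
  -- where control continues after the part.
  compile : ∀ c → (Label c → X) → X → Label c → Instr X
  compile skip       ι x _        = goto x
  compile (push r t) ι x _        = push r t x
  compile (c ⨾ d)    ι x (inj₁ l) = compile c (ι ∘ inj₁) (ι (inj₂ (entry d))) l
  compile (c ⨾ d)    ι x (inj₂ l) = compile d (ι ∘ inj₂) x l
  compile (pop r k)  ι x (inj₁ _) = pop r λ o → ι (inj₂ (o , entry (k o)))
  compile (pop r k)  ι x (inj₂ (o , l)) = compile (k o) (λ l → ι (inj₂ (o , l))) x l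
  compile (loop r k) ι x (inj₁ _) = pop r λ o → maybe′ (λ b → ι (inj₂ (b , entry (k b)))) x (bitOf o)
  compile (loop r k) ι x (inj₂ (b , l)) = compile (k b) (λ l → ι (inj₂ (b , l))) (ι (inj₁ tt)) l

Cell : Set
Cell = Vec (Maybe Tok) 5

empty : Cell
empty = replicate 5 nothing

-- Input and output words occupy track C, so that raw tape bits are ordinary cells.
bitCell : Bool → Cell
bitCell b = empty [ rC ]≔ just (bit b)

_≟C_ : DecidableEquality Cell
_≟C_ = Vec.≡-dec (Maybe.≡-dec (Maybe.≡-dec Bool._≟_))

-- Cell i of the tape holds the i-th token from the bottom of each of the five stacks; the empty
-- cell to the left of the bottom is what stops the return walk of the head.
data Phase : Set where
  ahead peek back : Phase

finite-Phase : Finite Phase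
finite-Phase = ahead ∷ peek ∷ back ∷ [] , λ where
  ahead   → here refl
  peek → there (here refl)
  back → there (there (here refl))

module Tracks {X : Set} (fin : Finite X) (x₀ : X) (G : X → Instr X) where

  -- `ahead` moves right to the first cell that is free on the track of `r`; `peek` looks at the
  -- cell before it, where the top of the stack lies; `back` returns to the bottom.
  walkPush : X → X → Reg → Tok → Cell → Maybe Tok → (X × Phase) × Cell × Move
  walkPush x y r t c (just _) = (x , ahead) , c , R
  walkPush x y r t c nothing  = (y , back) , c [ r ]≔ just t , L

  walkPop : X → Cell → Maybe Tok → (X × Phase) × Cell × Move
  walkPop x c (just _) = (x , ahead) , c , R
  walkPop x c nothing  = (x , peek) , c , L

  takeTop : Reg → (Maybe Tok → X) → Cell → Maybe Tok → (X × Phase) × Cell × Move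
  takeTop r k c (just t) = (k (just t) , back) , c [ r ]≔ nothing , L
  takeTop r k c nothing  = (k nothing , ahead) , c , R

  onGo : X → Instr X → Cell → Maybe ((X × Phase) × Cell × Move)
  onGo x halt         c = nothing
  onGo x (goto y)     c = just ((y , ahead) , c , S)
  onGo x (push r t y) c = just (walkPush x y r t c (lookup c r))
  onGo x (pop r k)    c = just (walkPop x c (lookup c r))

  onPeek : Instr X → Cell → Maybe ((X × Phase) × Cell × Move)
  onPeek (pop r k) c = just (takeTop r k c (lookup c r))
  onPeek _         c = nothing

  onBack : ∀ x {c} → Dec (c ≡ empty) → (X × Phase) × Cell × Move
  onBack x {c} (yes _) = (x , ahead) , c , R
  onBack x {c} (no _)  = (x , back) , c , L

  trackδ : X × Phase → Cell → Maybe ((X × Phase) × Cell × Move)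
  trackδ (x , ahead)   c = onGo x (G x) c
  trackδ (x , peek) c = onPeek (G x) c
  trackδ (x , back) c = just (onBack x (c ≟C empty))

  machine : Machine
  machine = record
    { Q = X × Phase ; Γ = Cell
    ; finQ = finite-Σ fin (λ _ → finite-Phase)
    ; finΓ = finite-Vec (finite-Maybe (finite-Maybe finite-Bool)) 5
    ; _≟Γ_ = _≟C_ ; start = x₀ , ahead ; □ = empty ; ⟨_⟩ = bitCell
    ; □≢bit = λ { false () ; true () } ; 0≢1 = λ () ; trans-δ = trackδ }

  open Realise machine public

  -- All cells past the last token have to be free on this track, and cells beyond the listed part
  -- of the tape count as free.
  data Track (r : Reg) : List Cell → List Tok → Set where
    end  : Track r [] []
    gap  : ∀ {c cs} → lookup c r ≡ nothing → Track r cs [] → Track r (c ∷ cs) []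
    cell : ∀ {c cs t u} → lookup c r ≡ just t → Track r cs u → Track r (c ∷ cs) (t ∷ u)

  put : ℕ → Reg → Maybe Tok → List Cell → List Cell
  put zero    r o []       = (empty [ r ]≔ o) ∷ []
  put zero    r o (c ∷ cs) = (c [ r ]≔ o) ∷ cs
  put (suc n) r o []       = empty ∷ put n r o []
  put (suc n) r o (c ∷ cs) = c ∷ put n r o cs

  lookup-empty : ∀ r → lookup empty r ≡ nothing
  lookup-empty r = lookup-replicate r nothing

  track-put : ∀ {r cs u} t → Track r cs u → Track r (put (length u) r (just t) cs) (u ∷ʳ t)
  track-put {r} t end        = cell (lookup∘update r empty _) end
  track-put {r} t (gap {c} _ p)  = cell (lookup∘update r c _) p
  track-put t (cell e p) = cell e (track-put t p)

  track-put′ : ∀ {r s cs u} n o → s ≢ r → Track s cs u → Track s (put n r o cs) u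
  track-put′ {r} {s} zero o ne end = gap (trans (lookup∘update′ ne empty o) (lookup-empty s)) end
  track-put′ zero o ne (gap {c} e p)  = gap (trans (lookup∘update′ ne c o) e) p
  track-put′ zero o ne (cell {c} e p) = cell (trans (lookup∘update′ ne c o) e) p
  track-put′ {s = s} (suc n) o ne end = gap (lookup-empty s) (track-put′ n o ne end)
  track-put′ (suc n) o ne (gap e p)  = gap e (track-put′ n o ne p)
  track-put′ (suc n) o ne (cell e p) = cell e (track-put′ n o ne p)

  -- A pop looks one cell past the top; if the listed part of the tape ends there, the visited blank
  -- becomes an explicit cell.
  extend : List Cell → List Cell
  extend []       = empty ∷ []
  extend (c ∷ cs) = c ∷ cs

  track-extend : ∀ {r cs u} → Track r cs u → Track r (extend cs) u
  track-extend {r} end = gap (lookup-empty r) end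
  track-extend (gap e p)  = gap e p
  track-extend (cell e p) = cell e p

  clear : ℕ → Reg → List Cell → List Cell
  clear n       r []       = []
  clear zero    r (c ∷ cs) = (c [ r ]≔ nothing) ∷ extend cs
  clear (suc n) r (c ∷ cs) = c ∷ clear n r cs

  track-clear : ∀ {r cs t} u → Track r cs (u ∷ʳ t) → Track r (clear (length u) r cs) u
  track-clear {r} [] (cell {c} e p) = gap (lookup∘update r c nothing) (track-extend p)
  track-clear (t ∷ u) (cell e p) = cell e (track-clear u p)

  track-clear′ : ∀ {r s cs u} n → s ≢ r → Track s cs u → Track s (clear n r cs) u
  track-clear′ n ne end = end
  track-clear′ zero    ne (gap {c} e p)  = gap (trans (lookup∘update′ ne c nothing) e) (track-extend p)
  track-clear′ zero    ne (cell {c} e p) = cell (trans (lookup∘update′ ne c nothing) e) (track-extend p)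
  track-clear′ (suc n) ne (gap e p)  = gap e (track-clear′ n ne p)
  track-clear′ (suc n) ne (cell e p) = cell e (track-clear′ n ne p)

  δ-push-gap : ∀ {x r t y c} → G x ≡ push r t y → lookup c r ≡ nothing →
               trackδ (x , ahead) c ≡ just ((y , back) , c [ r ]≔ just t , L)
  δ-push-gap e f rewrite e | f = refl

  δ-push-cell : ∀ {x r t y c u} → G x ≡ push r t y → lookup c r ≡ just u →
                trackδ (x , ahead) c ≡ just ((x , ahead) , c , R)
  δ-push-cell e f rewrite e | f = refl

  δ-pop-gap : ∀ {x r k c} → G x ≡ pop r k → lookup c r ≡ nothing →
              trackδ (x , ahead) c ≡ just ((x , peek) , c , L)
  δ-pop-gap e f rewrite e | f = refl

  δ-pop-cell : ∀ {x r k c u} → G x ≡ pop r k → lookup c r ≡ just u →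
               trackδ (x , ahead) c ≡ just ((x , ahead) , c , R)
  δ-pop-cell e f rewrite e | f = refl

  δ-peek-gap : ∀ {x r k c} → G x ≡ pop r k → lookup c r ≡ nothing →
               trackδ (x , peek) c ≡ just ((k nothing , ahead) , c , R)
  δ-peek-gap e f rewrite e | f = refl

  δ-peek-cell : ∀ {x r k c u} → G x ≡ pop r k → lookup c r ≡ just u →
                trackδ (x , peek) c ≡ just ((k (just u) , back) , c [ r ]≔ nothing , L)
  δ-peek-cell e f rewrite e | f = refl

  -- A cell with a token on some track is not `empty`, so the return walk cannot stop too early.
  δ-back-cell : ∀ {x c r t} → lookup c r ≡ just t → trackδ (x , back) c ≡ just ((x , back) , c , L)
  δ-back-cell {c = c} {r} e with c ≟C empty
  ... | no _     = refl
  ... | yes refl = contradiction (trans (sym e) (lookup-empty r)) λ ()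

  push-walk : ∀ {x y r t} l {cs u} → G x ≡ push r t y → Track r cs u →
              Reach (1 + 2 * length u) (at (x , ahead) l cs)
                    (backTo (y , back) l (put (length u) r (just t) cs))
  push-walk {r = r} l e end = next (δ-push-gap e (lookup-empty r)) stop
  push-walk l e (gap f p) = next (δ-push-gap e f) stop
  push-walk {r = r} l e (cell {c} {u = u} f p) =
    reach-≡ (lemma (length u))
      (next (δ-push-cell e f) (push-walk (c ∷ l) e p ⊙ next (δ-back-cell {r = r} f) stop))
    where
    lemma : ∀ n → suc (1 + 2 * n + 1) ≡ 1 + 2 * suc n
    lemma = solve-∀

  pop-walk : ∀ {x r k t} l {cs} u → G x ≡ pop r k → Track r cs (u ∷ʳ t) →
             Reach (3 + 2 * length u) (at (x , ahead) l cs)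
                   (backTo (k (just t) , back) l (clear (length u) r cs))
  pop-walk {x} {r} {k} {t} l [] e (cell {c} f p) = next (δ-pop-cell e f) (turn p)
    where
    turn : ∀ {cs} → Track r cs [] →
           Reach 2 (at (x , ahead) (c ∷ l) cs) (backTo (k (just t) , back) l ((c [ r ]≔ nothing) ∷ extend cs))
    turn end       = next (δ-pop-gap e (lookup-empty r)) (next (δ-peek-cell e f) stop)
    turn (gap g _) = next (δ-pop-gap e g) (next (δ-peek-cell e f) stop)
  pop-walk {r = r} l (_ ∷ u) e (cell {c} f p) =
    reach-≡ (lemma (length u))
      (next (δ-pop-cell e f) (pop-walk (c ∷ l) u e p ⊙ next (δ-back-cell {r = r} f) stop))
    where
    lemma : ∀ n → suc (3 + 2 * n + 1) ≡ 3 + 2 * suc n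
    lemma = solve-∀

  -- On an empty stack the peek falls on the cell left of the bottom and the head comes straight
  -- back. If no cell was listed there, one is created, which is why `m′` may differ from `m`.
  pop-empty-walk : ∀ {x r k} m {cs} → G x ≡ pop r k → Track r cs [] →
    ∃ λ m′ → Reach 2 (at (x , ahead) (List.replicate m empty) cs)
                     (at (k nothing , ahead) (List.replicate m′ empty) (extend cs))
  pop-empty-walk {r = r} zero    e end       =
    1 , next (δ-pop-gap e (lookup-empty r)) (next (δ-peek-gap e (lookup-empty r)) stop)
  pop-empty-walk {r = r} (suc m) e end       =
    suc m , next (δ-pop-gap e (lookup-empty r)) (next (δ-peek-gap e (lookup-empty r)) stop)
  pop-empty-walk {r = r} zero    e (gap f _) =
    1 , next (δ-pop-gap e f) (next (δ-peek-gap e (lookup-empty r)) stop)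
  pop-empty-walk {r = r} (suc m) e (gap f _) =
    suc m , next (δ-pop-gap e f) (next (δ-peek-gap e (lookup-empty r)) stop)

  -- Simulation of commands on the tracks

  Rep : Store → List Cell → Set
  Rep σ cs = ∀ r → Track r cs (reverse (lookup σ r))

  -- Between commands the head rests on the bottom cell. The number of empty cells listed to its
  -- left depends on earlier walks and is left open.
  Home : X → Store → Conf → Set
  Home x σ C = Σ ℕ λ m → Σ (List Cell) λ cs → Rep σ cs × C ≡ at (x , ahead) (List.replicate m empty) cs

  go-home : ∀ {x} m cs →
            ∃ λ m′ → Reach 1 (backTo (x , back) (List.replicate m empty) cs)
                             (at (x , ahead) (List.replicate m′ empty) cs)
  go-home zero    cs = 1 , next refl stop
  go-home (suc m) cs = suc m , next refl stop

  -- The claim covers every tape that represents the store, since popping leaves blanks behind and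
  -- the store alone does not determine the tape.
  record Steps (n : ℕ) (x : X) (σ : Store) (y : X) (τ : Store) : Set where
    constructor mkSteps
    field
      reach : ∀ {C} → Home x σ C → ∃ λ D → Home y τ D × ∃ λ k → k ≤ n × Reach k C D
  open Steps public

  goto-steps : ∀ {x y σ} → G x ≡ goto y → Steps 1 x σ y σ
  goto-steps {x} {y} e .reach (m , cs , rep , refl) =
    at (y , ahead) (List.replicate m empty) cs , (m , cs , rep , refl) , 1 , ≤-refl , step₁ cs
    where
    δ≡ : ∀ c → trackδ (x , ahead) c ≡ just ((y , ahead) , c , S)
    δ≡ c rewrite e = refl
    step₁ : ∀ cs → Reach 1 (at (x , ahead) (List.replicate m empty) cs) (at (y , ahead) (List.replicate m empty) cs)
    step₁ []       = next (δ≡ _) stop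
    step₁ (c ∷ cs) = next (δ≡ _) stop

  push-steps : ∀ {x y r t σ} → G x ≡ push r t y →
               Steps (2 + 2 * length (lookup σ r)) x σ y (updateAt σ r (t ∷_))
  push-steps {x} {y} {r} {t} {σ} e .reach (m , cs , rep , refl) =
    _ , (proj₁ home , _ , rep′ , refl) , _ , ≤-reflexive (eq (length-reverse (lookup σ r))) ,
    (push-walk _ e (rep r) ⊙ proj₂ home)
    where
    u = reverse (lookup σ r)
    home = go-home {y} m (put (length u) r (just t) cs)
    eq : ∀ {a b} → a ≡ b → 1 + 2 * a + 1 ≡ 2 + 2 * b
    eq {a} refl = +-comm (1 + 2 * a) 1
    rep′ : Rep (updateAt σ r (t ∷_)) (put (length u) r (just t) cs)
    rep′ s with s Fin.≟ r
    ... | yes refl rewrite lookup∘updateAt r {t ∷_} σ | unfold-reverse t (lookup σ r) =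
      track-put t (rep r)
    ... | no ne rewrite lookup∘updateAt′ s r {t ∷_} ne σ = track-put′ _ _ ne (rep s)

  pop-steps : ∀ {x r k σ} → G x ≡ pop r k →
              Steps (4 + 2 * length (lookup σ r)) x σ (k (top σ r)) (popped σ r)
  pop-steps {x} {r} {k} {σ} e .reach (m , cs , rep , refl)
    with lookup σ r in eqσ
  ... | [] with pop-empty-walk m e (subst (λ z → Track r cs (reverse z)) eqσ (rep r))
  ...   | m′ , p = _ , (m′ , extend cs , rep′ , refl) , 2 , s≤s (s≤s z≤n) , p
    where
    rep′ : Rep (popped σ r) (extend cs)
    rep′ s with s Fin.≟ r
    ... | yes refl rewrite lookup∘updateAt r {drop 1} σ | eqσ =
      track-extend (subst (λ z → Track r cs (reverse z)) eqσ (rep r))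
    ... | no ne rewrite lookup∘updateAt′ s r {drop 1} ne σ = track-extend (rep s)
  pop-steps {x} {r} {k} {σ} e .reach (m , cs , rep , refl) | t ∷ st =
    _ , (proj₁ home , _ , rep′ , refl) , _ , bound (length-reverse st) ,
    (pop-walk _ u e track ⊙ proj₂ home)
    where
    u = reverse st
    track : Track r cs (u ∷ʳ t)
    track = subst (Track r cs) (trans (cong reverse eqσ) (unfold-reverse t st)) (rep r)
    home = go-home {k (just t)} m (clear (length u) r cs)
    bound : ∀ {a b} → a ≡ b → 3 + 2 * a + 1 ≤ 4 + 2 * suc b
    bound {a} refl = ≤-trans (≤-reflexive (+-comm (3 + 2 * a) 1)) (+-monoʳ-≤ 4 (*-monoʳ-≤ 2 (n≤1+n a)))
    rep′ : Rep (popped σ r) (clear (length u) r cs)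
    rep′ s with s Fin.≟ r
    ... | yes refl rewrite lookup∘updateAt r {drop 1} σ | eqσ = track-clear u track
    ... | no ne rewrite lookup∘updateAt′ s r {drop 1} ne σ = track-clear′ _ ne (rep s)

  opCost : ℕ → ℕ
  opCost H = 4 + 2 * H

  steps-trans : ∀ {m n x σ y τ z ρ} → Steps m x σ y τ → Steps n y τ z ρ → Steps (m + n) x σ z ρ
  steps-trans f g .reach h with f .reach h
  ... | D , hD , k , k≤m , p with g .reach hD
  ... | E , hE , l , l≤n , q = E , hE , k + l , +-mono-≤ k≤m l≤n , p ⊙ q

  steps-relax : ∀ {m n x σ y τ} → m ≤ n → Steps m x σ y τ → Steps n x σ y τ
  steps-relax m≤n f .reach h with f .reach h
  ... | D , hD , k , k≤m , p = D , hD , k , ≤-trans k≤m m≤n , p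

  module _ (H : ℕ) where

    private
      K = opCost H

    op-bound : ∀ {a} (σ : Store) r → a ≤ 4 → total σ ≤ H → a + 2 * length (lookup σ r) ≤ K
    op-bound σ r a≤4 σ≤H = +-mono-≤ a≤4 (*-monoʳ-≤ 2 (≤-trans (length≤total σ r) σ≤H))

    -- `H` is a budget for the total stack height during the whole run. By `total-exec` a part of
    -- cost m raises the total by at most m, so remaining cost plus current total stays within `H`,
    -- and each unit of cost takes at most `opCost H` machine steps.
    simulate : ∀ {c σ n τ} → Exec c σ n τ → n + total σ ≤ H →
               (ι : Label c → X) (x : X) → (∀ l → G (ι l) ≡ compile c ι x l) →
               Steps (n * K) (ι (entry c)) σ x τ
    simulate skipE _ ι x g = steps-relax (s≤s z≤n) (goto-steps (g tt))
    simulate (pushE {σ} {r}) σ≤H ι x g =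
      steps-relax (≤-trans (op-bound σ r (s≤s (s≤s z≤n)) (m+n≤o⇒n≤o 1 σ≤H)) (m≤m+n K 0)) (push-steps (g tt))
    simulate (seqE {σ = σ} {τ} {m = m} {n} p q) σ≤H ι x g =
      steps-relax (≤-reflexive (sym (*-distribʳ-+ K m n))) (steps-trans
        (simulate p (≤-trans (+-monoˡ-≤ (total σ) (m≤m+n m n)) σ≤H) (ι ∘ inj₁) _ (g ∘ inj₁))
        (simulate q (≤-trans (after p) σ≤H) (ι ∘ inj₂) x (g ∘ inj₂)))
      where
      after : ∀ {c} → Exec c σ m τ → n + total τ ≤ m + n + total σ
      after p = ≤-trans (+-monoʳ-≤ n (total-exec p))
        (≤-reflexive (trans (sym (+-assoc n m _)) (cong (_+ total σ) (+-comm n m))))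
    simulate (popE {r} {k} {σ} {n = n} p) σ≤H ι x g =
      steps-trans (steps-relax (op-bound σ r ≤-refl (m+n≤o⇒n≤o (suc n) σ≤H)) (pop-steps (g (inj₁ tt))))
        (simulate p (≤-trans (+-monoʳ-≤ n (total-pop σ r)) (m+n≤o⇒n≤o 1 σ≤H)) _ x (λ l → g (inj₂ (_ , l))))
    simulate (exitE {r} {k} {σ} e) σ≤H ι x g =
      steps-relax (≤-trans (op-bound σ r ≤-refl (m+n≤o⇒n≤o 1 σ≤H)) (m≤m+n K 0))
        (subst (λ o → Steps (4 + 2 * length (lookup σ r)) _ σ (maybe′ (λ b → ι (inj₂ (b , entry (k b)))) x o) (popped σ r)) e
          (pop-steps (g (inj₁ tt))))
    simulate (iterE {r} {k} {σ} {τ} {b = b} {m} {n} e p q) σ≤H ι x g =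
      steps-relax (+-monoʳ-≤ K (≤-reflexive (sym (*-distribʳ-+ K m n))))
       (steps-trans
        (steps-relax (op-bound σ r ≤-refl (m+n≤o⇒n≤o (suc (m + n)) σ≤H))
          (subst (λ o → Steps (4 + 2 * length (lookup σ r)) _ σ (maybe′ (λ b → ι (inj₂ (b , entry (k b)))) x o) (popped σ r)) e
            (pop-steps (g (inj₁ tt)))))
        (steps-trans
          (simulate p (≤-trans (+-mono-≤ (m≤n⇒m≤1+n (m≤m+n m n)) (total-pop σ r)) σ≤H) _ _ (λ l → g (inj₂ (_ , l))))
          (simulate q (≤-trans (after p) σ≤H) ι x g)))
      where
      after : ∀ {c} → Exec c (popped σ r) m τ → n + total τ ≤ suc (m + n) + total σ
      after p = ≤-trans (+-monoʳ-≤ n (≤-trans (total-exec p) (+-monoʳ-≤ m (total-pop σ r))))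
        (≤-trans (≤-reflexive (trans (sym (+-assoc n m _)) (cong (_+ total σ) (+-comm n m)))) (n≤1+n _))
    simulate (relax {σ = σ} m≤n p) σ≤H ι x g =
      steps-relax (*-monoˡ-≤ K m≤n) (simulate p (≤-trans (+-monoˡ-≤ (total σ) m≤n) σ≤H) ι x g)

-- The last bit is on top of the stack, so that the track of C, which starts at the bottom, reads as
-- the word itself.
ioStore : List Bool → Store
ioStore x = [] ∷ [] ∷ reverse (map bit x) ∷ [] ∷ [] ∷ []

module _ (c : Cmd) where

  flow : Maybe (Label c) → Instr (Maybe (Label c))
  flow nothing  = halt
  flow (just l) = compile c just nothing l

  open Tracks (finite-Maybe (finite-Label c)) (just (entry c)) flow

  track-bits : ∀ x → Track rC (map bitCell x) (map bit x)
  track-bits []      = end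
  track-bits (b ∷ x) = cell refl (track-bits x)

  track-void : ∀ {r} x → (∀ b → lookup (bitCell b) r ≡ nothing) → Track r (map bitCell x) []
  track-void []      f = end
  track-void (b ∷ x) f = gap (f b) (track-void x f)

  rep-input : ∀ x → Rep (ioStore x) (map bitCell x)
  rep-input x rA = track-void x λ { false → refl ; true → refl }
  rep-input x rB = track-void x λ { false → refl ; true → refl }
  rep-input x rC rewrite reverse-involutive (map {B = Tok} bit x) = track-bits x
  rep-input x rD = track-void x λ { false → refl ; true → refl }
  rep-input x rE = track-void x λ { false → refl ; true → refl }

  -- A cell is determined by its five tracks, so a tape with nothing but `y` on track C is the raw
  -- word followed by blanks.
  cells-output : ∀ y {cs} → Track rA cs [] → Track rB cs [] → Track rC cs (map bit y) →
                 Track rD cs [] → Track rE cs [] →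
                 ∃ λ m → cs ≡ map bitCell y List.++ List.replicate m empty
  cells-output [] end end end end end = 0 , refl
  cells-output [] {(_ ∷ _ ∷ _ ∷ _ ∷ _ ∷ []) ∷ _} (gap refl a) (gap refl b) (gap refl c) (gap refl d) (gap refl e)
    with cells-output [] a b c d e
  ... | m , refl = suc m , refl
  cells-output (t ∷ y) {(_ ∷ _ ∷ _ ∷ _ ∷ _ ∷ []) ∷ _} (gap refl a) (gap refl b) (cell refl c) (gap refl d) (gap refl e)
    with cells-output y a b c d e
  ... | m , refl = m , refl

  rep-output : ∀ y {cs} → Rep (ioStore y) cs → ∃ λ m → cs ≡ map bitCell y List.++ List.replicate m empty
  rep-output y rep = cells-output y (rep rA) (rep rB)
    (subst (Track rC _) (reverse-involutive (map bit y)) (rep rC)) (rep rD) (rep rE)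

  program : TM
  program = realise

  total-io : ∀ x → total (ioStore x) ≡ length x
  total-io x = trans (+-identityʳ _) (trans (length-reverse (map {B = Tok} bit x)) (length-map bit x))

  program-run : ∀ {N n} x y → Exec c (ioStore x) n (ioStore y) →
                n * (4 + 2 * (n + length x)) ≤ N →
                runTM program N x ≡ just y
  program-run {n = n} x y p n≤N
    with simulate (n + length x) p (≤-reflexive (cong (n +_) (total-io x))) just nothing (λ _ → refl)
           .reach (0 , map bitCell x , rep-input x , refl)
  ... | _ , (m , cs , rep , refl) , k , k≤n , q with rep-output y rep
  ... | m′ , refl = runTM-realise x y m′ refl q (≤-trans k≤n n≤N)

-- Functions computed by stack programs

pattern ⟪_,_,_,_,_⟫ a b c d e = a ∷ b ∷ c ∷ d ∷ e ∷ []

infixr 5 _▹_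
-- The closing `#` allows words to be piled up on one stack: a loop consumes the topmost word
-- together with its `#` and nothing more.
_▹_ : List Bool → Stack → Stack
[]      ▹ s = # ∷ s
(b ∷ v) ▹ s = bit b ∷ (v ▹ s)

length-▹ : ∀ v s → length (v ▹ s) ≡ suc (length v + length s)
length-▹ []      s = refl
length-▹ (b ∷ v) s = cong suc (length-▹ v s)

-- The cost of a loop with n rounds of cost k: one unit for the test in each round, and one for
-- leaving.
lin : ℕ → ℕ → ℕ
lin k zero    = 1
lin k (suc n) = suc (k + lin k n)

lin-formula : ∀ k n → lin k n ≡ 1 + n * suc k
lin-formula k zero    = refl
lin-formula k (suc n) = cong suc (trans (cong (k +_) (lin-formula k n)) (+-suc k _))

bound-lin : ∀ {X : Set} {s t u : X → ℕ} → PolyBounded s u → PolyBounded s t → PolyBounded s (λ v → lin (u v) (t v))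
bound-lin {u = u} bu bt = bound-≤ (λ v → ≤-reflexive (lin-formula (u v) _))
  (bound-+ (bound-const 1) (bound-* bt (bound-+ (bound-const 1) bu)))

lin-mono : ∀ {k l m n} → k ≤ l → m ≤ n → lin k m ≤ lin l n
lin-mono {k} {l} {m} {n} k≤l m≤n = subst₂ _≤_ (sym (lin-formula k m)) (sym (lin-formula l n))
  (+-monoʳ-≤ 1 (*-mono-≤ m≤n (s≤s k≤l)))

infix 4 _⇒_
-- The frame variables let such a program run as a subroutine with other data stored beneath and
-- beside its argument. The index type confines the claim to inputs of the form `f v`, such as
-- well-formed pairs.
record _⇒_ {X : Set} (f g : X → List Bool) : Set where
  no-eta-equality
  field
    prog  : Cmd
    cost  : X → ℕ
    exec  : ∀ v {a b c d e} → Exec prog ⟪ f v ▹ a , b , c , d , e ⟫ (cost v) ⟪ g v ▹ a , b , c , d , e ⟫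
    bound : PolyBounded (length ∘ f) cost
open _⇒_

-- From otherwise empty stacks, a run adds at most its cost to the total height. This keeps
-- compositions polynomial.
out-bound : ∀ {X : Set} {f g : X → List Bool} → f ⇒ g → PolyBounded (length ∘ f) (length ∘ g)
out-bound {f = f} {g} F = bound-≤ output≤ (bound-+ (bound F) (bound-+ (bound-const 1) bound-self))
  where
  output≤ : ∀ v → length (g v) ≤ cost F v + (1 + length (f v))
  output≤ v = ≤-trans (≤-trans (n≤1+n _) (m≤m+n _ 0)) (subst₂ (λ m n → m + 0 ≤ cost F v + n)
    (trans (length-▹ (g v) []) (cong suc (+-identityʳ _)))
    (trans (+-identityʳ _) (trans (length-▹ (f v) []) (cong suc (+-identityʳ _))))
    (total-exec (exec F v {[]} {[]} {[]} {[]} {[]})))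

module _ {X : Set} {f g : X → List Bool} where

  infixl 9 _≫_
  _≫_ : ∀ {h} → f ⇒ g → g ⇒ h → f ⇒ h
  (F ≫ G) .prog   = prog F ⨾ prog G
  (F ≫ G) .cost v = cost F v + cost G v
  (F ≫ G) .exec v = seqE (exec F v) (exec G v)
  (F ≫ G) .bound  = bound-+ (bound F) (bound-trans (out-bound F) (bound G))

  reindex : {Y : Set} (h : Y → X) → f ⇒ g → f ∘ h ⇒ g ∘ h
  reindex h F .prog   = prog F
  reindex h F .cost v = cost F (h v)
  reindex h F .exec v = exec F (h v)
  reindex h F .bound  = proj₁ (bound F) , λ v → proj₂ (bound F) (h v)

  ⇒-cong : ∀ {h} → (∀ v → g v ≡ h v) → f ⇒ g → f ⇒ h
  ⇒-cong e F .prog   = prog F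
  ⇒-cong e F .cost   = cost F
  ⇒-cong e F .exec v {a} {b} {c} {d} {e′} =
    subst (λ z → Exec (prog F) _ _ ⟪ z ▹ a , b , c , d , e′ ⟫) (e v) (exec F v)
  ⇒-cong e F .bound  = bound F

recast : ∀ {c σ m n τ ρ} → m ≡ n → τ ≡ ρ → Exec c σ m τ → Exec c σ n ρ
recast refl refl p = p

-- Moving, discarding and copying words

move : Reg → Reg → Cmd
move r s = loop r λ b → push s (bit b)

discard : Reg → Cmd
discard r = loop r λ _ → skip

module _ {a b c d e : Stack} where

  moveAB : ∀ v {w} → Exec (move rA rB) ⟪ v ▹ a , w ▹ b , c , d , e ⟫ (lin 1 (length v)) ⟪ a , (v ʳ++ w) ▹ b , c , d , e ⟫
  moveAB []      = exitE refl
  moveAB (t ∷ v) = iterE refl pushE (moveAB v)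

  moveBA : ∀ v {w} → Exec (move rB rA) ⟪ w ▹ a , v ▹ b , c , d , e ⟫ (lin 1 (length v)) ⟪ (v ʳ++ w) ▹ a , b , c , d , e ⟫
  moveBA []      = exitE refl
  moveBA (t ∷ v) = iterE refl pushE (moveBA v)

  moveCB : ∀ v {w} → Exec (move rC rB) ⟪ a , w ▹ b , v ▹ c , d , e ⟫ (lin 1 (length v)) ⟪ a , (v ʳ++ w) ▹ b , c , d , e ⟫
  moveCB []      = exitE refl
  moveCB (t ∷ v) = iterE refl pushE (moveCB v)

  moveAC : ∀ v {w} → Exec (move rA rC) ⟪ v ▹ a , b , w ▹ c , d , e ⟫ (lin 1 (length v)) ⟪ a , b , (v ʳ++ w) ▹ c , d , e ⟫
  moveAC []      = exitE refl
  moveAC (t ∷ v) = iterE refl pushE (moveAC v)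

  moveDC : ∀ v {w} → Exec (move rD rC) ⟪ a , b , w ▹ c , v ▹ d , e ⟫ (lin 1 (length v)) ⟪ a , b , (v ʳ++ w) ▹ c , d , e ⟫
  moveDC []      = exitE refl
  moveDC (t ∷ v) = iterE refl pushE (moveDC v)

  moveEA : ∀ v {w} → Exec (move rE rA) ⟪ w ▹ a , b , c , d , v ▹ e ⟫ (lin 1 (length v)) ⟪ (v ʳ++ w) ▹ a , b , c , d , e ⟫
  moveEA []      = exitE refl
  moveEA (t ∷ v) = iterE refl pushE (moveEA v)

  discardA : ∀ v → Exec (discard rA) ⟪ v ▹ a , b , c , d , e ⟫ (lin 1 (length v)) ⟪ a , b , c , d , e ⟫
  discardA []      = exitE refl
  discardA (t ∷ v) = iterE refl skipE (discardA v)

  discardB : ∀ v → Exec (discard rB) ⟪ a , v ▹ b , c , d , e ⟫ (lin 1 (length v)) ⟪ a , b , c , d , e ⟫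
  discardB []      = exitE refl
  discardB (t ∷ v) = iterE refl skipE (discardB v)

  discardC : ∀ v → Exec (discard rC) ⟪ a , b , v ▹ c , d , e ⟫ (lin 1 (length v)) ⟪ a , b , c , d , e ⟫
  discardC []      = exitE refl
  discardC (t ∷ v) = iterE refl skipE (discardC v)

unmoveBA : ∀ {a b c d e} v →
  Exec (move rB rA) ⟪ # ∷ a , (v ʳ++ []) ▹ b , c , d , e ⟫ (lin 1 (length v)) ⟪ v ▹ a , b , c , d , e ⟫
unmoveBA {a} {b} {c} {d} {e} v =
  recast (cong (lin 1) (length-reverse v)) (cong (λ w → ⟪ w ▹ a , b , c , d , e ⟫) (reverse-involutive v))
    (moveBA (v ʳ++ []) {[]})

spread : Cmd
spread = loop rB λ t → push rA (bit t) ⨾ push rC (bit t)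

-- The detour through B reverses the word, and spreading it from there onto A and C reverses both
-- copies back.
copy : Cmd
copy = push rB # ⨾ move rA rB ⨾ push rA # ⨾ push rC # ⨾ spread

copy-cost : ℕ → ℕ
copy-cost n = 1 + (lin 1 n + (1 + (1 + lin 2 n)))

restore : Cmd
restore = push rB # ⨾ move rC rB ⨾ push rA # ⨾ move rB rA

restore-cost : ℕ → ℕ
restore-cost n = 1 + (lin 1 n + (1 + lin 1 n))

module _ {a b c d e : Stack} where

  spread-exec : ∀ v {w w′} →
    Exec spread ⟪ w ▹ a , v ▹ b , w′ ▹ c , d , e ⟫ (lin 2 (length v)) ⟪ (v ʳ++ w) ▹ a , b , (v ʳ++ w′) ▹ c , d , e ⟫
  spread-exec []      = exitE refl
  spread-exec (t ∷ v) = iterE refl (seqE pushE pushE) (spread-exec v)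

  copy-exec : ∀ v → Exec copy ⟪ v ▹ a , b , c , d , e ⟫ (copy-cost (length v)) ⟪ v ▹ a , b , v ▹ c , d , e ⟫
  copy-exec v = seqE pushE (seqE (moveAB v {[]}) (seqE pushE (seqE pushE
    (recast (cong (lin 2) (length-reverse v)) (cong (λ w → ⟪ w ▹ a , b , w ▹ c , d , e ⟫) (reverse-involutive v))
      (spread-exec (v ʳ++ []) {[]} {[]})))))

  restore-exec : ∀ v → Exec restore ⟪ a , b , v ▹ c , d , e ⟫ (restore-cost (length v)) ⟪ v ▹ a , b , c , d , e ⟫
  restore-exec v = seqE pushE (seqE (moveCB v {[]}) (seqE pushE (unmoveBA v)))

bound-copy : ∀ {X : Set} {s t : X → ℕ} → PolyBounded s t → PolyBounded s (copy-cost ∘ t)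
bound-copy p = bound-+ (bound-const 1) (bound-+ (bound-lin (bound-const 1) p)
  (bound-+ (bound-const 1) (bound-+ (bound-const 1) (bound-lin (bound-const 2) p))))

bound-restore : ∀ {X : Set} {s t : X → ℕ} → PolyBounded s t → PolyBounded s (restore-cost ∘ t)
bound-restore p = bound-+ (bound-const 1) (bound-+ (bound-lin (bound-const 1) p)
  (bound-+ (bound-const 1) (bound-lin (bound-const 1) p)))

module _ {X : Set} {f : X → List Bool} where

  ⇒-cons : ∀ t → f ⇒ (λ v → t ∷ f v)
  ⇒-cons t .prog   = push rA (bit t)
  ⇒-cons t .cost v = 1
  ⇒-cons t .exec v = pushE
  ⇒-cons t .bound  = bound-const 1

  ⇒-id : f ⇒ f
  ⇒-id .prog   = skip
  ⇒-id .cost v = 1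
  ⇒-id .exec v = skipE
  ⇒-id .bound  = bound-const 1

  ⇒-nil : f ⇒ (λ _ → [])
  ⇒-nil .prog   = discard rA ⨾ push rA #
  ⇒-nil .cost v = lin 1 (length (f v)) + 1
  ⇒-nil .exec v = seqE (discardA (f v)) pushE
  ⇒-nil .bound  = bound-+ (bound-lin (bound-const 1) bound-self) (bound-const 1)

⇒-const : ∀ {X : Set} {f : X → List Bool} w → f ⇒ (λ _ → w)
⇒-const []      = ⇒-nil
⇒-const (t ∷ w) = ⇒-const w ≫ ⇒-cons t

-- Pairing and unpairing

double : Cmd
double = loop rB λ t → push rA (bit t) ⨾ push rA (bit t)

double-exec : ∀ {a b c d e} v {w u} →
  Exec double ⟪ pair w u ▹ a , v ▹ b , c , d , e ⟫ (lin 2 (length v)) ⟪ pair (v ʳ++ w) u ▹ a , b , c , d , e ⟫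
double-exec []      = exitE refl
double-exec (t ∷ v) = iterE refl (seqE pushE pushE) (double-exec v)

module _ {X : Set} {f g h : X → List Bool} where

  -- The second component is computed first, so that it lies beneath the first; the argument waits
  -- on C meanwhile. The first component is then reversed onto B and returned with doubled bits on
  -- top of the separator 01.
  ⇒-pair : f ⇒ g → f ⇒ h → f ⇒ (λ v → pair (g v) (h v))
  ⇒-pair G H .prog = copy ⨾ prog H ⨾ restore ⨾ prog G ⨾ push rB # ⨾ move rA rB ⨾
                     push rA (bit true) ⨾ push rA (bit false) ⨾ double
  ⇒-pair G H .cost v =
    copy-cost (length (f v)) + (cost H v + (restore-cost (length (f v)) + (cost G v +
      (1 + (lin 1 (length (g v)) + (1 + (1 + lin 2 (length (g v)))))))))
  ⇒-pair G H .exec v {a} {b} {c} {d} {e} =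
    seqE (copy-exec (f v)) (seqE (exec H v) (seqE (restore-exec (f v)) (seqE (exec G v)
      (seqE pushE (seqE (moveAB (g v) {[]}) (seqE pushE (seqE pushE
        (recast (cong (lin 2) (length-reverse (g v)))
          (cong (λ w → ⟪ pair w (h v) ▹ a , b , c , d , e ⟫) (reverse-involutive (g v)))
          (double-exec (g v ʳ++ []) {[]})))))))))
  ⇒-pair G H .bound =
    bound-+ (bound-copy bound-self) (bound-+ (bound H) (bound-+ (bound-restore bound-self) (bound-+ (bound G)
      (bound-+ (bound-const 1) (bound-+ (bound-lin (bound-const 1) (out-bound G))
        (bound-+ (bound-const 1) (bound-+ (bound-const 1) (bound-lin (bound-const 2) (out-bound G)))))))))

halve : Bool → Maybe Tok → Cmd
halve false (just (bit true)) = push rA #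
halve t     (just (bit _))    = push rB (bit t)
halve _     _                 = push rA #

-- Pushing # back makes the loop stop right after the separator 01.
unpair : Cmd
unpair = loop rA λ t → pop rA (halve t)

unpair-exec : ∀ {a b c d e} x {w u} →
  Exec unpair ⟪ pair x w ▹ a , u ▹ b , c , d , e ⟫ (lin 2 (suc (length x))) ⟪ w ▹ a , (x ʳ++ u) ▹ b , c , d , e ⟫
unpair-exec []          = iterE refl (popE pushE) (exitE refl)
unpair-exec (false ∷ x) = iterE refl (popE pushE) (unpair-exec x)
unpair-exec (true ∷ x)  = iterE refl (popE pushE) (unpair-exec x)

length-pair : ∀ x w → length (pair x w) ≡ length x + (length x + (2 + length w))
length-pair []      w = refl
length-pair (t ∷ x) w = cong suc (trans (cong suc (length-pair x w)) (sym (+-suc (length x) _)))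

module _ {X : Set} {g h : X → List Bool} where

  private
    gh : X → List Bool
    gh v = pair (g v) (h v)

  bound-fst : PolyBounded (length ∘ gh) (length ∘ g)
  bound-fst = bound-≤ (λ v → ≤-trans (m≤m+n _ _) (≤-reflexive (sym (length-pair (g v) (h v))))) bound-self

  bound-snd : PolyBounded (length ∘ gh) (length ∘ h)
  bound-snd = bound-≤ (λ v → ≤-trans (≤-trans (m≤n+m _ 2) (≤-trans (m≤n+m _ (length (g v))) (m≤n+m _ (length (g v)))))
    (≤-reflexive (sym (length-pair (g v) (h v))))) bound-self

  ⇒-fst : gh ⇒ g
  ⇒-fst .prog   = push rB # ⨾ unpair ⨾ discard rA ⨾ push rA # ⨾ move rB rA
  ⇒-fst .cost v = 1 + (lin 2 (suc (length (g v))) + (lin 1 (length (h v)) + (1 + lin 1 (length (g v)))))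
  ⇒-fst .exec v = seqE pushE (seqE (unpair-exec (g v) {h v} {[]}) (seqE (discardA (h v))
    (seqE pushE (unmoveBA (g v)))))
  ⇒-fst .bound = bound-+ (bound-const 1) (bound-+ (bound-lin (bound-const 2) (bound-+ (bound-const 1) bound-fst))
    (bound-+ (bound-lin (bound-const 1) bound-snd) (bound-+ (bound-const 1) (bound-lin (bound-const 1) bound-fst))))

  ⇒-snd : gh ⇒ h
  ⇒-snd .prog   = push rB # ⨾ unpair ⨾ discard rB
  ⇒-snd .cost v = 1 + (lin 2 (suc (length (g v))) + lin 1 (length (g v)))
  ⇒-snd .exec v = seqE pushE (seqE (unpair-exec (g v) {h v} {[]})
    (recast (cong (lin 1) (length-reverse (g v))) refl (discardB (g v ʳ++ []))))
  ⇒-snd .bound = bound-+ (bound-const 1) (bound-+ (bound-lin (bound-const 2) (bound-+ (bound-const 1) bound-fst))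
    (bound-lin (bound-const 1) bound-fst))

branch : Cmd → Cmd → Maybe Tok → Cmd
branch c d (just (bit true)) = pop rA (λ _ → skip) ⨾ restore ⨾ c
branch c d _                 = pop rA (λ _ → skip) ⨾ restore ⨾ d

module _ {X : Set} {f g h : X → List Bool} {P : X → Bool} where

  -- The test consumes one copy of the argument while another waits on C. Both branches are charged,
  -- which avoids a case distinction in the bound.
  ⇒-if : f ⇒ (λ v → P v ∷ []) → f ⇒ g → f ⇒ h → f ⇒ (λ v → if P v then g v else h v)
  ⇒-if C G H .prog = copy ⨾ prog C ⨾ pop rA (branch (prog G) (prog H))
  ⇒-if C G H .cost v = copy-cost (length (f v)) + (cost C v + suc (2 + (restore-cost (length (f v)) + (cost G v + cost H v))))
  ⇒-if C G H .exec v {a} {b} {c} {d} {e} = seqE (copy-exec (f v)) (seqE (exec C v) (branches (P v)))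
    where
    n = 2 + (restore-cost (length (f v)) + (cost G v + cost H v))
    branches : ∀ t → Exec (pop rA (branch (prog G) (prog H))) ⟪ bit t ∷ # ∷ a , b , f v ▹ c , d , e ⟫ (suc n)
                          ⟪ (if t then g v else h v) ▹ a , b , c , d , e ⟫
    branches true  = popE (relax (+-monoʳ-≤ 2 (+-monoʳ-≤ (restore-cost (length (f v))) (m≤m+n _ _)))
      (seqE (popE skipE) (seqE (restore-exec (f v)) (exec G v))))
    branches false = popE (relax (+-monoʳ-≤ 2 (+-monoʳ-≤ (restore-cost (length (f v))) (m≤n+m _ (cost G v))))
      (seqE (popE skipE) (seqE (restore-exec (f v)) (exec H v))))
  ⇒-if C G H .bound = bound-+ (bound-copy bound-self) (bound-+ (bound C) (bound-+ (bound-const 1)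
    (bound-+ (bound-const 2) (bound-+ (bound-restore bound-self) (bound-+ (bound G) (bound H))))))

headBit : List Bool → Bool
headBit []      = false
headBit (t ∷ _) = t

module _ {X : Set} {f : X → List Bool} where

  ⇒-tail : f ⇒ (λ v → List.drop 1 (f v))
  ⇒-tail .prog = pop rA rest
    where
    rest : Maybe Tok → Cmd
    rest (just (bit _)) = skip
    rest _              = push rA #
  ⇒-tail .cost v = 2
  ⇒-tail .exec v with f v
  ... | []    = popE pushE
  ... | _ ∷ _ = popE skipE
  ⇒-tail .bound = bound-const 2

  ⇒-head : f ⇒ (λ v → headBit (f v) ∷ [])
  ⇒-head .prog = pop rA first
    where
    first : Maybe Tok → Cmd
    first (just (bit t)) = discard rA ⨾ push rA # ⨾ push rA (bit t)
    first _              = push rA # ⨾ push rA (bit false)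
  ⇒-head .cost v = suc (lin 1 (length (f v)) + 2)
  ⇒-head .exec v with f v
  ... | []    = popE (relax (n≤1+n 2) (seqE pushE pushE))
  ... | t ∷ w = popE (relax (+-monoˡ-≤ 2 (lin-mono {1} ≤-refl (n≤1+n (length w)))) (seqE (discardA w) (seqE pushE pushE)))
  ⇒-head .bound = bound-+ (bound-const 1) (bound-+ (bound-lin (bound-const 1) bound-self) (bound-const 2))

-- Equality of words

fail : Cmd
fail = pop rA λ _ → push rA (bit false)

compareBit : Bool → Maybe Tok → Cmd
compareBit false (just (bit false)) = skip
compareBit true  (just (bit true))  = skip
compareBit _     (just (bit _))     = fail
compareBit _     _                  = push rC # ⨾ fail

compareEnd : Maybe Tok → Cmd
compareEnd (just (bit _)) = discard rC ⨾ fail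
compareEnd _              = skip

compareStep : Bool → Bool → Bool → Bool
compareStep acc false false = acc
compareStep acc true  true  = acc
compareStep acc _     _     = false

-- Follows the run of the comparison: a mismatch is only recorded in the accumulator, and both words
-- are consumed to the end so that nothing is left on the stacks.
agree : Bool → List Bool → List Bool → Bool
agree acc []      []      = acc
agree acc []      (_ ∷ w) = false
agree acc (t ∷ x) []      = agree false x []
agree acc (t ∷ x) (u ∷ w) = agree (compareStep acc t u) x w

agree-refl : ∀ x → agree true x x ≡ true
agree-refl []          = refl
agree-refl (false ∷ x) = agree-refl x
agree-refl (true ∷ x)  = agree-refl x

agree-acc : ∀ {acc} x w → agree acc x w ≡ true → acc ≡ true
agree-acc []      []      p = p
agree-acc (t ∷ x) []      p with agree-acc x [] p
... | ()
agree-acc {acc} (t ∷ x) (u ∷ w) p with t | u | agree-acc {compareStep acc t u} x w p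
... | false | false | q = q
... | true  | true  | q = q

agree-sound : ∀ {acc} x w → agree acc x w ≡ true → x ≡ w
agree-sound []      []      p = refl
agree-sound (t ∷ x) []      p with agree-acc x [] p
... | ()
agree-sound {acc} (t ∷ x) (u ∷ w) p
  with t | u | agree-acc {compareStep acc t u} x w p | agree-sound {compareStep acc t u} x w p
... | false | false | _ | q = cong (false ∷_) q
... | true  | true  | _ | q = cong (true ∷_) q

-- The reversals come from the program, which reverses both words while loading them onto B and C.
sameWord : List Bool → List Bool → Bool
sameWord x w = agree true (reverse x) (reverse w)

sameWord-sound : ∀ x w → sameWord x w ≡ true → x ≡ w
sameWord-sound x w p = reverse-injective (agree-sound (reverse x) (reverse w) p)

sameWord-refl : ∀ x → sameWord x x ≡ true
sameWord-refl x = agree-refl (reverse x)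

compare-cost : ℕ → ℕ → ℕ
compare-cost m n = lin 4 m + (4 + lin 1 n)

compare-exec : ∀ {a b c d e} acc x w →
  Exec (loop rB (λ t → pop rC (compareBit t)) ⨾ pop rC compareEnd)
       ⟪ bit acc ∷ a , x ▹ b , w ▹ c , d , e ⟫ (compare-cost (length x) (length w))
       ⟪ bit (agree acc x w) ∷ a , b , c , d , e ⟫
compare-exec acc x w = whole (go acc x w)
  where
  -- The accumulator and the unread rest of `w` when the loop over `x` ends.
  steps : Bool → List Bool → List Bool → Bool × List Bool
  steps acc []      w       = acc , w
  steps acc (t ∷ x) []      = steps false x []
  steps acc (t ∷ x) (u ∷ w) = steps (compareStep acc t u) x w
  finish : Bool × List Bool → Bool
  finish (acc , [])    = acc
  finish (acc , _ ∷ _) = false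
  finish-steps : ∀ acc x w → finish (steps acc x w) ≡ agree acc x w
  finish-steps acc []      []      = refl
  finish-steps acc []      (_ ∷ w) = refl
  finish-steps acc (t ∷ x) []      = finish-steps false x []
  finish-steps acc (t ∷ x) (u ∷ w) = finish-steps (compareStep acc t u) x w
  length-steps : ∀ acc x w → length (proj₂ (steps acc x w)) ≤ length w
  length-steps acc []      w       = ≤-refl
  length-steps acc (t ∷ x) []      = length-steps false x []
  length-steps acc (t ∷ x) (u ∷ w) = m≤n⇒m≤1+n (length-steps (compareStep acc t u) x w)
  body : ∀ {a b c d e} acc t u →
    Exec (compareBit t (just (bit u))) ⟪ bit acc ∷ a , b , c , d , e ⟫ 3 ⟪ bit (compareStep acc t u) ∷ a , b , c , d , e ⟫
  body acc false false = relax (s≤s z≤n) skipE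
  body acc true  true  = relax (s≤s z≤n) skipE
  body acc false true  = relax (s≤s (s≤s z≤n)) (popE pushE)
  body acc true  false = relax (s≤s (s≤s z≤n)) (popE pushE)
  missing : ∀ {a b c d e} acc t →
    Exec (compareBit t (just #)) ⟪ bit acc ∷ a , b , c , d , e ⟫ 3 ⟪ bit false ∷ a , b , # ∷ c , d , e ⟫
  missing acc false = seqE pushE (popE pushE)
  missing acc true  = seqE pushE (popE pushE)
  go : ∀ {a b c d e} acc x w → Exec (loop rB (λ t → pop rC (compareBit t)))
       ⟪ bit acc ∷ a , x ▹ b , w ▹ c , d , e ⟫ (lin 4 (length x))
       ⟪ bit (proj₁ (steps acc x w)) ∷ a , b , proj₂ (steps acc x w) ▹ c , d , e ⟫
  go acc []      w       = exitE refl
  go acc (t ∷ x) []      = iterE refl (popE (missing acc t)) (go false x [])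
  go acc (t ∷ x) (u ∷ w) = iterE refl (popE (body acc t u)) (go (compareStep acc t u) x w)
  last : ∀ {a b c d e} acc w →
    Exec (pop rC compareEnd) ⟪ bit acc ∷ a , b , w ▹ c , d , e ⟫ (4 + lin 1 (length w)) ⟪ bit (finish (acc , w)) ∷ a , b , c , d , e ⟫
  last acc []      = relax (s≤s (s≤s z≤n)) (popE skipE)
  last acc (_ ∷ w) = relax
    (≤-trans (≤-reflexive (cong suc (+-comm _ 2)))
      (+-mono-≤ {3} {4} (n≤1+n 3) (lin-mono {1} ≤-refl (n≤1+n (length w)))))
    (popE (seqE (discardC w) (popE pushE)))
  whole : ∀ {a b c d e} → Exec (loop rB (λ t → pop rC (compareBit t)))
       ⟪ bit acc ∷ a , x ▹ b , w ▹ c , d , e ⟫ (lin 4 (length x))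
       ⟪ bit (proj₁ (steps acc x w)) ∷ a , b , proj₂ (steps acc x w) ▹ c , d , e ⟫ →
       Exec _ ⟪ bit acc ∷ a , x ▹ b , w ▹ c , d , e ⟫ (compare-cost (length x) (length w))
         ⟪ bit (agree acc x w) ∷ a , b , c , d , e ⟫
  whole {a} {b} {c} {d} {e} p = recast refl (cong (λ r → ⟪ bit r ∷ a , b , c , d , e ⟫) (finish-steps acc x w))
    (seqE p (relax (+-monoʳ-≤ 4 (lin-mono {1} ≤-refl (length-steps acc x w))) (last _ _)))

module _ {X : Set} {g h : X → List Bool} where

  ⇒-same : (λ v → pair (g v) (h v)) ⇒ (λ v → sameWord (g v) (h v) ∷ [])
  ⇒-same .prog = push rB # ⨾ unpair ⨾ push rC # ⨾ move rA rC ⨾ push rA # ⨾ push rA (bit true) ⨾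
                 loop rB (λ t → pop rC (compareBit t)) ⨾ pop rC compareEnd
  ⇒-same .cost v = 1 + (lin 2 (suc (length (g v))) + (1 + (lin 1 (length (h v)) + (1 + (1 +
                   compare-cost (length (g v)) (length (h v)))))))
  ⇒-same .exec v = seqE pushE (seqE (unpair-exec (g v) {h v} {[]}) (seqE pushE (seqE (moveAC (h v) {[]}) (seqE pushE (seqE pushE
    (recast (cong₂ compare-cost (length-reverse (g v)) (length-reverse (h v))) refl
      (compare-exec true (reverse (g v)) (reverse (h v)))))))))
  ⇒-same .bound = bound-+ (bound-const 1) (bound-+ (bound-lin (bound-const 2) (bound-+ (bound-const 1) g≤))
    (bound-+ (bound-const 1) (bound-+ (bound-lin (bound-const 1) h≤) (bound-+ (bound-const 1) (bound-+ (bound-const 1)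
      (bound-+ (bound-lin (bound-const 4) g≤) (bound-+ (bound-const 4) (bound-lin (bound-const 1) h≤))))))))
    where
    g≤ = bound-fst {g = g} {h}
    h≤ = bound-snd {g = g} {h}

-- Unary arithmetic

zeros : ℕ → List Bool
zeros n = List.replicate n false

addZeros : ℕ → List Bool → List Bool
addZeros zero    z = z
addZeros (suc n) z = addZeros n (false ∷ z)

addBlocks : ℕ → ℕ → List Bool → List Bool
addBlocks zero    m z = z
addBlocks (suc n) m z = addBlocks n m (addZeros m z)

addZeros-zeros : ∀ n m → addZeros n (zeros m) ≡ zeros (n + m)
addZeros-zeros zero    m = refl
addZeros-zeros (suc n) m = trans (addZeros-zeros n (suc m)) (cong zeros (+-suc n m))

addBlocks-zeros : ∀ n m k → addBlocks n m (zeros k) ≡ zeros (n * m + k)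
addBlocks-zeros zero    m k = refl
addBlocks-zeros (suc n) m k rewrite addZeros-zeros m k = trans (addBlocks-zeros n m (m + k))
  (cong zeros (trans (sym (+-assoc (n * m) m k)) (cong (_+ k) (+-comm (n * m) m))))

emit : Cmd
emit = loop rC λ t → push rA (bit false) ⨾ push rD (bit t)

-- One zero is produced per bit on C; the detour through D brings the word back to C for the next
-- round.
emitBlock : Cmd
emitBlock = push rD # ⨾ emit ⨾ push rC # ⨾ move rD rC

emitBlock-cost : ℕ → ℕ
emitBlock-cost n = 1 + (lin 2 n + (1 + lin 1 n))

module _ {a b c d e : Stack} where

  emit-exec : ∀ w {z u} → Exec emit ⟪ z ▹ a , b , w ▹ c , u ▹ d , e ⟫ (lin 2 (length w))
                               ⟪ addZeros (length w) z ▹ a , b , c , (w ʳ++ u) ▹ d , e ⟫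
  emit-exec []      = exitE refl
  emit-exec (t ∷ w) {z} = iterE refl (seqE pushE pushE) (emit-exec w {false ∷ z})

  emitBlock-exec : ∀ w {z} → Exec emitBlock ⟪ z ▹ a , b , w ▹ c , d , e ⟫ (emitBlock-cost (length w))
                                  ⟪ addZeros (length w) z ▹ a , b , w ▹ c , d , e ⟫
  emitBlock-exec w {z} = seqE pushE (seqE (emit-exec w {z} {[]}) (seqE pushE
    (recast (cong (lin 1) (length-reverse w)) (cong (λ u → ⟪ addZeros (length w) z ▹ a , b , u ▹ c , d , e ⟫) (reverse-involutive w))
      (moveDC (w ʳ++ []) {[]}))))

emitBlocks-exec : ∀ {a b c d e} v w {z} →
  Exec (loop rB λ _ → emitBlock) ⟪ z ▹ a , v ▹ b , w ▹ c , d , e ⟫ (lin (emitBlock-cost (length w)) (length v))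
       ⟪ addBlocks (length v) (length w) z ▹ a , b , w ▹ c , d , e ⟫
emitBlocks-exec []      w = exitE refl
emitBlocks-exec (t ∷ v) w {z} = iterE refl (emitBlock-exec w {z}) (emitBlocks-exec v w)

module _ {X : Set} {g h : X → List Bool} where

  ⇒-times : (λ v → pair (g v) (h v)) ⇒ (λ v → zeros (length (g v) * length (h v)))
  ⇒-times .prog = push rB # ⨾ unpair ⨾ push rC # ⨾ move rA rC ⨾ push rA # ⨾
                  loop rB (λ _ → emitBlock) ⨾ discard rC
  ⇒-times .cost v = 1 + (lin 2 (suc (length (g v))) + (1 + (lin 1 (length (h v)) + (1 +
                    (lin (emitBlock-cost (length (h v))) (length (g v)) + lin 1 (length (h v)))))))
  ⇒-times .exec v {a} {b} {c} {d} {e} =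
    seqE pushE (seqE (unpair-exec (g v) {h v} {[]}) (seqE pushE (seqE (moveAC (h v) {[]}) (seqE pushE
    (seqE (recast (cong₂ (λ m n → lin (emitBlock-cost n) m) (length-reverse (g v)) (length-reverse (h v)))
             (cong (λ z → ⟪ z ▹ a , b , reverse (h v) ▹ c , d , e ⟫) product)
             (emitBlocks-exec (reverse (g v)) (reverse (h v)) {[]}))
          (recast (cong (lin 1) (length-reverse (h v))) refl (discardC (reverse (h v)))))))))
    where
    product : addBlocks (length (reverse (g v))) (length (reverse (h v))) [] ≡ zeros (length (g v) * length (h v))
    product rewrite length-reverse (g v) | length-reverse (h v) =
      trans (addBlocks-zeros (length (g v)) (length (h v)) 0) (cong zeros (+-identityʳ _))
  ⇒-times .bound = bound-+ (bound-const 1) (bound-+ (bound-lin (bound-const 2) (bound-+ (bound-const 1) g≤))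
    (bound-+ (bound-const 1) (bound-+ (bound-lin (bound-const 1) h≤) (bound-+ (bound-const 1)
      (bound-+ (bound-lin (bound-+ (bound-const 1) (bound-+ (bound-lin (bound-const 2) h≤)
        (bound-+ (bound-const 1) (bound-lin (bound-const 1) h≤)))) g≤) (bound-lin (bound-const 1) h≤))))))
    where
    g≤ = bound-fst {g = g} {h}
    h≤ = bound-snd {g = g} {h}

⇒-zeros : ∀ {X : Set} {f : X → List Bool} → f ⇒ (λ v → zeros (length (f v)))
⇒-zeros {f = f} = ⇒-cong (λ v → cong zeros (*-identityʳ (length (f v))))
  (⇒-pair ⇒-id (⇒-const (false ∷ [])) ≫ ⇒-times)

-- Horner's rule in unary: the input is paired with the value of the inner polynomial, the two
-- lengths are multiplied, and the coefficient is added bit by bit.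
⇒-eval : ∀ {X : Set} {f : X → List Bool} p → f ⇒ (λ v → zeros (eval p (length (f v))))
⇒-eval []      = ⇒-nil
⇒-eval {f = f} (c ∷ p) = ⇒-cong (λ v → cong (λ n → zeros (c + length (f v) * n)) (length-zeros (eval p (length (f v)))))
  (⇒-pair ⇒-id (⇒-eval p) ≫ ⇒-times ≫ more c)
  where
  length-zeros : ∀ n → length (zeros n) ≡ n
  length-zeros zero    = refl
  length-zeros (suc n) = cong suc (length-zeros n)
  more : ∀ c {n : _ → ℕ} → (λ v → zeros (n v)) ⇒ (λ v → zeros (c + n v))
  more zero    = ⇒-id
  more (suc c) = more c ≫ ⇒-cons false

-- Equivalence with Turing machines

Computable : {X : Set} (f g : X → List Bool) → Set
Computable f g = Σ TM λ M → Σ Poly λ q → ∀ v → runTM M (eval q (length (f v))) (f v) ≡ just (g v)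

module _ {X : Set} {f g : X → List Bool} (F : f ⇒ g) where

  -- Input and output words on C have no closing `#`; here the bottom of the stack ends the loop.
  moveCA-end : ∀ x {a b w d e} →
    Exec (move rC rA) ⟪ w ▹ a , b , map bit x , d , e ⟫ (lin 1 (length x)) ⟪ (x ʳ++ w) ▹ a , b , [] , d , e ⟫
  moveCA-end []      = exitE refl
  moveCA-end (t ∷ x) = iterE refl pushE (moveCA-end x)

  moveAC-end : ∀ x {a b w d e} →
    Exec (move rA rC) ⟪ x ▹ a , b , map bit w , d , e ⟫ (lin 1 (length x)) ⟪ a , b , map bit (x ʳ++ w) , d , e ⟫
  moveAC-end []      = exitE refl
  moveAC-end (t ∷ x) {w = w} = iterE refl pushE (moveAC-end x {w = t ∷ w})

  ioProgram : Cmd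
  ioProgram = push rA # ⨾ move rC rA ⨾ prog F ⨾ move rA rC

  io-cost : X → ℕ
  io-cost v = 1 + (lin 1 (length (f v)) + (cost F v + lin 1 (length (g v))))

  io-exec : ∀ v → Exec ioProgram (ioStore (f v)) (io-cost v) (ioStore (g v))
  io-exec v = seqE pushE (seqE
    (recast (cong (lin 1) (length-reverse (f v))) (cong (λ x → ⟪ x ▹ [] , [] , [] , [] , [] ⟫) (reverse-involutive (f v)))
      (subst (λ s → Exec (move rC rA) ⟪ # ∷ [] , [] , s , [] , [] ⟫ (lin 1 (length (reverse (f v))))
                         ⟪ (reverse (f v) ʳ++ []) ▹ [] , [] , [] , [] , [] ⟫)
        (reverse-map bit (f v)) (moveCA-end (reverse (f v)) {w = []})))
    (seqE (exec F v) (recast refl (cong (λ s → ⟪ [] , [] , s , [] , [] ⟫) (reverse-map bit (g v))) (moveAC-end (g v) {w = []}))))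

  computable : Computable f g
  computable = program ioProgram , proj₁ time , λ v → program-run ioProgram (f v) (g v) (io-exec v) (proj₂ time v)
    where
    io-bound : PolyBounded (length ∘ f) io-cost
    io-bound = bound-+ (bound-const 1) (bound-+ (bound-lin (bound-const 1) bound-self)
      (bound-+ (bound F) (bound-lin (bound-const 1) (out-bound F))))
    time : PolyBounded (length ∘ f) (λ v → io-cost v * (4 + 2 * (io-cost v + length (f v))))
    time = bound-* io-bound (bound-+ (bound-const 4) (bound-* (bound-const 2) (bound-+ io-bound bound-self)))

-- Unary, closed by a zero bit: successive pops recognise the symbol, and a `#` can never be
-- mistaken for part of a code.
symCode : ∀ {n} → Fin n → Stack → Stack
symCode zero    s = bit false ∷ s
symCode (suc i) s = bit true ∷ symCode i s

pushSym : ∀ {n} → Reg → Fin n → Cmd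
pushSym r zero    = push r (bit false)
pushSym r (suc i) = pushSym r i ⨾ push r (bit true)

popSym : ∀ n → Reg → (Fin n → Cmd) → Cmd
popSym zero    r k = skip
popSym (suc n) r k = pop r λ where
  (just (bit true))  → popSym n r (k ∘ suc)
  (just (bit false)) → k zero
  _                  → skip

update-top : ∀ {k} (σ : Vec Stack k) r {t s} → List.head (lookup (σ [ r ]≔ (t ∷ s)) r) ≡ just t
update-top (_ ∷ σ) zero    = refl
update-top (_ ∷ σ) (suc r) = update-top σ r

update-popped : ∀ {k} (σ : Vec Stack k) r {t s} → updateAt (σ [ r ]≔ (t ∷ s)) r (drop 1) ≡ σ [ r ]≔ s
update-popped (_ ∷ σ) zero    = refl
update-popped (x ∷ σ) (suc r) = cong (x ∷_) (update-popped σ r)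

update-pushed : ∀ {k} (σ : Vec Stack k) r {t s} → updateAt (σ [ r ]≔ s) r (t ∷_) ≡ σ [ r ]≔ (t ∷ s)
update-pushed (_ ∷ σ) zero    = refl
update-pushed (x ∷ σ) (suc r) = cong (x ∷_) (update-pushed σ r)

exec-cmd : ∀ {c d σ n τ} → c ≡ d → Exec c σ n τ → Exec d σ n τ
exec-cmd refl p = p

popE′ : ∀ {r k t s n τ} (σ : Store) → Exec (k (just t)) (σ [ r ]≔ s) n τ →
        Exec (pop r k) (σ [ r ]≔ (t ∷ s)) (suc n) τ
popE′ {r} {k} {n = n} {τ} σ p =
  popE (subst₂ (λ o ρ → Exec (k o) ρ n τ) (sym (update-top σ r)) (sym (update-popped σ r)) p)

popSym-exec : ∀ {n r k s m τ} (σ : Store) i → Exec (k i) (σ [ r ]≔ s) m τ →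
              Exec (popSym n r k) (σ [ r ]≔ symCode i s) (n + m) τ
popSym-exec {suc n} {m = m} σ zero p = popE′ σ (relax (m≤n+m m n) p)
popSym-exec {suc n} σ (suc i) p = popE′ σ (popSym-exec σ i p)

pushSym-exec : ∀ {n r s} (σ : Store) (i : Fin n) →
               Exec (pushSym r i) (σ [ r ]≔ s) n (σ [ r ]≔ symCode i s)
pushSym-exec {suc n} {r} σ zero = relax (s≤s z≤n) (recast refl (update-pushed σ r) pushE)
pushSym-exec {suc n} {r} σ (suc i) = recast (+-comm n 1) refl
  (seqE (pushSym-exec σ i) (recast refl (update-pushed σ r) pushE))

module Simulation (M : TM) where
  open TM M

  n m : ℕ
  n = suc nStates
  m = 3 + nExtra

  tapeCode : List (Fin m) → Stack → Stack
  tapeCode []       s = # ∷ s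
  tapeCode (x ∷ xs) s = symCode x (tapeCode xs s)

  -- The # below an exhausted half-tape is put back and read as a blank.
  getSym : Reg → (Fin m → Cmd) → Cmd
  getSym r k = pop r λ where
    (just (bit true))  → popSym (2 + nExtra) r (k ∘ suc)
    (just (bit false)) → k zero
    _                  → push r # ⨾ k zero

  getSym-cell : ∀ {r k s l τ} (σ : Store) i → Exec (k i) (σ [ r ]≔ s) l τ →
                Exec (getSym r k) (σ [ r ]≔ symCode i s) (m + l) τ
  getSym-cell {l = l} σ zero    p = popE′ σ (relax (m≤n+m l (2 + nExtra)) p)
  getSym-cell         σ (suc i) p = popE′ σ (popSym-exec σ i p)

  getSym-end : ∀ {r k s l τ} (σ : Store) → Exec (k zero) (σ [ r ]≔ (# ∷ s)) l τ →
               Exec (getSym r k) (σ [ r ]≔ (# ∷ s)) (m + l) τ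
  getSym-end {r} {l = l} σ p = popE′ σ (relax (s≤s (m≤n+m l (1 + nExtra)))
    (seqE (recast refl (update-pushed σ r) pushE) p))

  continue : Fin n → Cmd
  continue q = pushSym rD q ⨾ push rD (bit true)

  react : Fin m → Maybe (Fin n × Fin m × Move) → Cmd
  react s nothing              = pushSym rC s ⨾ push rD #
  react s (just (q , s′ , L)) = getSym rB λ x → pushSym rC s′ ⨾ pushSym rC x ⨾ continue q
  react s (just (q , s′ , R)) = pushSym rB s′ ⨾ getSym rC λ x → pushSym rC x ⨾ continue q
  react s (just (q , s′ , S)) = pushSym rC s′ ⨾ continue q

  body : Cmd
  body = popSym n rD λ q → getSym rC λ s → react s (δ q s)

  -- In the worst case two symbols are pushed and one is read before the new state and the loop bit
  -- are pushed.
  react-cost body-cost : ℕ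
  react-cost = m + (m + (m + (n + 1)))
  body-cost  = n + (m + react-cost)

  module _ (a b c d e : Stack) where

    -- C starts with the cell under the head, B with its left neighbour. In `running` the extra bit
    -- on D makes the loop go on; a halting round leaves a `#` there instead, which the loop
    -- consumes on leaving.
    halted running : Config M → Store
    halted  (cfg q l s r) = ⟪ a , tapeCode l b , tapeCode (s ∷ r) c , d , e ⟫
    running (cfg q l s r) = ⟪ a , tapeCode l b , tapeCode (s ∷ r) c , bit true ∷ symCode q d , e ⟫

    continue-exec : ∀ q {b c} → Exec (continue q) ⟪ a , b , c , d , e ⟫ (n + 1) ⟪ a , b , c , bit true ∷ symCode q d , e ⟫
    continue-exec q {b} {c} = seqE (pushSym-exec {n} {rD} ⟪ a , b , c , d , e ⟫ q) pushE

    push-continue : ∀ q x {b c} → Exec (pushSym rC x ⨾ continue q) ⟪ a , b , c , d , e ⟫ (m + (n + 1))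
                                       ⟪ a , b , symCode x c , bit true ∷ symCode q d , e ⟫
    push-continue q x {b} {c} = seqE (pushSym-exec {m} {rC} ⟪ a , b , c , d , e ⟫ x) (continue-exec q)

    react-exec : ∀ l s r q s′ μ → Exec (react s (just (q , s′ , μ))) ⟪ a , tapeCode l b , tapeCode r c , d , e ⟫ react-cost
                                       (running (moveHead {M = M} q μ l s′ r))
    react-exec [] s r q s′ L = getSym-end {r = rB} ⟪ a , [] , tapeCode r c , d , e ⟫
      (seqE (pushSym-exec {m} {rC} ⟪ a , # ∷ b , tapeCode r c , d , e ⟫ s′) (push-continue q zero))
    react-exec (x ∷ l) s r q s′ L = getSym-cell {r = rB} ⟪ a , [] , tapeCode r c , d , e ⟫ x
      (seqE (pushSym-exec {m} {rC} ⟪ a , tapeCode l b , tapeCode r c , d , e ⟫ s′) (push-continue q x))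
    react-exec l s [] q s′ R = seqE (pushSym-exec {m} {rB} ⟪ a , tapeCode l b , # ∷ c , d , e ⟫ s′)
      (getSym-end {r = rC} ⟪ a , symCode s′ (tapeCode l b) , [] , d , e ⟫ (push-continue q zero))
    react-exec l s (x ∷ r) q s′ R = seqE (pushSym-exec {m} {rB} ⟪ a , tapeCode l b , tapeCode (x ∷ r) c , d , e ⟫ s′)
      (getSym-cell {r = rC} ⟪ a , symCode s′ (tapeCode l b) , [] , d , e ⟫ x (push-continue q x))
    react-exec l s r q s′ S = relax (≤-trans (m≤n+m _ m) (m≤n+m _ m)) (push-continue q s′)

    halt-exec : ∀ l s r → Exec (react s nothing) ⟪ a , tapeCode l b , tapeCode r c , d , e ⟫ react-cost
                               ⟪ a , tapeCode l b , tapeCode (s ∷ r) c , # ∷ d , e ⟫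
    halt-exec l s r = relax (+-monoʳ-≤ m (≤-trans (m≤n+m 1 n) (≤-trans (m≤n+m _ m) (m≤n+m _ m))))
      (seqE (pushSym-exec {m} {rC} ⟪ a , tapeCode l b , tapeCode r c , d , e ⟫ s) pushE)

    body-exec : ∀ q l s r {τ} → Exec (react s (δ q s)) ⟪ a , tapeCode l b , tapeCode r c , d , e ⟫ react-cost τ →
                Exec body ⟪ a , tapeCode l b , tapeCode (s ∷ r) c , symCode q d , e ⟫ body-cost τ
    body-exec q l s r p = popSym-exec {r = rD} ⟪ a , tapeCode l b , tapeCode (s ∷ r) c , [] , e ⟫ q
      (getSym-cell {r = rC} ⟪ a , tapeCode l b , [] , d , e ⟫ s p)

    -- One round more than the `t` steps allowed, because the last round is the one that finds no
    -- transition.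
    run-exec : ∀ t C {C′} → run {M = M} t C ≡ just C′ →
               Exec (loop rD λ _ → body) (running C) (lin body-cost (suc t)) (halted C′)
    run-exec t (cfg q l s r) p with δ q s in eq
    run-exec t (cfg q l s r) refl | nothing =
      relax (s≤s (+-monoʳ-≤ body-cost (lin-mono {body-cost} {n = t} ≤-refl z≤n)))
        (iterE refl (body-exec q l s r (exec-cmd (cong (react s) (sym eq)) (halt-exec l s r))) (exitE refl))
    run-exec (suc t) (cfg q l s r) p | just (q′ , s′ , μ) =
      iterE refl (body-exec q l s r (exec-cmd (cong (react s) (sym eq)) (react-exec l s r q′ s′ μ)))
        (run-exec t (moveHead {M = M} q′ μ l s′ r) p)

  size : Config M → ℕ
  size (cfg q l s r) = length l + length r

  size-move : ∀ q μ l s r → size (moveHead {M = M} q μ l s r) ≤ suc (length l + length r)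
  size-move q L []      s r       = ≤-refl
  size-move q L (x ∷ l) s r       = ≤-trans (≤-reflexive (+-suc (length l) (length r))) (s≤s (n≤1+n _))
  size-move q R l       s []      = ≤-refl
  size-move q R l       s (x ∷ r) = s≤s (+-monoʳ-≤ (length l) (n≤1+n (length r)))
  size-move q S l       s r       = n≤1+n _

  -- A step lists at most one new cell. This bounds the cost of reading and clearing the tape
  -- afterwards.
  size-run : ∀ t C {C′} → run {M = M} t C ≡ just C′ → size C′ ≤ t + size C
  size-run t (cfg q l s r) p with δ q s
  size-run t (cfg q l s r) refl | nothing = m≤n+m _ t
  size-run (suc t) (cfg q l s r) p | just (q′ , s′ , μ) =
    ≤-trans (size-run t (moveHead {M = M} q′ μ l s′ r) p)
      (≤-trans (+-monoʳ-≤ t (size-move q′ μ l s′ r)) (≤-reflexive (+-suc t _)))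

  loadBits : Cmd
  loadBits = loop rB λ t → pushSym rC (bitSym {M = M} t)

  loadBits-exec : ∀ v {w a b c d e} → Exec loadBits ⟪ a , v ▹ b , tapeCode (map (bitSym {M = M}) w) c , d , e ⟫ (lin m (length v))
                                           ⟪ a , b , tapeCode (map (bitSym {M = M}) (v ʳ++ w)) c , d , e ⟫
  loadBits-exec []      = exitE refl
  loadBits-exec (t ∷ v) {w} {a} {b} {c} {d} {e} =
    iterE refl (pushSym-exec {m} {rC} ⟪ a , v ▹ b , tapeCode (map (bitSym {M = M}) w) c , d , e ⟫ (bitSym {M = M} t))
      (loadBits-exec v {t ∷ w})

  load : Cmd
  load = push rB # ⨾ move rA rB ⨾ push rC # ⨾ loadBits ⨾ getSym rC (pushSym rC) ⨾ push rB # ⨾ continue zero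

  load-cost : ℕ → ℕ
  load-cost k = 1 + (lin 1 k + (1 + (lin m k + (m + m + (1 + (n + 1))))))

  load-exec : ∀ v {a b c d e} → Exec load ⟪ v ▹ a , b , c , d , e ⟫ (load-cost (length v))
                                     (running a b c d e (initial {M = M} v))
  load-exec v {a} {b} {c} {d} {e} = seqE pushE (seqE (moveAB v {[]}) (seqE pushE
    (seqE (recast (cong (lin m) (length-reverse v))
            (cong (λ w → ⟪ a , b , tapeCode (map (bitSym {M = M}) w) c , d , e ⟫) (reverse-involutive v))
            (loadBits-exec (reverse v) {[]}))
      (seqE (settle v) (seqE pushE (start v))))))
    where
    tape : Config M → Stack
    tape (cfg q l s r) = tapeCode (s ∷ r) c
    -- On the empty word the head stands on a blank that must be present on C. Reading a symbol and
    -- pushing it again creates that blank, and changes nothing if the word is not empty.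
    settle : ∀ v → Exec (getSym rC (pushSym rC)) ⟪ a , b , tapeCode (map (bitSym {M = M}) v) c , d , e ⟫ (m + m)
                        ⟪ a , b , tape (initial {M = M} v) , d , e ⟫
    settle [] = getSym-end {r = rC} ⟪ a , b , [] , d , e ⟫ (pushSym-exec {m} {rC} ⟪ a , b , [] , d , e ⟫ zero)
    settle (t ∷ v) = getSym-cell {r = rC} ⟪ a , b , [] , d , e ⟫ (bitSym {M = M} t)
      (pushSym-exec {m} {rC} ⟪ a , b , [] , d , e ⟫ (bitSym {M = M} t))
    start : ∀ v → Exec (continue zero) ⟪ a , # ∷ b , tape (initial {M = M} v) , d , e ⟫ (n + 1) (running a b c d e (initial {M = M} v))
    start []      = continue-exec a b c d e zero
    start (t ∷ v) = continue-exec a b c d e zero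

  writeBit : Maybe Bool → Cmd
  writeBit (just t) = push rE (bit t) ⨾ push rD (bit true)
  writeBit nothing  = push rD #

  readOut : Cmd
  readOut = loop rD λ _ → getSym rC λ s → writeBit (symBit {M = M} s)

  -- Reading ends at the first symbol that is not a bit; `ys` is the rest of the tape, still to be
  -- discarded. The bits arrive on E in reverse order, which the final move to A undoes.
  readOut-exec : ∀ xs w {a b c d e} → ∃ λ ys → length ys ≤ length xs ×
    Exec readOut ⟪ a , b , tapeCode xs c , bit true ∷ d , w ▹ e ⟫ (lin (m + 2) (suc (length xs)))
         ⟪ a , b , tapeCode ys c , d , (readBits {M = M} xs ʳ++ w) ▹ e ⟫
  readOut-exec [] w {a} {b} {c} {d} {e} = [] , z≤n ,
    iterE refl (getSym-end {r = rC} ⟪ a , b , [] , d , w ▹ e ⟫ (relax (s≤s z≤n) pushE)) (exitE refl)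
  readOut-exec (x ∷ xs) w {a} {b} {c} {d} {e} with symBit {M = M} x in eq
  ... | nothing = xs , n≤1+n _ ,
    relax (s≤s (+-monoʳ-≤ (m + 2) (lin-mono {m + 2} {n = suc (length xs)} ≤-refl z≤n)))
      (iterE refl (getSym-cell {r = rC} ⟪ a , b , [] , d , w ▹ e ⟫ x
        (exec-cmd (cong writeBit (sym eq)) (relax (s≤s z≤n) pushE))) (exitE refl))
  ... | just t with readOut-exec xs (t ∷ w) {a} {b} {c} {d} {e}
  ...   | ys , ys≤ , p = ys , m≤n⇒m≤1+n ys≤ ,
    iterE refl (getSym-cell {r = rC} ⟪ a , b , [] , d , w ▹ e ⟫ x
      (exec-cmd (cong writeBit (sym eq)) (seqE pushE pushE))) p

  discard-symB : ∀ {k} (i : Fin k) {a b c d e l τ} → Exec (discard rB) ⟪ a , b , c , d , e ⟫ l τ →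
                 Exec (discard rB) ⟪ a , symCode i b , c , d , e ⟫ (2 * k + l) τ
  discard-symB {suc k} zero p = relax (+-monoˡ-≤ _ (s≤s (≤-trans (s≤s z≤n) (m≤n+m (suc (k + 0)) k)))) (iterE refl skipE p)
  discard-symB {suc k} (suc i) {l = l} p =
    recast (cong (λ x → suc x + l) (sym (+-suc k (k + 0)))) refl (iterE refl skipE (discard-symB i p))

  discard-symC : ∀ {k} (i : Fin k) {a b c d e l τ} → Exec (discard rC) ⟪ a , b , c , d , e ⟫ l τ →
                 Exec (discard rC) ⟪ a , b , symCode i c , d , e ⟫ (2 * k + l) τ
  discard-symC {suc k} zero p = relax (+-monoˡ-≤ _ (s≤s (≤-trans (s≤s z≤n) (m≤n+m (suc (k + 0)) k)))) (iterE refl skipE p)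
  discard-symC {suc k} (suc i) {l = l} p =
    recast (cong (λ x → suc x + l) (sym (+-suc k (k + 0)))) refl (iterE refl skipE (discard-symC i p))

  discard-tapeB : ∀ xs {a b c d e} →
    Exec (discard rB) ⟪ a , tapeCode xs b , c , d , e ⟫ (lin (2 * m) (length xs)) ⟪ a , b , c , d , e ⟫
  discard-tapeB []       = exitE refl
  discard-tapeB (x ∷ xs) = relax (n≤1+n _) (discard-symB x (discard-tapeB xs))

  discard-tapeC : ∀ xs {a b c d e} →
    Exec (discard rC) ⟪ a , b , tapeCode xs c , d , e ⟫ (lin (2 * m) (length xs)) ⟪ a , b , c , d , e ⟫
  discard-tapeC []       = exitE refl
  discard-tapeC (x ∷ xs) = relax (n≤1+n _) (discard-symC x (discard-tapeC xs))

  unload : Cmd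
  unload = push rE # ⨾ push rD (bit true) ⨾ readOut ⨾ discard rB ⨾ discard rC ⨾ push rA # ⨾ move rE rA

  length-readBits : ∀ xs → length (readBits {M = M} xs) ≤ length xs
  length-readBits []       = z≤n
  length-readBits (x ∷ xs) with symBit {M = M} x
  ... | just _  = s≤s (length-readBits xs)
  ... | nothing = z≤n

  unload-cost : ℕ → ℕ
  unload-cost k = 1 + (1 + (lin (m + 2) (suc k) + (lin (2 * m) k + (lin (2 * m) k + (1 + lin 1 k)))))

  unload-exec : ∀ C {k a b c d e} → suc (size C) ≤ k →
    Exec unload (halted a b c d e C) (unload-cost k) ⟪ output {M = M} C ▹ a , b , c , d , e ⟫
  unload-exec (cfg q l s r) {k} {a} {b} {c} {d} {e} C≤k with readOut-exec (s ∷ r) [] {a} {tapeCode l b} {c} {d} {e}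
  ... | ys , ys≤ , p = seqE pushE (seqE pushE (seqE
      (relax (lin-mono {m + 2} {n = suc k} ≤-refl (s≤s r≤k)) p)
      (seqE (relax (lin-mono {2 * m} ≤-refl (≤-trans (m≤n⇒m≤1+n (m≤m+n _ _)) C≤k)) (discard-tapeB l))
        (seqE (relax (lin-mono {2 * m} ≤-refl (≤-trans ys≤ r≤k)) (discard-tapeC ys))
          (seqE pushE (relax (lin-mono {1} ≤-refl (≤-trans (≤-reflexive (length-reverse out)) (≤-trans (length-readBits (s ∷ r)) r≤k)))
            (recast refl (cong (λ w → ⟪ w ▹ a , b , c , d , e ⟫) (reverse-involutive out)) (moveEA (reverse out) {[]}))))))))
    where
    out = readBits {M = M} (s ∷ r)
    r≤k : length (s ∷ r) ≤ k
    r≤k = ≤-trans (s≤s (m≤n+m _ (length l))) C≤k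

runTM-run : ∀ (M : TM) t x {y} → runTM M t x ≡ just y →
            ∃ λ C → run {M = M} t (initial {M = M} x) ≡ just C × output {M = M} C ≡ y
runTM-run M t x p with run {M = M} t (initial {M = M} x)
runTM-run M t x refl | just C = C , refl , refl

size-initial : ∀ (M : TM) x → Simulation.size M (initial {M = M} x) ≤ length x
size-initial M []      = z≤n
size-initial M (t ∷ x) = m≤n⇒m≤1+n (≤-reflexive (length-map (bitSym {M = M}) x))

-- The machines given by the hypotheses become subroutines in this way, and `computable` leads back
-- to machines.
⇒-runTM : ∀ {X : Set} {f g : X → List Bool} → Computable f g → f ⇒ g
⇒-runTM {f = f} {g} (M , q , runs) = record
  { prog  = load ⨾ (loop rD λ _ → body) ⨾ unload
  ; cost  = total-cost
  ; exec  = go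
  ; bound = bound-+ (bound-+ (bound-const 1) (bound-+ (bound-lin (bound-const 1) bound-self) (bound-+ (bound-const 1)
              (bound-+ (bound-lin (bound-const m) bound-self) (bound-const _)))))
            (bound-+ (bound-lin (bound-const body-cost) (bound-+ (bound-const 1) time))
              (bound-+ (bound-const 1) (bound-+ (bound-const 1)
                (bound-+ (bound-lin (bound-const (m + 2)) (bound-+ (bound-const 1) space))
                (bound-+ (bound-lin (bound-const (2 * m)) space) (bound-+ (bound-lin (bound-const (2 * m)) space)
                  (bound-+ (bound-const 1) (bound-lin (bound-const 1) space))))))))
  }
  where
  open Simulation M
  t s total-cost : _ → ℕ
  t v = eval q (length (f v))
  -- A bound for the number of listed cells after `t v` steps, including the one under the head.
  s v = suc (t v + length (f v))
  total-cost v = load-cost (length (f v)) + (lin body-cost (suc (t v)) + unload-cost (s v))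
  time : PolyBounded (length ∘ f) t
  time = q , λ v → ≤-refl
  space : PolyBounded (length ∘ f) s
  space = bound-+ (bound-const 1) (bound-+ time bound-self)
  go : ∀ v {a b c d e} →
    Exec (load ⨾ (loop rD λ _ → body) ⨾ unload) ⟪ f v ▹ a , b , c , d , e ⟫ (total-cost v) ⟪ g v ▹ a , b , c , d , e ⟫
  go v {a} {b} {c} {d} {e} with runTM-run M (t v) (f v) (runs v)
  ... | C , p , out = recast refl (cong (λ w → ⟪ w ▹ a , b , c , d , e ⟫) out)
    (seqE (load-exec (f v)) (seqE (run-exec a b c d e (t v) (initial {M = M} (f v)) p)
    (unload-exec C (s≤s (≤-trans (size-run (t v) (initial {M = M} (f v)) p) (+-monoʳ-≤ (t v) (size-initial M (f v))))))))

-- Lexicographic rank and trails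

-- The binary value, most significant bit first; it carries lexicographic order over to the order of
-- the natural numbers.
rank : ∀ {n} → Vec Bool n → ℕ
rank []                  = 0
rank (false ∷ v)         = rank v
rank {suc n} (true ∷ v)  = 2 ^ n + rank v

unrank : ∀ n → ℕ → Vec Bool n
unrank zero    k = []
unrank (suc n) k with k <? 2 ^ n
... | yes _ = false ∷ unrank n k
... | no  _ = true ∷ unrank n (k ∸ 2 ^ n)

2^-suc : ∀ n → 2 ^ suc n ≡ 2 ^ n + 2 ^ n
2^-suc n = cong (2 ^ n +_) (+-identityʳ (2 ^ n))

rank< : ∀ {n} (v : Vec Bool n) → rank v < 2 ^ n
rank< []                 = s≤s z≤n
rank< {suc n} (false ∷ v) = ≤-trans (rank< v) (m≤m+n (2 ^ n) _)
rank< {suc n} (true ∷ v)  = subst (2 ^ n + rank v <_) (sym (2^-suc n)) (+-monoʳ-< (2 ^ n) (rank< v))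

rank-unrank : ∀ n {k} → k < 2 ^ n → rank (unrank n k) ≡ k
rank-unrank zero    {zero}  k<  = refl
rank-unrank zero    {suc k} (s≤s ())
rank-unrank (suc n) {k} k<′ with k <? 2 ^ n
... | yes k< = rank-unrank n k<
... | no  k≮ = trans (cong (2 ^ n +_) (rank-unrank n (+-cancelˡ-< (2 ^ n) _ _
  (subst₂ _<_ (sym (m+[n∸m]≡n (≮⇒≥ k≮))) (2^-suc n) k<′)))) (m+[n∸m]≡n (≮⇒≥ k≮))

≤lex⇒≤ : ∀ {n} {a b : Vec Bool n} → a ≤lex b → rank a ≤ rank b
≤lex⇒≤ []≤                       = z≤n
≤lex⇒≤ (0<1 {n} {a})             = ≤-trans (<⇒≤ (rank< a)) (m≤m+n (2 ^ n) _)
≤lex⇒≤ (same false p)            = ≤lex⇒≤ p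
≤lex⇒≤ {suc n} (same true p)     = +-monoʳ-≤ (2 ^ n) (≤lex⇒≤ p)

≤⇒≤lex : ∀ {n} (a b : Vec Bool n) → rank a ≤ rank b → a ≤lex b
≤⇒≤lex []          []          p = []≤
≤⇒≤lex (false ∷ a) (false ∷ b) p = same false (≤⇒≤lex a b p)
≤⇒≤lex (false ∷ a) (true ∷ b)  p = 0<1
≤⇒≤lex {suc n} (true ∷ a) (false ∷ b) p = contradiction (≤-trans (m≤m+n (2 ^ n) _) p) (<⇒≱ (rank< b))
≤⇒≤lex {suc n} (true ∷ a) (true ∷ b)  p = same true (≤⇒≤lex a b (+-cancelˡ-≤ (2 ^ n) _ _ p))

rank-injective : ∀ {n} (a b : Vec Bool n) → rank a ≡ rank b → a ≡ b
rank-injective []          []          p = refl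
rank-injective (false ∷ a) (false ∷ b) p = cong (false ∷_) (rank-injective a b p)
rank-injective {suc n} (false ∷ a) (true ∷ b)  p =
  contradiction (rank< a) (≤⇒≯ (≤-trans (m≤m+n (2 ^ n) _) (≤-reflexive (sym p))))
rank-injective {suc n} (true ∷ a) (false ∷ b) p =
  contradiction (rank< b) (≤⇒≯ (≤-trans (m≤m+n (2 ^ n) _) (≤-reflexive p)))
rank-injective {suc n} (true ∷ a) (true ∷ b)  p = cong (true ∷_) (rank-injective a b (+-cancelˡ-≡ (2 ^ n) _ _ p))

rank-zeros : ∀ n → rank (replicate n false) ≡ 0
rank-zeros zero    = refl
rank-zeros (suc n) = rank-zeros n

rank-ones : ∀ n → suc (rank (replicate n true)) ≡ 2 ^ n
rank-ones zero    = refl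
rank-ones (suc n) = trans (sym (+-suc (2 ^ n) _)) (trans (cong (2 ^ n +_) (rank-ones n)) (sym (2^-suc n)))

<lex⇒< : ∀ {n} {a b : Vec Bool n} → a <lex b → rank a < rank b
<lex⇒< {a = a} {b} (p , ne) = ≤∧≢⇒< (≤lex⇒≤ p) (ne ∘ rank-injective a b)

<⇒<lex : ∀ {n} (a b : Vec Bool n) → rank a < rank b → a <lex b
<⇒<lex a b p = ≤⇒≤lex a b (<⇒≤ p) , λ { refl → <-irrefl refl p }

-- If the ranks differed by more than one, the string of rank `suc (rank a)` would lie strictly
-- between.
≺lex⇒suc : ∀ {n} (a b : Vec Bool n) → a ≺lex b → suc (rank a) ≡ rank b
≺lex⇒suc {n} a b (a<b , none) with m≤n⇒m<n∨m≡n (<lex⇒< a<b)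
... | inj₂ e = e
... | inj₁ l = ⊥-elim (none c (<⇒<lex a c (subst (rank a <_) (sym rank-c) ≤-refl))
                             (<⇒<lex c b (subst (_< rank b) (sym rank-c) l)))
  where
  c = unrank n (suc (rank a))
  rank-c : rank c ≡ suc (rank a)
  rank-c = rank-unrank n (<-trans l (rank< b))

suc⇒≺lex : ∀ {n} (a b : Vec Bool n) → suc (rank a) ≡ rank b → a ≺lex b
suc⇒≺lex a b e = <⇒<lex a b (≤-reflexive e) , λ c a<c c<b →
  <-irrefl refl (≤-<-trans (<lex⇒< a<c) (≤-trans (<lex⇒< c<b) (≤-reflexive (sym e))))

-- Positions, walks and trails

data At {A : Set} : List A → ℕ → A → Set where
  here  : ∀ {x xs} → At (x ∷ xs) 0 x
  there : ∀ {x xs i y} → At xs i y → At (x ∷ xs) (suc i) y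

module _ {A : Set} where

  at-functional : ∀ {xs : List A} {i y z} → At xs i y → At xs i z → y ≡ z
  at-functional here      here      = refl
  at-functional (there p) (there q) = at-functional p q

  at-length : ∀ {xs : List A} {i y} → At xs i y → i < length xs
  at-length here      = s≤s z≤n
  at-length (there p) = s≤s (at-length p)

  at-total : ∀ (xs : List A) {i} → i < length xs → ∃ (At xs i)
  at-total (x ∷ xs) {zero}  l       = x , here
  at-total (x ∷ xs) {suc i} (s≤s l) = proj₁ (at-total xs l) , there (proj₂ (at-total xs l))

  ∈⇒at : ∀ {xs : List A} {y} → y ∈ xs → ∃ λ i → At xs i y
  ∈⇒at (here refl) = 0 , here
  ∈⇒at (there p)   = suc (proj₁ (∈⇒at p)) , there (proj₂ (∈⇒at p))

  at-all : ∀ {P : A → Set} {xs i y} → All P xs → At xs i y → P y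
  at-all (p ∷ ps) here      = p
  at-all (p ∷ ps) (there q) = at-all ps q

  at-middle : ∀ {P : A → Set} as {bs cs i y} → All P bs → At (as ++ bs ++ cs) i y →
              length as ≤ i → i < length as + length bs → P y
  at-middle []       (p ∷ ps) here      _       _       = p
  at-middle []       (p ∷ ps) (there q) _       (s≤s l) = at-middle [] ps q z≤n l
  at-middle (a ∷ as) ps       (there q) (s≤s l) (s≤s r) = at-middle as ps q l r

  at-outside : ∀ {P : A → Set} {as} bs {cs i y} → All P as → All P cs → At (as ++ bs ++ cs) i y →
               ¬ P y → length as ≤ i × i < length as + length bs
  at-outside []       []       qs p         ¬P = contradiction (at-all qs p) ¬P
  at-outside (b ∷ bs) []       qs here      ¬P = z≤n , s≤s z≤n
  at-outside (b ∷ bs) []       qs (there p) ¬P = z≤n , s≤s (proj₂ (at-outside bs [] qs p ¬P))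
  at-outside bs       (p ∷ ps) qs here      ¬P = contradiction p ¬P
  at-outside bs       (_ ∷ ps) qs (there p) ¬P with at-outside bs ps qs p ¬P
  ... | l , r = s≤s l , s≤s r

  data Walk (R : A → A → Set) : A → A → List A → Set where
    stop : ∀ {a} → Walk R a a (a ∷ [])
    link : ∀ {a b c xs} → R a b → Walk R b c xs → Walk R a c (a ∷ xs)

  module _ {R : A → A → Set} where

    walk-join : ∀ {a b c d xs ys} → Walk R a b xs → R b c → Walk R c d ys → Walk R a d (xs ++ ys)
    walk-join stop       r w = link r w
    walk-join (link q v) r w = link q (walk-join v r w)

    walk-start : ∀ {a b xs} → Walk R a b xs → At xs 0 a
    walk-start stop       = here
    walk-start (link _ _) = here

    walk-last : ∀ {a b xs} → Walk R a b xs → ∃ λ k → suc k ≡ length xs × At xs k b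
    walk-last stop = 0 , refl , here
    walk-last (link _ w) with walk-last w
    ... | k , e , p = suc k , cong suc e , there p

    walk-all : ∀ {P : A → Set} {a b xs} → Walk R a b xs → All P xs → P b
    walk-all stop       (p ∷ _)  = p
    walk-all (link _ w) (_ ∷ ps) = walk-all w ps

    walk-edge : ∀ {a b xs i y z} → Walk R a b xs → At xs i y → At xs (suc i) z → R y z
    walk-edge (link r w) here      (there q) with at-functional (walk-start w) q
    ... | refl = r
    walk-edge (link r w) (there p) (there q) = walk-edge w p q
    walk-edge stop here (there ())
    walk-edge stop (there ()) _

  walk-map : ∀ {R S : A → A → Set} {a b xs} → (∀ {y z} → R y z → S y z) → Walk R a b xs → Walk S a b xs
  walk-map f stop       = stop
  walk-map f (link r w) = link (f r) (walk-map f w)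

-- Tracing two occurrences of a vertex back in parallel would give the start a predecessor, so a trail
-- visits every vertex at most once.
module Trail {A : Set} {R : A → A → Set} {s t : A} {xs : List A}
             (uniqueʳ : ∀ {a b c} → R a b → R a c → b ≡ c)
             (uniqueˡ : ∀ {a b c} → R a c → R b c → a ≡ b)
             (sink : ∀ {a} → ¬ R t a) (source : ∀ {a} → ¬ R a s)
             (walk : Walk R s t xs) where

  at-injective : ∀ {i j y} → At xs i y → At xs j y → i ≡ j
  at-injective {zero}  {zero}  p q = refl
  at-injective {zero}  {suc j} p q with at-functional p (walk-start walk)
  ... | refl = contradiction (walk-edge walk (proj₂ (at-total xs (<-trans ≤-refl (at-length q)))) q) source
  at-injective {suc i} {zero}  p q with at-functional q (walk-start walk)
  ... | refl = contradiction (walk-edge walk (proj₂ (at-total xs (<-trans ≤-refl (at-length p)))) p) source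
  at-injective {suc i} {suc j} p q with at-total xs {i} (<-trans ≤-refl (at-length p)) | at-total xs {j} (<-trans ≤-refl (at-length q))
  ... | y , p′ | z , q′ with uniqueˡ (walk-edge walk p′ p) (walk-edge walk q′ q)
  ... | refl = cong suc (at-injective p′ q′)

  -- Before the last position, the next vertex of the walk is the only possible `z`, and it occurs
  -- just once; the last vertex has no outgoing edge. Thus the locally defined relation `R` is
  -- exactly adjacency on the path.
  edge-suc : ∀ {i j y z} → At xs i y → At xs j z → R y z → suc i ≡ j
  edge-suc {i} p q r with suc i <? length xs
  ... | yes l with at-total xs l
  ...   | z′ , q′ with uniqueʳ r (walk-edge walk p q′)
  ...     | refl = at-injective q′ q
  edge-suc {i} p q r | no ≮ with walk-last walk
  ... | k , e , pₖ with ≤-antisym (at-length p) (≮⇒≥ ≮)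
  ...   | e′ with suc-injective (trans e′ (sym e))
  ...     | refl with at-functional p pₖ
  ...       | refl = contradiction r sink

record Block {A : Set} (V : A → Bool) (xs : List A) : Set where
  constructor block
  field
    {as bs cs} : List A
    split      : xs ≡ as ++ bs ++ cs
    outside₁   : All (λ y → V y ≡ false) as
    inside     : All (λ y → V y ≡ true) bs
    outside₂   : All (λ y → V y ≡ false) cs

module FromTrail {n : ℕ} {R : Vec Bool n → Vec Bool n → Set} {s t : Vec Bool n} {xs : List (Vec Bool n)}
             (uniqueʳ : ∀ {a b c} → R a b → R a c → b ≡ c)
             (uniqueˡ : ∀ {a b c} → R a c → R b c → a ≡ b)
             (sink : ∀ {a} → ¬ R t a) (source : ∀ {a} → ¬ R a s)
             (walk : Walk R s t xs)
             (complete : ∀ y → y ∈ xs) (card : length xs ≡ 2 ^ n) where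

  open Trail uniqueʳ uniqueˡ sink source walk

  pos : Vec Bool n → ℕ
  pos y = proj₁ (∈⇒at (complete y))

  at-pos : ∀ y → At xs (pos y) y
  at-pos y = proj₂ (∈⇒at (complete y))

  place : Vec Bool n → Vec Bool n
  place y = unrank n (pos y)

  rank-place : ∀ y → rank (place y) ≡ pos y
  rank-place y = rank-unrank n (subst (pos y <_) card (at-length (at-pos y)))

  place-at : ∀ {i y} → At xs i y → rank (place y) ≡ i
  place-at {y = y} p = trans (rank-place y) (at-injective (at-pos y) p)

  order : Perm n
  order = mk⤖ (injective , surjective)
    where
    injective : ∀ {y z} → place y ≡ place z → y ≡ z
    injective {y} {z} e = at-functional (at-pos y)
      (subst (λ i → At xs i z) (trans (sym (rank-place z)) (trans (cong rank (sym e)) (rank-place y))) (at-pos z))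
    surjective : ∀ v → ∃ λ y → ∀ {z} → z ≡ y → place z ≡ v
    surjective v with at-total xs (subst (rank v <_) (sym card) (rank< v))
    ... | y , p = y , λ { refl → rank-injective _ _ (place-at p) }

  order-start : app order s ≡ replicate n false
  order-start = rank-injective _ _ (trans (place-at (walk-start walk)) (sym (rank-zeros n)))

  order-end : app order t ≡ replicate n true
  order-end with walk-last walk
  ... | k , e , p = rank-injective _ _ (trans (place-at p) (suc-injective (trans e (trans card (sym (rank-ones n))))))

  order-edge : ∀ y z → R y z ⇔' (app order y ≺lex app order z)
  order-edge y z =
    (λ r → suc⇒≺lex _ _ (trans (cong suc (rank-place y)) (trans (edge-suc (at-pos y) (at-pos z) r) (sym (rank-place z))))) ,
    (λ p → walk-edge walk (at-pos y) (subst (λ i → At xs i z)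
      (trans (sym (rank-place z)) (trans (sym (≺lex⇒suc _ _ p)) (cong suc (rank-place y)))) (at-pos z)))

  order-interval : ∀ {V} → Block V xs → (∃ λ y → V y ≡ true) →
    ∃₂ λ ℓ u → ∀ w → (V w ≡ true) ⇔' (app order ℓ ≤lex app order w × app order w ≤lex app order u)
  order-interval (block {as} {bs} {cs} refl o₁ i o₂) (y , Vy)
    with at-outside bs o₁ o₂ (at-pos y) (λ Vy′ → contradiction (trans (sym Vy) Vy′) λ ())
  ... | lo , hi with at-total xs {length as} (≤-<-trans lo (at-length (at-pos y)))
                   | length as + length bs in eq
  -- By `hi` the sum cannot be zero, so `k` is the position of the last accepting vertex.
  ...   | ℓ , pℓ | suc k with at-total xs {k} (≤-trans (≤-reflexive (sym eq)) (subst (length as + length bs ≤_)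
                             (sym (trans (length-++ as) (cong (length as +_) (length-++ bs)))) (+-monoʳ-≤ (length as) (m≤m+n _ _))))
  ...     | u , pu = ℓ , u , λ w →
    (λ Vw → let l , r = at-outside bs o₁ o₂ (at-pos w) (λ Vw′ → contradiction (trans (sym Vw) Vw′) λ ()) in
      ≤⇒≤lex _ _ (subst₂ _≤_ (sym (place-at pℓ)) (sym (rank-place w)) l) ,
      ≤⇒≤lex _ _ (subst₂ _≤_ (sym (rank-place w)) (sym (place-at pu)) (s≤s⁻¹ (≤-trans r (≤-reflexive eq))))) ,
    (λ (l , r) → at-middle as i (at-pos w)
      (subst₂ _≤_ (place-at pℓ) (rank-place w) (≤lex⇒≤ l))
      (≤-trans (s≤s (subst₂ _≤_ (rank-place w) (place-at pu) (≤lex⇒≤ r))) (≤-reflexive (sym eq))))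

-- The layered path

pattern ℓ₀ y = false ∷ false ∷ y
pattern ℓ₁ y = false ∷ true ∷ y
pattern ℓ₂ y = true ∷ false ∷ y
pattern ℓ₃ y = true ∷ true ∷ y

true≢false : ∀ {b} → b ≡ true → b ≡ false → ⊥
true≢false refl ()

module Layers {m : ℕ} (_⟶_ : Vec Bool m → Vec Bool m → Set)
              (uniqueʳ : ∀ {a b c} → a ⟶ b → a ⟶ c → b ≡ c)
              (uniqueˡ : ∀ {a b c} → a ⟶ c → b ⟶ c → a ≡ b)
              (e : Vec Bool m) (cut : Vec Bool m → Vec Bool m → Bool) where

  -- The condition z ≢ e keeps the steps into e from returning to the start 1e of the path.
  data Edge : Vec Bool (2 + m) → Vec Bool (2 + m) → Set where
    1→2 : ∀ {y} → Edge (ℓ₁ y) (ℓ₂ y)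
    2→1 : ∀ {y z} → y ⟶ z → cut y z ≡ false → z ≢ e → Edge (ℓ₂ y) (ℓ₁ z)
    2→0 : ∀ {y z} → y ⟶ z → cut y z ≡ true → Edge (ℓ₂ y) (ℓ₀ z)
    2→3 : ∀ {y} → y ⟶ e → cut y e ≡ false → Edge (ℓ₂ y) (ℓ₃ y)
    0→0 : ∀ {y z} → y ⟶ z → cut y z ≡ false → Edge (ℓ₀ y) (ℓ₀ z)
    0→1 : ∀ {y z} → y ⟶ z → cut y z ≡ true → z ≢ e → Edge (ℓ₀ y) (ℓ₁ z)
    0→3 : ∀ {y} → y ⟶ e → cut y e ≡ true → Edge (ℓ₀ y) (ℓ₃ y)
    3→3 : ∀ {y z} → z ⟶ y → y ≢ e → Edge (ℓ₃ y) (ℓ₃ z)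

  -- The ring successor z of y is unique, and the value of `cut y z` together with the question
  -- whether z is `e` admits at most one rule out of layer 2, and likewise out of layer 0.
  edge-uniqueʳ : ∀ {a b c} → Edge a b → Edge a c → b ≡ c
  edge-uniqueʳ 1→2 1→2 = refl
  edge-uniqueʳ (2→1 p _ _) (2→1 q _ _) = cong ℓ₁ (uniqueʳ p q)
  edge-uniqueʳ (2→1 p c _) (2→0 q d) with uniqueʳ p q
  ... | refl = ⊥-elim (true≢false d c)
  edge-uniqueʳ (2→1 p _ ne) (2→3 q _) = contradiction (uniqueʳ p q) ne
  edge-uniqueʳ (2→0 p d) (2→1 q c _) with uniqueʳ p q
  ... | refl = ⊥-elim (true≢false d c)
  edge-uniqueʳ (2→0 p _) (2→0 q _) = cong ℓ₀ (uniqueʳ p q)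
  edge-uniqueʳ (2→0 p d) (2→3 q c) with uniqueʳ p q
  ... | refl = ⊥-elim (true≢false d c)
  edge-uniqueʳ (2→3 p _) (2→1 q _ ne) = contradiction (uniqueʳ q p) ne
  edge-uniqueʳ (2→3 p c) (2→0 q d) with uniqueʳ p q
  ... | refl = ⊥-elim (true≢false d c)
  edge-uniqueʳ (2→3 _ _) (2→3 _ _) = refl
  edge-uniqueʳ (0→0 p _) (0→0 q _) = cong ℓ₀ (uniqueʳ p q)
  edge-uniqueʳ (0→0 p c) (0→1 q d _) with uniqueʳ p q
  ... | refl = ⊥-elim (true≢false d c)
  edge-uniqueʳ (0→0 p c) (0→3 q d) with uniqueʳ p q
  ... | refl = ⊥-elim (true≢false d c)
  edge-uniqueʳ (0→1 p d _) (0→0 q c) with uniqueʳ p q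
  ... | refl = ⊥-elim (true≢false d c)
  edge-uniqueʳ (0→1 p _ _) (0→1 q _ _) = cong ℓ₁ (uniqueʳ p q)
  edge-uniqueʳ (0→1 p _ ne) (0→3 q _) = contradiction (uniqueʳ p q) ne
  edge-uniqueʳ (0→3 p d) (0→0 q c) with uniqueʳ p q
  ... | refl = ⊥-elim (true≢false d c)
  edge-uniqueʳ (0→3 p _) (0→1 q _ ne) = contradiction (uniqueʳ q p) ne
  edge-uniqueʳ (0→3 _ _) (0→3 _ _) = refl
  edge-uniqueʳ (3→3 p _) (3→3 q _) = cong ℓ₃ (uniqueˡ p q)

  -- Into layers 0 and 1, the value of `cut` separates the rules. A vertex of layer 3 is entered
  -- from another layer only over the ring predecessor of `e`, and there `3→3` is excluded, since it
  -- would start from `3e`.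
  edge-uniqueˡ : ∀ {a b c} → Edge a c → Edge b c → a ≡ b
  edge-uniqueˡ 1→2 1→2 = refl
  edge-uniqueˡ (2→1 p _ _) (2→1 q _ _) = cong ℓ₂ (uniqueˡ p q)
  edge-uniqueˡ (2→1 p c _) (0→1 q d _) with uniqueˡ p q
  ... | refl = ⊥-elim (true≢false d c)
  edge-uniqueˡ (0→1 p d _) (2→1 q c _) with uniqueˡ p q
  ... | refl = ⊥-elim (true≢false d c)
  edge-uniqueˡ (0→1 p _ _) (0→1 q _ _) = cong ℓ₀ (uniqueˡ p q)
  edge-uniqueˡ (2→0 p _) (2→0 q _) = cong ℓ₂ (uniqueˡ p q)
  edge-uniqueˡ (2→0 p d) (0→0 q c) with uniqueˡ p q
  ... | refl = ⊥-elim (true≢false d c)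
  edge-uniqueˡ (0→0 p c) (2→0 q d) with uniqueˡ p q
  ... | refl = ⊥-elim (true≢false d c)
  edge-uniqueˡ (0→0 p _) (0→0 q _) = cong ℓ₀ (uniqueˡ p q)
  edge-uniqueˡ (2→3 _ _) (2→3 _ _) = refl
  edge-uniqueˡ (2→3 _ c) (0→3 _ d) = ⊥-elim (true≢false d c)
  edge-uniqueˡ (2→3 p _) (3→3 q ne) = contradiction (uniqueʳ q p) ne
  edge-uniqueˡ (0→3 _ d) (2→3 _ c) = ⊥-elim (true≢false d c)
  edge-uniqueˡ (0→3 _ _) (0→3 _ _) = refl
  edge-uniqueˡ (0→3 p _) (3→3 q ne) = contradiction (uniqueʳ q p) ne
  edge-uniqueˡ (3→3 p ne) (2→3 q _) = contradiction (uniqueʳ p q) ne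
  edge-uniqueˡ (3→3 p ne) (0→3 q _) = contradiction (uniqueʳ p q) ne
  edge-uniqueˡ (3→3 p _) (3→3 q _) = cong ℓ₃ (uniqueʳ p q)

  edge-sink : ∀ {a} → ¬ Edge (ℓ₃ e) a
  edge-sink (3→3 _ ne) = ne refl

  edge-source : ∀ {a} → ¬ Edge a (ℓ₁ e)
  edge-source (2→1 _ _ ne) = ne refl
  edge-source (0→1 _ _ ne) = ne refl

  _⟶ₜ_ : Vec Bool m → Vec Bool m → Set
  y ⟶ₜ z = y ⟶ z × cut y z ≡ false × z ≢ e

  blocks : List (Vec Bool m) → List (Vec Bool (2 + m))
  blocks []       = []
  blocks (y ∷ ys) = ℓ₁ y ∷ ℓ₂ y ∷ blocks ys

  walk-blocks : ∀ {a b xs} → Walk _⟶ₜ_ a b xs → Walk Edge (ℓ₁ a) (ℓ₂ b) (blocks xs)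
  walk-blocks stop                   = link 1→2 stop
  walk-blocks (link (r , c , ne) w) = link 1→2 (link (2→1 r c ne) (walk-blocks w))

  layer₀ layer₃ : Vec Bool m → Vec Bool (2 + m)
  layer₀ y = ℓ₀ y
  layer₃ y = ℓ₃ y

  walk-ℓ₀ : ∀ {a b xs} → Walk _⟶ₜ_ a b xs → Walk Edge (ℓ₀ a) (ℓ₀ b) (map layer₀ xs)
  walk-ℓ₀ stop                  = stop
  walk-ℓ₀ (link (r , c , _) w) = link (0→0 r c) (walk-ℓ₀ w)

  walk-ℓ₃ : ∀ {a b xs} → Walk (λ y z → y ⟶ z × z ≢ e) a b xs → Walk Edge (ℓ₃ b) (ℓ₃ a) (map layer₃ (reverse xs))
  walk-ℓ₃ stop = stop
  walk-ℓ₃ (link {a} {xs = xs} (r , ne) w) =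
    subst (Walk Edge _ _) (sym (trans (cong (map layer₃) (unfold-reverse a xs)) (map-++ layer₃ (reverse xs) _)))
      (walk-join (walk-ℓ₃ w) (3→3 r ne) stop)

  path : List (Vec Bool m) → List (Vec Bool m) → List (Vec Bool (2 + m))
  path us vs = blocks us ++ map layer₀ (vs ++ us) ++ blocks vs ++ map layer₃ (reverse (us ++ vs))

  forget : ∀ {y z} → y ⟶ₜ z → y ⟶ z × z ≢ e
  forget (r , _ , ne) = r , ne

  -- `us` leads from `e` to the cut and `vs` from the cut back to `e`. If the cut is the edge into
  -- `e`, then `vs` is empty and no `Walk` describes it, hence a separate case.
  data Opened (us : List (Vec Bool m)) : List (Vec Bool m) → Set where
    closing    : ∀ {u} → Walk _⟶ₜ_ e u us → u ⟶ e → cut u e ≡ true → Opened us []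
    midway : ∀ {u v w vs} → Walk _⟶ₜ_ e u us → u ⟶ v → cut u v ≡ true → v ≢ e →
                Walk _⟶ₜ_ v w vs → w ⟶ e → cut w e ≡ false → Opened us vs

  walk-path : ∀ {us vs} → Opened us vs → Walk Edge (ℓ₁ e) (ℓ₃ e) (path us vs)
  walk-path {us} (closing wᵤ r c) =
    walk-join (walk-blocks wᵤ) (2→0 r c)
      (walk-join (walk-ℓ₀ wᵤ) (0→3 r c)
        (subst (λ xs → Walk Edge _ _ (map layer₃ (reverse xs))) (sym (++-identityʳ us)) (walk-ℓ₃ (walk-map forget wᵤ))))
  walk-path {us} {vs} (midway wᵤ r c ne wᵥ r′ c′) =
    walk-join (walk-blocks wᵤ) (2→0 r c)
      (walk-join (subst (Walk Edge _ _) (sym (map-++ layer₀ vs us)) (walk-join (walk-ℓ₀ wᵥ) (0→0 r′ c′) (walk-ℓ₀ wᵤ))) (0→1 r c ne)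
        (walk-join (walk-blocks wᵥ) (2→3 r′ c′)
          (walk-ℓ₃ (walk-join (walk-map forget wᵤ) (r , ne) (walk-map forget wᵥ)))))

  length-blocks : ∀ xs → length (blocks xs) ≡ 2 * length xs
  length-blocks []       = refl
  length-blocks (x ∷ xs) = trans (cong (2 +_) (length-blocks xs)) (sym (*-suc 2 (length xs)))

  length-path : ∀ us vs → length (path us vs) ≡ 4 * length (us ++ vs)
  length-path us vs
    rewrite length-++ (blocks us) {map layer₀ (vs ++ us) ++ blocks vs ++ map layer₃ (reverse (us ++ vs))}
          | length-++ (map layer₀ (vs ++ us)) {blocks vs ++ map layer₃ (reverse (us ++ vs))}
          | length-++ (blocks vs) {map layer₃ (reverse (us ++ vs))}
          | length-map layer₀ (vs ++ us) | length-map layer₃ (reverse (us ++ vs)) | length-reverse (us ++ vs)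
          | length-blocks us | length-blocks vs | length-++ vs {us} | length-++ us {vs}
    = lemma (length us) (length vs)
    where
    lemma : ∀ a b → 2 * a + (b + a + (2 * b + (a + b))) ≡ 4 * (a + b)
    lemma = solve-∀

  ∈-blocks₁ : ∀ {y xs} → y ∈ xs → ℓ₁ y ∈ blocks xs
  ∈-blocks₁ (here refl) = here refl
  ∈-blocks₁ (there p)   = there (there (∈-blocks₁ p))

  ∈-blocks₂ : ∀ {y xs} → y ∈ xs → ℓ₂ y ∈ blocks xs
  ∈-blocks₂ (here refl) = there (here refl)
  ∈-blocks₂ (there p)   = there (there (∈-blocks₂ p))

  path-complete : ∀ us vs → (∀ y → y ∈ us ++ vs) → ∀ y → y ∈ path us vs
  path-complete us vs all (ℓ₀ y) with ∈-++⁻ us (all y)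
  ... | inj₁ p = ∈-++⁺ʳ (blocks us) (∈-++⁺ˡ (∈-map⁺ layer₀ (∈-++⁺ʳ vs p)))
  ... | inj₂ p = ∈-++⁺ʳ (blocks us) (∈-++⁺ˡ (∈-map⁺ layer₀ (∈-++⁺ˡ p)))
  path-complete us vs all (ℓ₁ y) with ∈-++⁻ us (all y)
  ... | inj₁ p = ∈-++⁺ˡ (∈-blocks₁ p)
  ... | inj₂ p = ∈-++⁺ʳ (blocks us) (∈-++⁺ʳ (map layer₀ (vs ++ us)) (∈-++⁺ˡ (∈-blocks₁ p)))
  path-complete us vs all (ℓ₂ y) with ∈-++⁻ us (all y)
  ... | inj₁ p = ∈-++⁺ˡ (∈-blocks₂ p)
  ... | inj₂ p = ∈-++⁺ʳ (blocks us) (∈-++⁺ʳ (map layer₀ (vs ++ us)) (∈-++⁺ˡ (∈-blocks₂ p)))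
  path-complete us vs all (ℓ₃ y) =
    ∈-++⁺ʳ (blocks us) (∈-++⁺ʳ (map layer₀ (vs ++ us)) (∈-++⁺ʳ (blocks vs) (∈-map⁺ layer₃ (reverse⁺ (all y)))))

  lift : (Vec Bool m → Bool) → Vec Bool (2 + m) → Bool
  lift V (ℓ₀ y)      = V y
  lift V (_ ∷ _ ∷ y) = false

  -- Only layer 0 can accept, and the path runs through it in the order `vs ++ us`, which is the
  -- ring opened at the cut.
  path-block : ∀ {V} us vs → Block V (vs ++ us) → Block (lift V) (path us vs)
  path-block {V} us vs (block {as} {bs} {cs} split o₁ i o₂) = block split′
      (All.++⁺ (none us) (All.map⁺ o₁)) (All.map⁺ i)
      (All.++⁺ (All.map⁺ o₂) (All.++⁺ (none vs) (All.map⁺ (All.universal (λ _ → refl) _))))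
    where
    none : ∀ xs → All (λ y → lift V y ≡ false) (blocks xs)
    none []       = []
    none (x ∷ xs) = refl ∷ refl ∷ none xs
    rest = blocks vs ++ map layer₃ (reverse (us ++ vs))
    split′ : path us vs ≡ (blocks us ++ map layer₀ as) ++ map layer₀ bs ++ (map layer₀ cs ++ rest)
    split′ rewrite split | map-++ layer₀ as (bs ++ cs) | map-++ layer₀ bs cs
      | ++-assoc (blocks us) (map layer₀ as) (map layer₀ bs ++ (map layer₀ cs ++ rest))
      | ++-assoc (map layer₀ as) (map layer₀ bs ++ map layer₀ cs) rest
      | ++-assoc (map layer₀ bs) (map layer₀ cs) rest = refl

-- Unlike in `Walk`, the final vertex is not listed and the list may be empty. So the closed ring is
-- a segment from `e` to `e` that lists every vertex once, and segments concatenate without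
-- repeating a vertex.
data Seg {A : Set} (R : A → A → Set) : A → A → List A → Set where
  nil  : ∀ {a} → Seg R a a []
  cons : ∀ {a b c xs} → R a b → Seg R b c xs → Seg R a c (a ∷ xs)

module _ {A : Set} where

  module _ {R : A → A → Set} where

    seg-++ : ∀ {a b c xs ys} → Seg R a b xs → Seg R b c ys → Seg R a c (xs ++ ys)
    seg-++ nil        s = s
    seg-++ (cons r t) s = cons r (seg-++ t s)

    seg-split : ∀ {a c} xs {ys} → Seg R a c (xs ++ ys) → ∃ λ b → Seg R a b xs × Seg R b c ys
    seg-split []       s = _ , nil , s
    seg-split (x ∷ xs) (cons r s) with seg-split xs s
    ... | b , t , u = b , cons r t , u

    seg-upTo : ∀ f n → (∀ {i} → i < n → R (f i) (f (suc i))) → Seg R (f 0) (f n) (applyUpTo f n)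
    seg-upTo f zero    r = nil
    seg-upTo f (suc n) r = cons (r (s≤s z≤n)) (seg-upTo (f ∘ suc) n (r ∘ s≤s))

  -- The last edge is returned separately because `Q` may fail on it: it is the cut or the edge into
  -- `e`.
  seg⇒walk : ∀ {R Q : A → A → Set} {a c x xs} → Seg R a c (x ∷ xs) → Linked Q (x ∷ xs) →
             ∃ λ b → Walk (λ y z → R y z × Q y z) a b (x ∷ xs) × R b c
  seg⇒walk (cons r nil) [-] = _ , stop , r
  seg⇒walk (cons r s@(cons _ _)) (q ∷ qs) with seg⇒walk s qs
  ... | b , w , r′ = b , link (r , q) w , r′

  module _ {V : A → Bool} where

    private
      Rej Acc : List A → Set
      Rej = All (λ y → V y ≡ false)
      Acc = All (λ y → V y ≡ true)

    split-rejecting : ∀ f n → (∀ {i j} → i < j → j < n → V (f i) ≡ true → V (f j) ≡ true) →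
                      ∃₂ λ as bs → applyUpTo f n ≡ as ++ bs × Rej as × Acc bs
    split-rejecting f zero    up = [] , [] , refl , [] , []
    split-rejecting f (suc n) up with V (f 0) in eq
    ... | true  = [] , _ , refl , [] , eq ∷ All.applyUpTo⁺₁ (f ∘ suc) n (λ l → up (s≤s z≤n) (s≤s l) eq)
    ... | false with split-rejecting (f ∘ suc) n (λ l l′ → up (s≤s l) (s≤s l′))
    ...   | as , bs , e , o , i = f 0 ∷ as , bs , cong (f 0 ∷_) e , eq ∷ o , i

    split-accepting : ∀ f n → (∀ {i j} → i < j → j < n → V (f j) ≡ true → V (f i) ≡ true) →
                      ∃₂ λ bs cs → applyUpTo f n ≡ bs ++ cs × Acc bs × Rej cs
    split-accepting f zero    down = [] , [] , refl , [] , []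
    split-accepting f (suc n) down with V (f 0) in eq
    ... | true with split-accepting (f ∘ suc) n (λ l l′ → down (s≤s l) (s≤s l′))
    ...   | bs , cs , e , i , o = f 0 ∷ bs , cs , cong (f 0 ∷_) e , eq ∷ i , o
    split-accepting f (suc n) down | false = [] , _ , refl , [] , eq ∷ All.applyUpTo⁺₁ (f ∘ suc) n rej
      where
      rej : ∀ {i} → i < n → V (f (suc i)) ≡ false
      rej {i} l with V (f (suc i)) in eq′
      ... | false = refl
      ... | true  = ⊥-elim (true≢false (down (s≤s z≤n) (s≤s l) eq′) eq)

    -- Behind the first accepting element, convexity with that element as lower end makes acceptance
    -- closed downwards, so the rest accepts first and rejects afterwards.
    convex-block : ∀ f n → (∀ {i j l} → i < j → j < l → l < n → V (f i) ≡ true → V (f l) ≡ true → V (f j) ≡ true) →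
                   Block V (applyUpTo f n)
    convex-block f zero    cvx = block {as = []} {[]} {[]} refl [] [] []
    convex-block f (suc n) cvx with V (f 0) in eq
    ... | false with convex-block (f ∘ suc) n (λ a b c → cvx (s≤s a) (s≤s b) (s≤s c))
    ...   | block e o i o′ = block (cong (f 0 ∷_) e) (eq ∷ o) i o′
    convex-block f (suc n) cvx | true
      with split-accepting (f ∘ suc) n (λ l l′ a → cvx (s≤s z≤n) (s≤s l) (s≤s l′) eq a)
    ... | bs , cs , e , i , o = block {as = []} (cong (f 0 ∷_) e) [] (eq ∷ i) o

    none-or-some : ∀ f n → Rej (applyUpTo f n) ⊎ ∃ λ i → i < n × V (f i) ≡ true
    none-or-some f zero = inj₁ []
    none-or-some f (suc n) with V (f 0) in eq
    ... | true  = inj₂ (0 , s≤s z≤n , eq)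
    ... | false with none-or-some (f ∘ suc) n
    ...   | inj₁ o             = inj₁ (eq ∷ o)
    ...   | inj₂ (i , l , a) = inj₂ (suc i , s≤s l , a)

    block-++ˡ : ∀ {xs ys} → Rej xs → Block V ys → Block V (xs ++ ys)
    block-++ˡ {xs} o (block {as} {bs} {cs} e o₁ i o₂) =
      block (trans (cong (xs ++_) e) (sym (++-assoc xs as _))) (All.++⁺ o o₁) i o₂

    block-++ʳ : ∀ {xs ys} → Block V xs → Rej ys → Block V (xs ++ ys)
    block-++ʳ {ys = ys} (block {as} {bs} {cs} e o₁ i o₂) o =
      block (trans (cong (_++ ys) e) (trans (++-assoc as _ ys) (cong (as ++_) (++-assoc bs cs ys)))) o₁ i (All.++⁺ o₂ o)

    -- In a list that rejects first and accepts afterwards, no step leads from an accepting to a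
    -- rejecting element.
    linked-rejecting : ∀ {Q : A → A → Set} {x xs} → (∀ {y z} → V y ≡ false ⊎ V z ≡ true → Q y z) →
                       ∀ as bs → x ∷ xs ≡ as ++ bs → Rej as → Acc bs → Linked Q (x ∷ xs)
    linked-rejecting {xs = []} _ _ _ _ _ _ = [-]
    linked-rejecting {xs = _ ∷ _} q [] (_ ∷ _ ∷ bs) refl o (_ ∷ i ∷ is) = q (inj₂ i) ∷ linked-rejecting q [] (_ ∷ bs) refl o (i ∷ is)
    linked-rejecting {xs = _ ∷ _} q (_ ∷ as) bs e (o ∷ os) is with List.∷-injective e
    ... | refl , e′ = q (inj₁ o) ∷ linked-rejecting q as bs e′ os is

  linked-all : ∀ {Q : A → A → Set} {P : A → Set} {x xs} → (∀ {y z} → P z → Q y z) → All P xs → Linked Q (x ∷ xs)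
  linked-all q []       = [-]
  linked-all q (p ∷ ps) = q p ∷ linked-all q ps

  linked-and : ∀ {P Q : A → A → Set} {xs} → Linked P xs → Linked Q xs → Linked (λ y z → P y z × Q y z) xs
  linked-and []       []       = []
  linked-and [-]      [-]      = [-]
  linked-and (p ∷ ps) (q ∷ qs) = (p , q) ∷ linked-and ps qs

-- Cutting the ring

module Ring {m : ℕ} (_⟶_ : Vec Bool m → Vec Bool m → Set)
            (uniqueʳ : ∀ {a b c} → a ⟶ b → a ⟶ c → b ≡ c)
            (uniqueˡ : ∀ {a b c} → a ⟶ c → b ⟶ c → a ≡ b)
            (V : Vec Bool m → Bool) (cut : Vec Bool m → Vec Bool m → Bool)
            (N k r : ℕ) (N≡ : suc r + k ≡ N) (g : ℕ → Vec Bool m)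
            (edge : ∀ {i} → i < N → g i ⟶ g (suc i)) (wrap : g N ≡ g 0)
            (g-injective : ∀ {i j} → i < N → j < N → g i ≡ g j → i ≡ j)
            (g-surjective : ∀ y → ∃ λ i → i < N × g i ≡ y) where

  e : Vec Bool m
  e = g k

  open Layers _⟶_ uniqueʳ uniqueˡ e cut

  -- `e` has position `k` in the enumeration `g`. Read from `e`, the ring passes the wrap-around
  -- between `after` and `before`.
  after before : List (Vec Bool m)
  after  = applyUpTo (λ i → g (suc i + k)) r
  before = applyUpTo g k

  k<N : k < N
  k<N = subst (k <_) N≡ (s≤s (m≤n+m k r))

  after< : ∀ {i} → i < r → suc i + k < N
  after< {i} l = subst (suc i + k <_) N≡ (+-monoˡ-< k (s≤s l))

  ring : Seg _⟶_ e e (e ∷ after ++ before)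
  ring = seg-++ (seg-upTo (λ i → g (i + k)) (suc r) (λ {i} l → edge (subst (i + k <_) N≡ (+-monoˡ-< k l))))
    (subst (λ a → Seg _⟶_ a e before) (trans (sym wrap) (cong g (sym N≡)))
      (seg-upTo g k (λ l → edge (<-trans l k<N))))

  away : All (_≢ e) (after ++ before)
  away = All.++⁺
    (All.applyUpTo⁺₁ _ r (λ {i} l q → m≢1+n+m k (sym (g-injective (after< l) k<N q))))
    (All.applyUpTo⁺₁ g k (λ l q → <⇒≢ l (g-injective (<-trans l k<N) k<N q)))

  ring-complete : ∀ y → y ∈ e ∷ after ++ before
  ring-complete y with g-surjective y
  ... | i , i<N , refl with i <? k
  ...   | yes i<k = there (∈-++⁺ʳ after (∈-applyUpTo⁺ g i<k))
  ...   | no  i≮k = subst (λ j → g j ∈ _) (m∸n+n≡m (≮⇒≥ i≮k))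
    (∈-++⁺ˡ (∈-applyUpTo⁺ (λ j → g (j + k)) (+-cancelʳ-< k _ _
      (subst₂ _<_ (sym (m∸n+n≡m (≮⇒≥ i≮k))) (sym N≡) i<N))))

  length-ring : length (e ∷ after ++ before) ≡ N
  length-ring = trans (cong suc (trans (length-++ after)
    (cong₂ _+_ (length-applyUpTo (λ i → g (suc i + k)) r) (length-applyUpTo g k)))) N≡

  Convex : Set
  Convex = ∀ {i j l} → i < j → j < l → l < N → V (g i) ≡ true → V (g l) ≡ true → V (g j) ≡ true

  record Cut : Set where
    field
      us vs    : List (Vec Bool m)
      opened   : Opened us vs
      complete : ∀ y → y ∈ us ++ vs
      size     : length (us ++ vs) ≡ N
      blocked  : Convex → Block V (vs ++ us)

  -- The accepting positions form an interval that misses `k`, so they lie all before or all after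
  -- `k`, and reading the ring from `e` does not break them up.
  rejecting-start : Convex → V e ≡ false → Block V (e ∷ after ++ before)
  rejecting-start cvx rej with none-or-some {V = V} g k
  ... | inj₁ none = block-++ˡ {xs = e ∷ []} (rej ∷ [])
    (block-++ʳ (convex-block _ r (λ a b c → cvx (+-monoˡ-< k (s≤s a)) (+-monoˡ-< k (s≤s b)) (after< c))) none)
  ... | inj₂ (i , i<k , acc) = block-++ˡ {xs = e ∷ after} (rej ∷ All.applyUpTo⁺₁ _ r none)
    (convex-block g k (λ a b c → cvx a b (<-trans c k<N)))
    where
    none : ∀ {j} → j < r → V (g (suc j + k)) ≡ false
    none {j} l with V (g (suc j + k)) in eq
    ... | false = refl
    ... | true  = ⊥-elim (true≢false (cvx i<k (s≤s (m≤n+m k j)) (after< l) acc eq) rej)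

  cut-at-start : (∀ y → cut y e ≡ true) → (∀ y z → z ≢ e → cut y z ≡ false) →
                 V e ≡ false ⊎ (∀ y → V y ≡ true) → Cut
  cut-at-start hit miss trivial = record
    { us = e ∷ after ++ before ; vs = []
    ; opened = let u , w , r = seg⇒walk ring (linked-all {Q = λ y z → cut y z ≡ false × z ≢ e} (λ ne → miss _ _ ne , ne) away)
               in closing w r (hit u)
    ; complete = λ y → ∈-++⁺ˡ (ring-complete y)
    ; size = trans (cong length (++-identityʳ (e ∷ after ++ before))) length-ring
    ; blocked = blocked trivial
    }
    where
    blocked : V e ≡ false ⊎ (∀ y → V y ≡ true) → Convex → Block V (e ∷ after ++ before)
    blocked (inj₁ rej) cvx = rejecting-start cvx rej
    blocked (inj₂ acc) cvx = block {as = []} {cs = []} (sym (++-identityʳ _)) [] (All.universal acc _) []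

  -- As `e` accepts, `after` accepts first and then rejects, while `before` rejects first and then
  -- accepts. From `e` the ring is therefore accepting, rejecting, accepting, and the cut is the end
  -- of the first stretch; behind it come all rejecting strings, then all accepting ones.
  cut-at-boundary : (∀ y z → cut y z ≡ V y ∧ not (V z)) → V e ≡ true → (∃ λ y → V y ≡ false) → Convex → Cut
  cut-at-boundary cut≡ Ve (y₀ , rej₀) cvx
    with split-rejecting {V = V} g k (λ l l′ a → cvx l l′ k<N a Ve)
       | split-accepting {V = V} (λ i → g (suc i + k)) r
           (λ {i} l l′ a → cvx (s≤s (m≤n+m k i)) (+-monoˡ-< k (s≤s l)) (after< l′) Ve a)
  ... | as , bs , before≡ , rejᵃ , accᵇ | bs′ , gs , after≡ , accᵇ′ , rejᵍ = go (gs ++ as) refl (All.++⁺ rejᵍ rejᵃ)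
    where
    us = e ∷ bs′
    ring≡ : e ∷ after ++ before ≡ us ++ (gs ++ as) ++ bs
    ring≡ = cong (e ∷_) (trans (cong₂ _++_ after≡ before≡)
      (trans (++-assoc bs′ gs (as ++ bs)) (cong (bs′ ++_) (sym (++-assoc gs as bs)))))
    noncut : ∀ {y z} → V y ≡ false ⊎ V z ≡ true → cut y z ≡ false
    noncut {y} {z} (inj₁ p) = trans (cut≡ y z) (cong (_∧ not (V z)) p)
    noncut {y} {z} (inj₂ p) = trans (cut≡ y z) (trans (cong (λ b → V y ∧ not b) p) (Bool.∧-zeroʳ (V y)))
    go : ∀ rs → gs ++ as ≡ rs → All (λ y → V y ≡ false) rs → Cut
    -- An empty rejecting stretch would make `y₀` accept.
    go [] eq _ = ⊥-elim (true≢false (All.lookup (All.++⁺ (Ve ∷ accᵇ′) accᵇ)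
      (subst (y₀ ∈_) (trans ring≡ (cong (λ rs → us ++ rs ++ bs) eq)) (ring-complete y₀))) rej₀)
    go (v ∷ rs) eq (rejᵛ ∷ rejᵣ) with seg-split us (subst (Seg _⟶_ e e) (trans ring≡ (cong (λ rs → us ++ rs ++ bs) eq)) ring)
      | All.++⁻ bs′ (subst (All (_≢ e)) (trans (List.∷-injectiveʳ ring≡) (cong (λ rs → bs′ ++ rs ++ bs) eq)) away)
    ... | _ , segᵤ , segᵥ@(cons _ _) | awayᵤ , awayᵥ ∷ awayₛ
      with seg⇒walk segᵤ (linked-and (linked-rejecting noncut [] us refl [] (Ve ∷ accᵇ′))
                                     (linked-all {Q = λ _ z → z ≢ e} (λ ne → ne) awayᵤ))
         | seg⇒walk segᵥ (linked-and (linked-rejecting noncut (v ∷ rs) bs refl (rejᵛ ∷ rejᵣ) accᵇ)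
                                     (linked-all {Q = λ _ z → z ≢ e} (λ ne → ne) awayₛ))
    ... | u , walkᵤ , u⟶v | w , walkᵥ , w⟶e = record
      { us = us ; vs = v ∷ rs ++ bs
      ; opened = midway walkᵤ u⟶v (trans (cut≡ u v) (cong₂ (λ a b → a ∧ not b) (walk-all walkᵤ (Ve ∷ accᵇ′)) rejᵛ))
                   awayᵥ walkᵥ w⟶e (noncut (inj₂ Ve))
      ; complete = λ y → subst (y ∈_) ring≡′ (ring-complete y)
      ; size = trans (cong length (sym ring≡′)) length-ring
      ; blocked = λ _ → block {as = v ∷ rs} {bs ++ us} {[]}
          (trans (++-assoc (v ∷ rs) bs us) (cong ((v ∷ rs) ++_) (sym (++-identityʳ (bs ++ us)))))
          (rejᵛ ∷ rejᵣ) (All.++⁺ accᵇ (Ve ∷ accᵇ′)) []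
      }
      where
      ring≡′ : e ∷ after ++ before ≡ us ++ v ∷ rs ++ bs
      ring≡′ = trans ring≡ (cong (λ rs → us ++ rs ++ bs) eq)

-- The second case demands a rejecting string, for otherwise no edge would lead from accepting to
-- rejecting. In the first case, opening the ring at `e` is harmless because `e` rejects or
-- everything accepts.
Scenario : ∀ {m} → (Vec Bool m → Bool) → Vec Bool m → (Vec Bool m → Vec Bool m → Bool) → Set
Scenario V e cut =
    ((∀ y → cut y e ≡ true) × (∀ y z → z ≢ e → cut y z ≡ false) × (V e ≡ false ⊎ (∀ y → V y ≡ true)))
  ⊎ ((∀ y z → cut y z ≡ V y ∧ not (V z)) × V e ≡ true × ∃ λ y → V y ≡ false)

Interval : ∀ {n} → (Vec Bool n → Bool) → Perm n → Set
Interval V h = (∃ λ y → V y ≡ true) →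
  ∃₂ λ ℓ u → ∀ w → (V w ≡ true) ⇔' (app h ℓ ≤lex app h w × app h w ≤lex app h u)

module Linearise {m : ℕ} (h : Perm m) (nx : Vec Bool m → Vec Bool m → Bool)
  (circular : ∀ y z → (nx y z ≡ true) ⇔' (app h y ≺lex app h z ⊎ (app h y ≡ replicate m true × app h z ≡ replicate m false)))
  (V : Vec Bool m → Bool) (interval : Interval V h)
  (e : Vec Bool m) (cut : Vec Bool m → Vec Bool m → Bool) (sc : Scenario V e cut) where

  N : ℕ
  N = 2 ^ m

  0<N : 0 < N
  0<N = ≤-<-trans z≤n (rank< (replicate m false))

  position : Vec Bool m → ℕ
  position y = rank (app h y)

  position-injective : ∀ {y z} → position y ≡ position z → y ≡ z
  position-injective p = Bijection.injective h (rank-injective _ _ p)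

  position< : ∀ y → position y < N
  position< y = rank< (app h y)

  vertex : ℕ → Vec Bool m
  vertex i = proj₁ (Bijection.surjective h (unrank m i))

  position-vertex : ∀ {i} → i < N → position (vertex i) ≡ i
  position-vertex {i} l = trans (cong rank (proj₂ (Bijection.surjective h (unrank m i)) refl)) (rank-unrank m l)

  _⟶_ : Vec Bool m → Vec Bool m → Set
  y ⟶ z = nx y z ≡ true

  Next : ℕ → ℕ → Set
  Next i j = suc i ≡ j ⊎ (suc i ≡ N × j ≡ 0)

  ⟶⇒next : ∀ {y z} → y ⟶ z → Next (position y) (position z)
  ⟶⇒next {y} {z} p with proj₁ (circular y z) p
  ... | inj₁ l       = inj₁ (≺lex⇒suc _ _ l)
  ... | inj₂ (a , b) = inj₂ (trans (cong (suc ∘ rank) a) (rank-ones m) , trans (cong rank b) (rank-zeros m))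

  next⇒⟶ : ∀ {y z} → Next (position y) (position z) → y ⟶ z
  next⇒⟶ {y} {z} (inj₁ p) = proj₂ (circular y z) (inj₁ (suc⇒≺lex _ _ p))
  next⇒⟶ {y} {z} (inj₂ (a , b)) = proj₂ (circular y z) (inj₂
    (rank-injective _ _ (suc-injective (trans a (sym (rank-ones m)))) , rank-injective _ _ (trans b (sym (rank-zeros m)))))

  next-functional : ∀ {i j l} → j < N → l < N → Next i j → Next i l → j ≡ l
  next-functional _   _   (inj₁ refl)       (inj₁ refl)       = refl
  next-functional j<N _   (inj₁ refl)       (inj₂ (a , _))    = contradiction a (<⇒≢ j<N)
  next-functional _   l<N (inj₂ (a , _))    (inj₁ refl)       = contradiction a (<⇒≢ l<N)
  next-functional _   _   (inj₂ (_ , refl)) (inj₂ (_ , refl)) = refl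

  next-injective : ∀ {i j l} → Next i l → Next j l → i ≡ j
  next-injective (inj₁ p)       (inj₁ q)       = suc-injective (trans p (sym q))
  next-injective (inj₁ refl)    (inj₂ (_ , ()))
  next-injective (inj₂ (_ , ())) (inj₁ refl)
  next-injective (inj₂ (a , _)) (inj₂ (b , _)) = suc-injective (trans a (sym b))

  uniqueʳ : ∀ {a b c} → a ⟶ b → a ⟶ c → b ≡ c
  uniqueʳ p q = position-injective (next-functional (position< _) (position< _) (⟶⇒next p) (⟶⇒next q))

  uniqueˡ : ∀ {a b c} → a ⟶ c → b ⟶ c → a ≡ b
  uniqueˡ p q = position-injective (next-injective (⟶⇒next p) (⟶⇒next q))

  -- `g` has to close up at N, whereas `unrank` gives the intended string only below N.
  clamp : ℕ → ℕ
  clamp i with i <? N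
  ... | yes _ = i
  ... | no  _ = 0

  clamp-< : ∀ {i} → i < N → clamp i ≡ i
  clamp-< {i} l with i <? N
  ... | yes _ = refl
  ... | no ≮  = contradiction l ≮

  clamp-N : clamp N ≡ 0
  clamp-N with N <? N
  ... | yes l = contradiction l (<-irrefl refl)
  ... | no _  = refl

  g : ℕ → Vec Bool m
  g i = vertex (clamp i)

  position-g : ∀ {i} → i < N → position (g i) ≡ i
  position-g l = trans (cong (position ∘ vertex) (clamp-< l)) (position-vertex l)

  g-position : ∀ y → g (position y) ≡ y
  g-position y = position-injective (position-g (position< y))

  wrap : g N ≡ g 0
  wrap = cong vertex (trans clamp-N (sym (clamp-< 0<N)))

  g-edge : ∀ {i} → i < N → g i ⟶ g (suc i)
  g-edge {i} l with m≤n⇒m<n∨m≡n l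
  ... | inj₁ l′ = next⇒⟶ (inj₁ (trans (cong suc (position-g l)) (sym (position-g l′))))
  ... | inj₂ e′ = next⇒⟶ (inj₂ (trans (cong suc (position-g l)) e′ ,
                    trans (cong position (trans (cong g e′) wrap)) (position-g 0<N)))

  k : ℕ
  k = position e

  module Rg = Ring _⟶_ uniqueʳ uniqueˡ V cut N k (N ∸ suc k)
    (trans (sym (+-suc (N ∸ suc k) k)) (m∸n+n≡m (position< e))) g g-edge wrap
    (λ a b p → trans (sym (position-g a)) (trans (cong position p) (position-g b)))
    (λ y → position y , position< y , g-position y)

  convex : (∃ λ y → V y ≡ true) → Rg.Convex
  convex some {i} {j} {l} i<j j<l l<N Vi Vl with interval some
  ... | ℓ , u , iff = proj₂ (iff (g j))
    ( ≤⇒≤lex _ _ (≤-trans (≤lex⇒≤ (proj₁ (proj₁ (iff (g i)) Vi)))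
        (subst₂ _≤_ (sym (position-g (<-trans i<j j<N))) (sym (position-g j<N)) (<⇒≤ i<j)))
    , ≤⇒≤lex _ _ (≤-trans (subst₂ _≤_ (sym (position-g j<N)) (sym (position-g l<N)) (<⇒≤ j<l))
        (≤lex⇒≤ (proj₂ (proj₁ (iff (g l)) Vl)))))
    where
    j<N = <-trans j<l l<N

  ring-cut : Scenario V e cut → Rg.Cut
  ring-cut (inj₁ (hit , miss , trivial)) = Rg.cut-at-start
    (λ y → trans (cong (cut y) (g-position e)) (hit y)) (λ y z ne → miss y z (λ q → ne (trans q (sym (g-position e)))))
    (map₁ (trans (cong V (g-position e))) trivial)
  ring-cut (inj₂ (cut≡ , Ve , rej)) = Rg.cut-at-boundary cut≡ (trans (cong V (g-position e)) Ve) rej (convex (e , Ve))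

  module Ly = Layers _⟶_ uniqueʳ uniqueˡ

  -- The ring starts at `g k`, which equals `e` only propositionally. With the start as a parameter,
  -- a single transport at the end suffices.
  record Linear (e : Vec Bool m) : Set where
    field
      order     : Perm (2 + m)
      starts    : app order (ℓ₁ e) ≡ replicate (2 + m) false
      ends      : app order (ℓ₃ e) ≡ replicate (2 + m) true
      edges     : ∀ y z → Ly.Edge e cut y z ⇔' (app order y ≺lex app order z)
      intervals : Interval (Ly.lift e cut V) order

  linear : Linear e
  linear = subst Linear (g-position e) (record
    { order = order ; starts = order-start ; ends = order-end ; edges = order-edge
    ; intervals = λ (y , p) → order-interval (path-block us vs (blocked (convex (below y p)))) (y , p) })
    where
    open Rg.Cut (ring-cut sc)
    open Layers _⟶_ uniqueʳ uniqueˡ (g k) cut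
    below : ∀ y → lift V y ≡ true → ∃ λ y → V y ≡ true
    below (ℓ₀ y) p = y , p
    card : length (path us vs) ≡ 2 ^ (2 + m)
    card = trans (length-path us vs) (trans (cong (4 *_) size) (*-assoc 2 2 N))
    open FromTrail edge-uniqueʳ edge-uniqueˡ edge-sink edge-source (walk-path opened)
      (path-complete us vs complete) card

-- Decision procedures

Word : Set
Word = List Bool

Decides : {X : Set} → (X → Word) → (X → Bool) → Set
Decides f P = f ⇒ (λ v → P v ∷ [])

module _ {X : Set} {f : X → Word} where

  decides-if : ∀ {P Q R} → Decides f P → Decides f Q → Decides f R → Decides f (λ v → if P v then Q v else R v)
  decides-if {P} F G H = ⇒-cong (λ v → sym (Bool.if-float (_∷ []) (P v))) (⇒-if F G H)

  decides-const : ∀ t → Decides f (λ _ → t)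
  decides-const t = ⇒-const (t ∷ [])

  decides-∧ : ∀ {P Q} → Decides f P → Decides f Q → Decides f (λ v → P v ∧ Q v)
  decides-∧ {P} {Q} F G = ⇒-cong (λ v → cong (_∷ []) (if-∧ (P v) (Q v))) (decides-if F G (decides-const false))
    where
    if-∧ : ∀ a b → (if a then b else false) ≡ a ∧ b
    if-∧ true  b = refl
    if-∧ false b = refl

  decides-∨ : ∀ {P Q} → Decides f P → Decides f Q → Decides f (λ v → P v ∨ Q v)
  decides-∨ {P} {Q} F G = ⇒-cong (λ v → cong (_∷ []) (if-∨ (P v) (Q v))) (decides-if F (decides-const true) G)
    where
    if-∨ : ∀ a b → (if a then true else b) ≡ a ∨ b
    if-∨ true  b = refl
    if-∨ false b = refl

  decides-not : ∀ {P} → Decides f P → Decides f (λ v → not (P v))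
  decides-not {P} F = ⇒-cong (λ v → cong (_∷ []) (if-not (P v))) (decides-if F (decides-const false) (decides-const true))
    where
    if-not : ∀ a → (if a then false else true) ≡ not a
    if-not true  = refl
    if-not false = refl

  decides-same : ∀ {g h} → f ⇒ g → f ⇒ h → Decides f (λ v → sameWord (g v) (h v))
  decides-same G H = ⇒-pair G H ≫ ⇒-same

  apply₁ : ∀ {a k} → (λ (x : Word) → x) ⇒ k → f ⇒ a → f ⇒ (λ v → k (a v))
  apply₁ {a} K A = A ≫ reindex a K

pairs : Word × Word → Word
pairs v = pair (proj₁ v) (proj₂ v)

triples : Word × Word × Word → Word
triples v = triple (proj₁ v) (proj₁ (proj₂ v)) (proj₂ (proj₂ v))

Decides₂ : (Word → Word → Bool) → Set
Decides₂ P = Decides pairs (λ v → P (proj₁ v) (proj₂ v))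

Decides₃ : (Word → Word → Word → Bool) → Set
Decides₃ P = Decides triples (λ v → P (proj₁ v) (proj₁ (proj₂ v)) (proj₂ (proj₂ v)))

module _ {X : Set} {f : X → Word} where

  apply₂ : ∀ {a b} P → Decides₂ P → f ⇒ a → f ⇒ b → Decides f (λ v → P (a v) (b v))
  apply₂ {a} {b} P K A B = ⇒-pair A B ≫ reindex (λ v → a v , b v) K

  apply₃ : ∀ {a b c} P → Decides₃ P → f ⇒ a → f ⇒ b → f ⇒ c → Decides f (λ v → P (a v) (b v) (c v))
  apply₃ {a} {b} {c} P K A B C = ⇒-pair A (⇒-pair B C) ≫ reindex (λ v → a v , b v , c v) K

FP⇒ : ∀ {g} → FP g → (λ x → x) ⇒ g
FP⇒ (M , q , runs) = ⇒-runTM (M , q , runs)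

poly₁ : ∀ P → PolyPred P → Decides (λ x → x) P
poly₁ P (M , q , runs) = ⇒-runTM (M , q , runs)

poly₂ : ∀ P → PolyPred₂ P → Decides₂ P
poly₂ P (M , q , runs) = ⇒-runTM (M , q , λ v → runs (proj₁ v) (proj₂ v))

poly₃ : ∀ P → PolyPred₃ P → Decides₃ P
poly₃ P (M , q , runs) = ⇒-runTM (M , q , λ v → runs (proj₁ v) (proj₁ (proj₂ v)) (proj₂ (proj₂ v)))

polyPred₂ : ∀ P → Decides₂ P → PolyPred₂ P
polyPred₂ P F = let M , q , runs = computable F in M , q , λ x y → runs (x , y)

polyPred₃ : ∀ P → Decides₃ P → PolyPred₃ P
polyPred₃ P F = let M , q , runs = computable F in M , q , λ x y z → runs (x , y , z)

private
  tail₂ : Word × Word × Word → Word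
  tail₂ v = pair (proj₁ (proj₂ v)) (proj₂ (proj₂ v))

arg₁ : triples ⇒ (λ v → proj₁ v)
arg₁ = ⇒-fst {g = λ v → proj₁ v} {tail₂}

arg₂ : triples ⇒ (λ v → proj₁ (proj₂ v))
arg₂ = ⇒-snd {g = λ v → proj₁ v} {tail₂} ≫ ⇒-fst {g = λ v → proj₁ (proj₂ v)} {λ v → proj₂ (proj₂ v)}

arg₃ : triples ⇒ (λ v → proj₂ (proj₂ v))
arg₃ = ⇒-snd {g = λ v → proj₁ v} {tail₂} ≫ ⇒-snd {g = λ v → proj₁ (proj₂ v)} {λ v → proj₂ (proj₂ v)}

-- Counting

∈-allVecs : ∀ {n} (v : Vec Bool n) → v ∈ allVecs n
∈-allVecs []          = here refl
∈-allVecs (false ∷ v) = ∈-++⁺ˡ (∈-map⁺ (false ∷_) (∈-allVecs v))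
∈-allVecs {suc n} (true ∷ v) = ∈-++⁺ʳ (map (false ∷_) (allVecs n)) (∈-map⁺ (true ∷_) (∈-allVecs v))

length-allVecs : ∀ n → length (allVecs n) ≡ 2 ^ n
length-allVecs zero    = refl
length-allVecs (suc n) = trans (length-++ (map (false ∷_) (allVecs n)))
  (trans (cong₂ _+_ (length-map (false ∷_) (allVecs n)) (length-map (true ∷_) (allVecs n)))
    (trans (cong₂ _+_ (length-allVecs n) (length-allVecs n)) (sym (2^-suc n))))

module _ {n : ℕ} {P : Vec Bool n → Bool} where

  count-none : (∀ w → P w ≡ false) → ∀ ws → countTrue P ws ≡ 0
  count-none f []       = refl
  count-none f (w ∷ ws) rewrite f w = count-none f ws

  count-some : ∀ {w ws} → w ∈ ws → P w ≡ true → countTrue P ws ≢ 0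
  count-some (here refl) p c rewrite p with c
  ... | ()
  count-some {ws = v ∷ _} (there w∈) p c with P v
  ... | false = count-some w∈ p c
  count-some {ws = v ∷ _} (there w∈) p () | true

  count-witness : ∀ ws → countTrue P ws ≢ 0 → ∃ λ w → P w ≡ true
  count-witness []       c = contradiction refl c
  count-witness (w ∷ ws) c with P w in eq
  ... | true  = w , eq
  ... | false = count-witness ws c

  count-all : (∀ w → P w ≡ true) → ∀ ws → countTrue P ws ≡ length ws
  count-all f []       = refl
  count-all f (w ∷ ws) rewrite f w = cong suc (count-all f ws)

  count≤ : ∀ ws → countTrue P ws ≤ length ws
  count≤ []       = z≤n
  count≤ (w ∷ ws) with P w
  ... | true  = s≤s (count≤ ws)
  ... | false = m≤n⇒m≤1+n (count≤ ws)

  count-full : ∀ {w ws} → countTrue P ws ≡ length ws → w ∈ ws → P w ≡ true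
  count-full {ws = v ∷ ws} c w∈ with P v in eq
  count-full {ws = v ∷ ws} c (here refl) | true = eq
  count-full {ws = v ∷ ws} c (there w∈)  | true = count-full (suc-injective c) w∈
  count-full {ws = v ∷ ws} c w∈          | false = contradiction (count≤ ws) (<⇒≱ (≤-reflexive (sym c)))

  count-deficient : ∀ ws → countTrue P ws ≢ length ws → ∃ λ w → P w ≡ false
  count-deficient []       c = contradiction refl c
  count-deficient (w ∷ ws) c with P w in eq
  ... | true  = count-deficient ws (c ∘ cong suc)
  ... | false = w , eq

  count-++ : ∀ us vs → countTrue P (us ++ vs) ≡ countTrue P us + countTrue P vs
  count-++ []       vs = refl
  count-++ (u ∷ us) vs with P u
  ... | true  = cong suc (count-++ us vs)
  ... | false = count-++ us vs

count-map : ∀ {k n} (P : Vec Bool n → Bool) (f : Vec Bool k → Vec Bool n) ws →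
            countTrue P (map f ws) ≡ countTrue (P ∘ f) ws
count-map P f []       = refl
count-map P f (w ∷ ws) with P (f w)
... | true  = cong suc (count-map P f ws)
... | false = count-map P f ws

toList-injective : ∀ {n} (a b : Vec Bool n) → toList a ≡ toList b → a ≡ b
toList-injective []      []      p = refl
toList-injective (x ∷ a) (y ∷ b) p with List.∷-injective p
... | refl , q = cong (x ∷_) (toList-injective a b q)

zeros≤lex : ∀ {n} (a : Vec Bool n) → replicate n false ≤lex a
zeros≤lex []          = []≤
zeros≤lex (false ∷ a) = same false (zeros≤lex a)
zeros≤lex (true ∷ a)  = 0<1

≤lex-ones : ∀ {n} (a : Vec Bool n) → a ≤lex replicate n true
≤lex-ones []          = []≤
≤lex-ones (false ∷ a) = 0<1
≤lex-ones (true ∷ a)  = same true (≤lex-ones a)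

≤lex-trans : ∀ {n} {a b c : Vec Bool n} → a ≤lex b → b ≤lex c → a ≤lex c
≤lex-trans {a = a} {c = c} p q = ≤⇒≤lex a c (≤-trans (≤lex⇒≤ p) (≤lex⇒≤ q))

-- The two inclusions

module ToCircular {f : Word → ℕ} (W : CLU#P-witness f) where
  open CLU#P-witness W
  open BalancedNPTM M

  wrapped : Word → Word → Word → Bool
  wrapped x y z = prec x y z ∨ (sameWord y (t x) ∧ sameWord z (b x))

  wrapped-poly : PolyPred₃ wrapped
  wrapped-poly = polyPred₃ wrapped (decides-∨ (poly₃ prec prec-poly)
    (decides-∧ (decides-same arg₂ (apply₁ (FP⇒ t-FP) arg₁)) (decides-same arg₃ (apply₁ (FP⇒ b-FP) arg₁))))

  full : Word → Bool
  full x = V x (b x) ∧ V x (t x)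

  full-poly : PolyPred full
  full-poly = computable (decides-∧ (apply₂ V (poly₂ V V-poly) ⇒-id (FP⇒ b-FP)) (apply₂ V (poly₂ V V-poly) ⇒-id (FP⇒ t-FP)))

  module _ (x : Word) where

    n : ℕ
    n = eval p (length x)

    h : Perm n
    h = proj₁ (cond x)

    circular : ∀ y z → (wrapped x (toList y) (toList z) ≡ true) ⇔'
               (app h y ≺lex app h z ⊎ (app h y ≡ replicate n true × app h z ≡ replicate n false))
    circular y z with cond x
    ... | h , (bv , bv≡ , hb) , (tv , tv≡ , ht) , step , _ = to , from
      where
      to : wrapped x (toList y) (toList z) ≡ true →
           app h y ≺lex app h z ⊎ (app h y ≡ replicate n true × app h z ≡ replicate n false)
      to p with prec x (toList y) (toList z) in eq
      ... | true  = inj₁ (proj₁ (step y z) eq)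
      ... | false = inj₂
        ( trans (cong (app h) (toList-injective y tv (trans (sameWord-sound _ _ (Bool.∧-conicalˡ _ _ p)) (sym tv≡)))) ht
        , trans (cong (app h) (toList-injective z bv (trans (sameWord-sound _ _ (Bool.∧-conicalʳ _ _ p)) (sym bv≡)))) hb)
      from : app h y ≺lex app h z ⊎ (app h y ≡ replicate n true × app h z ≡ replicate n false) →
             wrapped x (toList y) (toList z) ≡ true
      from (inj₁ l) rewrite proj₂ (step y z) l = refl
      from (inj₂ (hy , hz))
        with Bijection.injective h (trans hy (sym ht)) | Bijection.injective h (trans hz (sym hb))
      ... | refl | refl rewrite sym tv≡ | sym bv≡ | sameWord-refl (toList y) | sameWord-refl (toList z) = Bool.∨-zeroʳ _

    full-correct : (full x ≡ true) ⇔' (f x ≡ 2 ^ n)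
    full-correct with cond x
    ... | h , (bv , bv≡ , hb) , (tv , tv≡ , ht) , _ , interval = to , from
      where
      to : full x ≡ true → f x ≡ 2 ^ n
      to p with interval (subst (_≢ 0) (sym (count x)) (count-some (∈-allVecs bv) Vb))
        where
        Vb : V x (toList bv) ≡ true
        Vb = trans (cong (V x) bv≡) (Bool.∧-conicalˡ _ _ p)
      ... | ℓ , u , iff = trans (count x) (trans (count-all all (allVecs n)) (length-allVecs n))
        where
        all : ∀ w → V x (toList w) ≡ true
        -- `h` sends `b x` to the least and `t x` to the greatest string, so an interval that
        -- contains both contains everything.
        all w = proj₂ (iff w)
          ( ≤lex-trans (proj₁ (proj₁ (iff bv) (trans (cong (V x) bv≡) (Bool.∧-conicalˡ _ _ p))))
              (subst (_≤lex app h w) (sym hb) (zeros≤lex _))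
          , ≤lex-trans (subst (app h w ≤lex_) (sym ht) (≤lex-ones _))
              (proj₂ (proj₁ (iff tv) (trans (cong (V x) tv≡) (Bool.∧-conicalʳ _ _ p)))))
      from : f x ≡ 2 ^ n → full x ≡ true
      from p = cong₂ _∧_ (trans (cong (V x) (sym bv≡)) (accepted bv)) (trans (cong (V x) (sym tv≡)) (accepted tv))
        where
        accepted : ∀ w → V x (toList w) ≡ true
        accepted w = count-full (trans (sym (count x)) (trans p (sym (length-allVecs n)))) (∈-allVecs w)

  circularWitness : CLU#P~circular f
  circularWitness = p , M , wrapped ,
    (wrapped-poly , (λ x → h x , circular x , proj₂ (proj₂ (proj₂ (proj₂ (cond x))))) , count) ,
    full , full-poly , full-correct

two-more : Poly → Poly
two-more p = (2 ∷ []) ⊕ p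

eval-two-more : ∀ p n → eval (two-more p) n ≡ 2 + eval p n
eval-two-more p n rewrite eval-⊕ (2 ∷ []) p n | *-zeroʳ n = refl

module FromCircular {f : Word → ℕ} {p : Poly} {M : BalancedNPTM p} {prec : Word → Word → Word → Bool}
                    (W : WitnessCircular f p M prec) {D : Word → Bool} (D-poly : PolyPred D)
                    (D-correct : ∀ x → (D x ≡ true) ⇔' (f x ≡ 2 ^ eval p (length x))) where
  open BalancedNPTM M

  prec-poly : PolyPred₃ prec
  prec-poly = proj₁ W

  count : ∀ x → f x ≡ #acc M x
  count = proj₂ (proj₂ W)

  -- For a path `e` this says that `e` accepts while some path rejects. Then exactly one edge of the
  -- ring leads from accepting to rejecting paths and can serve as the cut.
  boundary? : Word → Word → Bool
  boundary? x e = V x e ∧ not (D x)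

  cutAt : Word → Word → Word → Word → Bool
  cutAt x e y z = if boundary? x e then V x y ∧ not (V x z) else sameWord z e

  -- `i₁ i₀` and `j₁ j₀` are the layers of source and target; each innermost test states the
  -- premises of one constructor of `Layers.Edge`, with an equality test where both ends share their
  -- base string.
  edge : Bool → Bool → Bool → Bool → Word → Word → Word → Word → Bool
  edge i₁ i₀ j₁ j₀ x e y z =
    if i₁ then
      (if i₀ then
        (if j₁ then (if j₀ then prec x z y ∧ not (sameWord y e) else false) else false)
      else
        (if j₁ then (if j₀ then sameWord y z ∧ (prec x y e ∧ not (cutAt x e y e)) else false)
         else (if j₀ then prec x y z ∧ (not (cutAt x e y z) ∧ not (sameWord z e)) else prec x y z ∧ cutAt x e y z)))
    else
      (if i₀ then
        (if j₁ then (if j₀ then false else sameWord y z) else false)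
      else
        (if j₁ then (if j₀ then sameWord y z ∧ (prec x y e ∧ cutAt x e y e) else false)
         else (if j₀ then prec x y z ∧ (cutAt x e y z ∧ not (sameWord z e)) else prec x y z ∧ not (cutAt x e y z))))

  base : Word → Word
  base y = drop 1 (drop 1 y)

  -- The string `e` is taken from the length of the base of `y`: on paths it is 0...0 of length
  -- p(|x|), and the polynomial need not be evaluated here.
  layered : Word → Word → Word → Bool
  layered x y z = edge (headBit y) (headBit (drop 1 y)) (headBit z) (headBit (drop 1 z))
                       x (zeros (length (base y))) (base y) (base z)

  module _ {X : Set} {s : X → Word} {x e y z : X → Word} (F : s ⇒ x) (E : s ⇒ e) (G : s ⇒ y) (H : s ⇒ z) where

    decides-cutAt : Decides s (λ v → cutAt (x v) (e v) (y v) (z v))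
    decides-cutAt = decides-if
      (decides-∧ (apply₂ V (poly₂ V V-poly) F E) (decides-not (apply₁ (poly₁ D D-poly) F)))
      (decides-∧ (apply₂ V (poly₂ V V-poly) F G) (decides-not (apply₂ V (poly₂ V V-poly) F H)))
      (decides-same H E)

  module _ {X : Set} {s : X → Word} {i₁ i₀ j₁ j₀ : X → Bool} {x e y z : X → Word}
           (I₁ : Decides s i₁) (I₀ : Decides s i₀) (J₁ : Decides s j₁) (J₀ : Decides s j₀)
           (F : s ⇒ x) (E : s ⇒ e) (G : s ⇒ y) (H : s ⇒ z) where

    decides-edge : Decides s (λ v → edge (i₁ v) (i₀ v) (j₁ v) (j₀ v) (x v) (e v) (y v) (z v))
    decides-edge =
      decides-if I₁
        (decides-if I₀
          (decides-if J₁
            (decides-if J₀ (decides-∧ (apply₃ prec (poly₃ prec prec-poly) F H G) (decides-not (decides-same G E))) never) never)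
          (decides-if J₁ (decides-if J₀ (decides-∧ (decides-same G H) (decides-∧ toE (decides-not cutE))) never)
            (decides-if J₀ (decides-∧ next (decides-∧ (decides-not cutZ) (decides-not (decides-same H E)))) (decides-∧ next cutZ))))
        (decides-if I₀
          (decides-if J₁ (decides-if J₀ never (decides-same G H)) never)
          (decides-if J₁ (decides-if J₀ (decides-∧ (decides-same G H) (decides-∧ toE cutE)) never)
            (decides-if J₀ (decides-∧ next (decides-∧ cutZ (decides-not (decides-same H E)))) (decides-∧ next (decides-not cutZ)))))
      where
      never : Decides s (λ _ → false)
      never = decides-const false
      next = apply₃ prec (poly₃ prec prec-poly) F G H
      toE  = apply₃ prec (poly₃ prec prec-poly) F G E
      cutZ = decides-cutAt F E G H
      cutE = decides-cutAt F E G E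

  layered-poly : PolyPred₃ layered
  layered-poly = polyPred₃ layered (decides-edge (arg₂ ≫ ⇒-head) (arg₂ ≫ ⇒-tail ≫ ⇒-head) (arg₃ ≫ ⇒-head) (arg₃ ≫ ⇒-tail ≫ ⇒-head)
    arg₁ (arg₂ ≫ ⇒-tail ≫ ⇒-tail ≫ ⇒-zeros) (arg₂ ≫ ⇒-tail ≫ ⇒-tail) (arg₃ ≫ ⇒-tail ≫ ⇒-tail))

  V₀ : Word → Word → Bool
  V₀ x w = if headBit w then false else (if headBit (drop 1 w) then false else V x (base w))

  V₀-poly : PolyPred₂ V₀
  V₀-poly = polyPred₂ V₀ (decides-if (second ≫ ⇒-head) (decides-const false)
    (decides-if (second ≫ ⇒-tail ≫ ⇒-head) (decides-const false)
      (apply₂ V (poly₂ V V-poly) (⇒-fst {g = proj₁} {proj₂}) (second ≫ ⇒-tail ≫ ⇒-tail))))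
    where
    second : pairs ⇒ (λ v → proj₂ v)
    second = ⇒-snd {g = proj₁} {proj₂}

  M₀ : BalancedNPTM (two-more p)
  M₀ = record { V = V₀ ; V-poly = V₀-poly }

  -- Only the quarter of the strings with prefix 00 can accept, and there `V₀` is `V` on the
  -- remaining bits.
  count₀ : ∀ x → f x ≡ #acc M₀ x
  count₀ x = trans (count x) (sym (trans (cong (λ k → countTrue (V₀ x ∘ toList) (allVecs k)) (eval-two-more p (length x))) counts))
    where
    n = eval p (length x)
    A = allVecs n
    P : Vec Bool (2 + n) → Bool
    P w = V₀ x (toList w)
    half : ∀ i → countTrue P (map (i ∷_) (allVecs (suc n))) ≡
                 countTrue (λ w → P (i ∷ false ∷ w)) A + countTrue (λ w → P (i ∷ true ∷ w)) A
    half i = trans (count-map P (i ∷_) (allVecs (suc n))) (trans (count-++ (map (false ∷_) A) (map (true ∷_) A))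
      (cong₂ _+_ (count-map (P ∘ (i ∷_)) (false ∷_) A) (count-map (P ∘ (i ∷_)) (true ∷_) A)))
    counts : countTrue P (allVecs (2 + n)) ≡ #acc M x
    counts = trans (count-++ {P = P} (map (false ∷_) (allVecs (suc n))) (map (true ∷_) (allVecs (suc n))))
      (trans (cong₂ _+_ (half false) (half true))
        (trans (cong₂ (λ a b → countTrue (λ w → V x (toList w)) A + a + b)
          (count-none (λ _ → refl) A) (cong₂ _+_ (count-none (λ _ → refl) A) (count-none (λ _ → refl) A)))
          (trans (+-identityʳ _) (+-identityʳ _))))

  module _ (x : Word) where

    m : ℕ
    m = eval p (length x)

    h : Perm m
    h = proj₁ (proj₁ (proj₂ W) x)

    e : Vec Bool m
    e = replicate m false

    Vₓ : Vec Bool m → Bool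
    Vₓ y = V x (toList y)

    nx cut : Vec Bool m → Vec Bool m → Bool
    nx y z  = prec x (toList y) (toList z)
    cut y z = cutAt x (toList e) (toList y) (toList z)

    interval : Interval Vₓ h
    interval (y , acc) = proj₂ (proj₂ (proj₁ (proj₂ W) x)) (subst (_≢ 0) (sym (count x)) (count-some (∈-allVecs y) acc))

    sameVec-sound : ∀ {y z : Vec Bool m} → sameWord (toList y) (toList z) ≡ true → y ≡ z
    sameVec-sound q = toList-injective _ _ (sameWord-sound _ _ q)

    sameVec-complete : ∀ {y z : Vec Bool m} → y ≡ z → sameWord (toList y) (toList z) ≡ true
    sameVec-complete {y} refl = sameWord-refl (toList y)

    sameVec-apart : ∀ {y z : Vec Bool m} → y ≢ z → not (sameWord (toList y) (toList z)) ≡ true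
    sameVec-apart {y} {z} ne with sameWord (toList y) (toList z) in eq
    ... | true  = contradiction (sameVec-sound eq) ne
    ... | false = refl

    not-true : ∀ {b} → not b ≡ true → b ≡ false
    not-true {false} _ = refl

    not-false : ∀ {b} → b ≡ false → not b ≡ true
    not-false refl = refl

    sameVec-apart⁻ : ∀ {y z : Vec Bool m} → not (sameWord (toList y) (toList z)) ≡ true → y ≢ z
    sameVec-apart⁻ q y≡z = true≢false (sameVec-complete y≡z) (not-true q)

    -- Here the decision of f(x) = 2^p pays off: if `e` accepts, a positive answer makes every
    -- string accept, and a negative one yields by counting the rejecting string that the boundary
    -- case requires.
    scenario : Scenario Vₓ e cut
    scenario with Vₓ e in eqV | D x in eqD
    ... | true  | true  = inj₁ ((λ _ → sameWord-refl (toList e)) , (λ y z ne → not-true (sameVec-apart ne)) , inj₂ λ w →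
      count-full (trans (sym (count x)) (trans (proj₁ (D-correct x) eqD) (sym (length-allVecs m)))) (∈-allVecs w))
    ... | false | _     = inj₁ ((λ _ → sameWord-refl (toList e)) , (λ y z ne → not-true (sameVec-apart ne)) , inj₁ refl)
    ... | true  | false = inj₂ ((λ _ _ → refl) , refl , count-deficient (allVecs m) λ c →
      true≢false (proj₂ (D-correct x) (trans (count x) (trans c (length-allVecs m)))) eqD)

    open Linearise h nx (proj₁ (proj₂ (proj₁ (proj₂ W) x))) Vₓ interval e cut scenario
    open Linear linear
    open Ly using (1→2; 2→1; 2→0; 2→3; 0→0; 0→1; 0→3; 3→3)

    zeros≡e : ∀ (y : Vec Bool m) → zeros (length (toList y)) ≡ toList e
    zeros≡e y = trans (cong zeros (length-toList y)) (sym (toList-replicate m false))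

    eq : Vec Bool m → Vec Bool m → Bool
    eq y z = sameWord (toList y) (toList z)

    left : ∀ a {b} → a ∧ b ≡ true → a ≡ true
    left true _ = refl

    right : ∀ a {b} → a ∧ b ≡ true → b ≡ true
    right true q = q

    both : ∀ {a b} → a ≡ true → b ≡ true → a ∧ b ≡ true
    both refl q = q

    edge⇒ : ∀ y z → layered x (toList y) (toList z) ≡ true → Ly.Edge e cut y z
    edge⇒ (ℓ₀ y) (ℓ₀ z) q rewrite zeros≡e y = 0→0 (left (nx y z) q) (not-true (right (nx y z) q))
    edge⇒ (ℓ₀ y) (ℓ₁ z) q rewrite zeros≡e y =
      0→1 (left (nx y z) q) (left (cut y z) (right (nx y z) q)) (sameVec-apart⁻ (right (cut y z) (right (nx y z) q)))
    edge⇒ (ℓ₀ y) (ℓ₃ z) q rewrite zeros≡e y with sameVec-sound {y} {z} (left (eq y z) q)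
    ... | refl = 0→3 (left (nx y e) (right (eq y y) q)) (right (nx y e) (right (eq y y) q))
    edge⇒ (ℓ₁ y) (ℓ₂ z) q with sameVec-sound {y} {z} q
    ... | refl = 1→2
    edge⇒ (ℓ₂ y) (ℓ₀ z) q rewrite zeros≡e y = 2→0 (left (nx y z) q) (right (nx y z) q)
    edge⇒ (ℓ₂ y) (ℓ₁ z) q rewrite zeros≡e y =
      2→1 (left (nx y z) q) (not-true (left (not (cut y z)) (right (nx y z) q)))
          (sameVec-apart⁻ (right (not (cut y z)) (right (nx y z) q)))
    edge⇒ (ℓ₂ y) (ℓ₃ z) q rewrite zeros≡e y with sameVec-sound {y} {z} (left (eq y z) q)
    ... | refl = 2→3 (left (nx y e) (right (eq y y) q)) (not-true (right (nx y e) (right (eq y y) q)))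
    edge⇒ (ℓ₃ y) (ℓ₃ z) q rewrite zeros≡e y = 3→3 (left (nx z y) q) (sameVec-apart⁻ (right (nx z y) q))

    edge⇐ : ∀ y z → Ly.Edge e cut y z → layered x (toList y) (toList z) ≡ true
    edge⇐ _ _ (1→2 {y})           = sameWord-refl (toList y)
    edge⇐ _ _ (2→1 {y} {z} r c ne) rewrite zeros≡e y = both {nx y z} r (both {not (cut y z)} (not-false c) (sameVec-apart ne))
    edge⇐ _ _ (2→0 {y} {z} r c)    rewrite zeros≡e y = both {nx y z} r c
    edge⇐ _ _ (2→3 {y} r c)        rewrite zeros≡e y = both {eq y y} (sameWord-refl (toList y)) (both {nx y e} r (not-false c))
    edge⇐ _ _ (0→0 {y} {z} r c)    rewrite zeros≡e y = both {nx y z} r (not-false c)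
    edge⇐ _ _ (0→1 {y} {z} r c ne) rewrite zeros≡e y = both {nx y z} r (both {cut y z} c (sameVec-apart ne))
    edge⇐ _ _ (0→3 {y} r c)        rewrite zeros≡e y = both {eq y y} (sameWord-refl (toList y)) (both {nx y e} r c)
    edge⇐ _ _ (3→3 {y} {z} r ne)   rewrite zeros≡e y = both {nx z y} r (sameVec-apart ne)

    -- Stated for an arbitrary length `n`, because the value of `two-more p` equals `2 + m` only
    -- propositionally and the whole bundle is transported at once.
    Conditions : ℕ → Set
    Conditions n = Σ (Perm n) λ h →
      (Σ (Vec Bool n) λ bv → toList bv ≡ false ∷ true ∷ zeros m × app h bv ≡ replicate n false) ×
      (Σ (Vec Bool n) λ tv → toList tv ≡ true ∷ true ∷ zeros m × app h tv ≡ replicate n true) ×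
      (∀ (y z : Vec Bool n) → (layered x (toList y) (toList z) ≡ true) ⇔' (app h y ≺lex app h z)) ×
      (f x ≢ 0 → Σ (Vec Bool n) λ ℓ → Σ (Vec Bool n) λ u →
        ∀ w → (V₀ x (toList w) ≡ true) ⇔' (app h ℓ ≤lex app h w × app h w ≤lex app h u))

    lift≡ : ∀ w → Ly.lift e cut Vₓ w ≡ V₀ x (toList w)
    lift≡ (ℓ₀ y) = refl
    lift≡ (ℓ₁ y) = refl
    lift≡ (ℓ₂ y) = refl
    lift≡ (ℓ₃ y) = refl

    conditions : Conditions (2 + m)
    conditions = order ,
      (ℓ₁ e , cong (λ w → false ∷ true ∷ w) (toList-replicate m false) , starts) ,
      (ℓ₃ e , cong (λ w → true ∷ true ∷ w) (toList-replicate m false) , ends) ,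
      (λ y z → proj₁ (edges y z) ∘ edge⇒ y z , edge⇐ y z ∘ proj₂ (edges y z)) ,
      λ fx≢0 → let y , acc = count-witness (allVecs m) (subst (_≢ 0) (count x) fx≢0)
                   ℓ , u , iff = intervals (ℓ₀ y , acc)
               in ℓ , u , λ w → (λ q → proj₁ (iff w) (trans (lift≡ w) q)) , (λ q → trans (sym (lift≡ w)) (proj₂ (iff w) q))

  linearWitness : CLU#P-witness f
  linearWitness = record
    { p = two-more p ; M = M₀
    ; b = λ x → false ∷ true ∷ zeros (eval p (length x))
    ; t = λ x → true ∷ true ∷ zeros (eval p (length x))
    ; b-FP = computable (⇒-eval p ≫ ⇒-cons true ≫ ⇒-cons false)
    ; t-FP = computable (⇒-eval p ≫ ⇒-cons true ≫ ⇒-cons true)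
    ; prec = layered ; prec-poly = layered-poly
    ; cond = λ x → subst (Conditions x) (sym (eval-two-more p (length x))) (conditions x)
    ; count = count₀
    }

theorem5p4 : (f : List Bool → ℕ) → CLU#P~circular f ⇔' CLU#P f
theorem5p4 f =
  (λ (p , M , prec , W , D , D-poly , D-correct) → FromCircular.linearWitness {f} {p} {M} {prec} W D-poly D-correct) ,
  ToCircular.circularWitness
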